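{- Let $G$ be a finite simple $2$-degenerate graph with maximum degree at most $4$ and with $|E(G)|\geq 2|V(G)|-5$. Then $G$ has a $2$-linear coloring in which there is at most one monochromatic vertex.
   Context: A graph is $2$-degenerate if every subgraph of it has a vertex of degree at most $2$. A linear forest is a forest each of whose components is a path. A $2$-linear coloring of $G$ is a map $c:E(G)\to\{1,2\}$ such that each color class forms a linear forest. Given a $2$-linear coloring of $G$, a vertex is called monochromatic if it has degree exactly $2$ in $G$ and both edges incident with it receive the same color. -}

module Defs where

open import Data.Nat using (ℕ; zero; suc; _+_; _≤_; _<_; _∸_; _*_)
open import Data.Bool using (Bool; true; false; _∧_; if_then_else_)
open import Data.Fin using (Fin; toℕ)
open import Data.List using (List; []; _∷_; length; map; allFin)
open import Data.Nat.ListAction using (sum)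
open import Data.List.Relation.Unary.Unique.Propositional using (Unique)
open import Data.Product using (Σ; ∃; _×_; _,_)
open import Relation.Binary.PropositionalEquality using (_≡_; _≢_)
open import Relation.Nullary using (¬_)

record Graph (n : ℕ) : Set where
  field
    adj   : Fin n → Fin n → Bool
    sym   : ∀ u v → adj u v ≡ adj v u
    irrefl : ∀ v → adj v v ≡ false
open Graph public

countF : ∀ {n} → (Fin n → Bool) → ℕ
countF {n} p = sum (map (λ x → if p x then 1 else 0) (allFin n))

degR : ∀ {n} → (Fin n → Fin n → Bool) → Fin n → ℕ
degR R v = countF (R v)

deg : ∀ {n} → Graph n → Fin n → ℕ
deg G v = degR (adj G) v

numEdges : ∀ {n} → Graph n → ℕ
numEdges {n} G = sum (map (λ u → countF (λ v → if toℕ u Data.Nat.<ᵇ toℕ v then adj G u v else false)) (allFin n))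
  where import Data.Nat

record Subgraph {n : ℕ} (G : Graph n) : Set where
  field
    inS   : Fin n → Bool
    eH    : Fin n → Fin n → Bool
    eH-sym : ∀ u v → eH u v ≡ eH v u
    eH⊆G  : ∀ u v → eH u v ≡ true → adj G u v ≡ true
    eH-ends : ∀ u v → eH u v ≡ true → inS u ≡ true
open Subgraph public

TwoDegenerate : ∀ {n} → Graph n → Set
TwoDegenerate {n} G =
  (H : Subgraph G) → (∃ λ v → inS H v ≡ true) →
  ∃ λ v → inS H v ≡ true × degR (eH H) v ≤ 2

MaxDegLe : ∀ {n} → Graph n → ℕ → Set
MaxDegLe G d = ∀ v → deg G v ≤ d

PathIn : ∀ {n} → (Fin n → Fin n → Bool) → List (Fin n) → Set
PathIn R [] = Data.Unit.⊤
  where import Data.Unit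
PathIn R (x ∷ []) = Data.Unit.⊤
  where import Data.Unit
PathIn R (x ∷ y ∷ xs) = (R x y ≡ true) × PathIn R (y ∷ xs)

lastOr : ∀ {n} → Fin n → List (Fin n) → Fin n
lastOr d [] = d
lastOr d (y ∷ ys) = lastOr y ys

record Cycle {n : ℕ} (R : Fin n → Fin n → Bool) : Set where
  field
    vs     : List (Fin n)
    long   : 3 ≤ length vs
    distinct : Unique vs
    path   : PathIn R vs
    closes : ∀ x xs → vs ≡ x ∷ xs → R (lastOr x xs) x ≡ true

-- linear forest: acyclic with every vertex of degree ≤ 2
-- (equivalently: every component is a path)
LinearForest : ∀ {n} → (Fin n → Fin n → Bool) → Set
LinearForest {n} R = (∀ v → degR R v ≤ 2) × ¬ Cycle R

record EdgeColouring {n : ℕ} (G : Graph n) : Set where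
  field
    col : Fin n → Fin n → Fin 2
    col-sym : ∀ u v → adj G u v ≡ true → col u v ≡ col v u
open EdgeColouring public

_==F_ : Fin 2 → Fin 2 → Bool
Fin.zero ==F Fin.zero = true
Fin.suc Fin.zero ==F Fin.suc Fin.zero = true
_ ==F _ = false

colourClass : ∀ {n} {G : Graph n} → EdgeColouring G → Fin 2 → Fin n → Fin n → Bool
colourClass {G = G} c i u v = adj G u v ∧ (col c u v ==F i)

Is2Linear : ∀ {n} {G : Graph n} → EdgeColouring G → Set
Is2Linear c = ∀ i → LinearForest (colourClass c i)

Monochromatic : ∀ {n} (G : Graph n) → EdgeColouring G → Fin n → Set
Monochromatic G c v =
  deg G v ≡ 2 ×
  (∀ u w → adj G v u ≡ true → adj G v w ≡ true → col c v u ≡ col c v w)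

-- Put D = 4|V| − 2|E|, so that D is 6, 8 or 10; deleting a vertex of degree 2 does not change D.
-- We show that at most one monochromatic vertex is needed for D = 10 and none for D = 8, and that
-- for D = 6 every vertex u of degree less than 4 admits a colouring without monochromatic vertices
-- other than u, in which u is monochromatic unless its degree is odd.
--
-- For D = 8 and D = 10 apply induction on |V|. Vertices of degree at most 1, and vertices of
-- degree 2 with a neighbour of degree 3, are easily put back. Otherwise degeneracy of the subgraph
-- induced by the vertices of degree at least 3 gives a vertex u with two neighbours x, y of
-- degree 2. If x and y have distinct further neighbours x′, y′ ∉ {x, y}, replace x and y by a single
-- vertex z joined to x′ and y′. Given a colouring of the smaller graph, let xx′ and yy′ have the
-- colours of zx′ and zy′, and choose the colours of ux and uy: the colours can be chosen so that x
-- or y is monochromatic only if z or u was. The case x′ = y′ is similar. If x and y are adjacent,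
-- deleting them lowers D by 2; then u, which has degree 2 in the rest, should be monochromatic
-- there if D was 8, and nothing should be if D was 10.
--
-- For D = 6 the two colour classes have three components in all. Adding a vertex of degree 2
-- changes the list of the colours and ends of these three paths by simple rules, and up to
-- relabelling finitely many families of such lists are enough for all graphs.

module Submission where

open import Defs hiding (sym)

open import Data.Bool using (Bool; true; false; _∧_; _∨_; not; if_then_else_; T)
open import Data.Bool.ListAction using (any; all)
open import Data.Bool.Properties
  using (∧-comm; ∨-comm; ∧-zeroʳ; ∨-identityʳ; ¬-not; not-¬; not-injective; not-involutive; T-∧; T-∨; T-≡)
  renaming (_≟_ to _≟ᵇ_)
open import Data.Empty using (⊥; ⊥-elim)
open import Data.Fin using (Fin; zero; suc; toℕ)
open import Data.Fin.Properties using (_≟_; any?; toℕ-injective)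
open import Data.List using (List; []; _∷_; _++_; length; map; concatMap; upTo; allFin)
open import Data.List.Membership.Propositional using (_∈_; find; lose)
open import Data.List.Membership.Propositional.Properties
  using (∈-concatMap⁻; ∈-map⁻; ∈-++⁻; ∈-upTo⁺; ∈-allFin)
open import Data.List.Properties using (map-cong; map-tabulate)
open import Data.List.Relation.Unary.All using (All; []; _∷_)
import Data.List.Relation.Unary.All as All
open import Data.List.Relation.Unary.AllPairs using (_∷_)
open import Data.List.Relation.Unary.Any using (here; there)
import Data.List.Relation.Unary.Any as Any
open import Data.List.Relation.Unary.Any.Properties using (any⁻)
open import Data.List.Relation.Unary.Unique.Propositional using (Unique)
open import Data.Nat
  using (ℕ; zero; suc; _+_; _*_; _∸_; _≤_; _<_; z≤n; s≤s; s≤s⁻¹; _≡ᵇ_; _≤ᵇ_; _<ᵇ_; _≤?_)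
open import Data.Nat.ListAction using (sum)
open import Data.Nat.Properties hiding (_≟_)
import Data.Nat.Properties as ℕ
open import Algebra.Properties.CommutativeSemigroup +-commutativeSemigroup using (interchange)
open import Data.Nat.Solver using (module +-*-Solver)
open import Data.Product using (Σ; ∃; _×_; _,_; proj₁; proj₂)
open import Data.Sum using (_⊎_; inj₁; inj₂; [_,_]′)
open import Data.Unit using (tt)
open import Data.Vec using (Vec; []; _∷_; lookup)
open import Function using (_∘_; id; Equivalence; _⟨_⟩_)
open import Relation.Binary using (tri<; tri≈; tri>)
open import Relation.Binary.PropositionalEquality
open import Relation.Nullary using (¬_; Dec; yes; no; does)
open import Relation.Nullary.Decidable using (_×-dec_; dec-true; dec-false)

-- Acyclicity of a class is carried by cuts, that is, Boolean functions constant along the edges of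
-- the class. A new edge is harmless once a cut separates its ends, and in the fork with two equal
-- colours the side of u in such a cut decides which restored vertex may have both edges of that
-- colour.
--
-- The obstacle is D = 6. A pendant vertex or a triangle takes D from 8 to 6, and then a
-- monochromatic vertex is welcome at a prescribed place u only. The local replacements do not
-- control that place, so for D = 6 whole sets of realisable path lists are carried along. Two
-- linear forests with |E| edges in all have 2|V| - |E| = D/2 components, hence three.
--
-- If D = 6 and |V| ≥ 3, no vertex has degree below 2, since its deletion would push D below 6; so
-- these graphs grow from a single edge by vertices of degree 2. The deficiencies 4 - deg add up to
-- 6, are at most 2 as soon as |V| ≥ 3, and one of them is 2 by degeneracy. The patterns are 3+3
-- (the single edge, `type0`), 2+2+2 (`type1`), 2+2+1+1 (`type2`, `type3`) and 2+1+1+1+1 (`type4` to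
-- `type7`).

private
  variable
    n : ℕ
    X Y : Set

true≢false : true ≢ false
true≢false ()

∧-split : ∀ a {b} → a ∧ b ≡ true → a ≡ true × b ≡ true
∧-split true h = refl , h

-- Counting

bit : Bool → ℕ
bit b = if b then 1 else 0

∑ : (Fin n → ℕ) → ℕ
∑ {n} f = sum (map f (allFin n))

∑-cong : {f g : Fin n → ℕ} → (∀ x → f x ≡ g x) → ∑ f ≡ ∑ g
∑-cong {n} h = cong sum (map-cong h (allFin n))

∑-+ : (f g : Fin n → ℕ) → ∑ (λ x → f x + g x) ≡ ∑ f + ∑ g
∑-+ {n} f g = go (allFin n)
  where
  go : ∀ xs → sum (map (λ x → f x + g x) xs) ≡ sum (map f xs) + sum (map g xs)
  go []       = refl
  go (x ∷ xs) rewrite go xs = interchange (f x) (g x) _ _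

∑-* : (k : ℕ) (f : Fin n → ℕ) → ∑ (λ x → k * f x) ≡ k * ∑ f
∑-* {n} k f = go (allFin n)
  where
  go : ∀ xs → sum (map (λ x → k * f x) xs) ≡ k * sum (map f xs)
  go []       = sym (*-zeroʳ k)
  go (x ∷ xs) rewrite go xs = sym (*-distribˡ-+ k (f x) _)

∑-mono : {f g : Fin n → ℕ} → (∀ x → f x ≤ g x) → ∑ f ≤ ∑ g
∑-mono {n} {f} {g} h = go (allFin n)
  where
  go : ∀ xs → sum (map f xs) ≤ sum (map g xs)
  go []       = z≤n
  go (x ∷ xs) = +-mono-≤ (h x) (go xs)

∑-zero : ∀ n → ∑ {n} (λ _ → 0) ≡ 0
∑-zero n = go (allFin n)
  where
  go : (xs : List (Fin n)) → sum (map (λ _ → 0) xs) ≡ 0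
  go []       = refl
  go (x ∷ xs) = go xs

∑-suc : (f : Fin (suc n) → ℕ) → ∑ f ≡ f zero + ∑ (f ∘ suc)
∑-suc {n} f = cong (λ xs → f zero + sum xs)
  (trans (map-tabulate suc f) (sym (map-tabulate id (f ∘ suc))))

infix 7 _==_
_==_ : Fin n → Fin n → Bool
x == y = does (x ≟ y)

==-refl : (x : Fin n) → x == x ≡ true
==-refl x = dec-true (x ≟ x) refl

≢⇒== : {x y : Fin n} → x ≢ y → x == y ≡ false
≢⇒== {x = x} {y} = dec-false (x ≟ y)

ι : Fin n → Fin n → ℕ
ι a x = bit (x == a)

ι-same : (a : Fin n) → ι a a ≡ 1
ι-same a = cong bit (==-refl a)

ι-diff : {a x : Fin n} → x ≢ a → ι a x ≡ 0
ι-diff h = cong bit (≢⇒== h)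

∑-ι : (a : Fin n) → ∑ (ι a) ≡ 1
∑-ι {suc n} zero = trans (∑-suc {n} (ι zero)) (cong suc (∑-zero n))
∑-ι {suc n} (suc a) = trans (∑-suc {n} (ι (suc a))) (∑-ι a)

count-cong : {p q : Fin n → Bool} → (∀ x → p x ≡ q x) → countF p ≡ countF q
count-cong h = ∑-cong (λ x → cong bit (h x))

bit-mono : ∀ {a b} → (a ≡ true → b ≡ true) → bit a ≤ bit b
bit-mono {false} h = z≤n
bit-mono {true} h rewrite h refl = ≤-refl

count-mono : {p q : Fin n → Bool} → (∀ x → p x ≡ true → q x ≡ true) → countF p ≤ countF q
count-mono h = ∑-mono (λ x → bit-mono (h x))

_∖_ : (Fin n → Bool) → Fin n → Fin n → Bool
(p ∖ a) x = p x ∧ not (x == a)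

∖⇒ : (p : Fin n → Bool) {a x : Fin n} → (p ∖ a) x ≡ true → p x ≡ true × x ≢ a
∖⇒ p {a} {x} h with p x | x ≟ a
... | true | no x≢a = refl , x≢a

⇒∖ : (p : Fin n → Bool) {a x : Fin n} → p x ≡ true → x ≢ a → (p ∖ a) x ≡ true
⇒∖ p {a} {x} h x≢a rewrite h | ≢⇒== x≢a = refl

count-∖ : (p : Fin n → Bool) {a : Fin n} → p a ≡ true → countF p ≡ suc (countF (p ∖ a))
count-∖ p {a} pa = begin
  countF p                            ≡⟨ ∑-cong pointwise ⟩
  ∑ (λ x → ι a x + bit ((p ∖ a) x))   ≡⟨ ∑-+ (ι a) _ ⟩
  ∑ (ι a) + countF (p ∖ a)            ≡⟨ cong (_+ countF (p ∖ a)) (∑-ι a) ⟩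
  suc (countF (p ∖ a))                ∎
  where
  open ≡-Reasoning
  pointwise : ∀ x → bit (p x) ≡ ι a x + bit ((p ∖ a) x)
  pointwise x with x ≟ a
  ... | yes refl rewrite pa = refl
  ... | no _ with p x
  ...   | true  = refl
  ...   | false = refl

count≡0 : (p : Fin n → Bool) → countF p ≡ 0 → ∀ x → p x ≡ false
count≡0 p h x with p x in px
... | false = refl
... | true with () ← trans (sym h) (count-∖ p px)

count-none : (p : Fin n → Bool) → (∀ x → p x ≡ false) → countF p ≡ 0
count-none {n} p h = trans (count-cong h) (∑-zero n)

extract : (p : Fin n → Bool) {k : ℕ} → countF p ≡ suc k →
  ∃ λ a → p a ≡ true × countF (p ∖ a) ≡ k
extract {n} p h with any? (λ x → p x ≟ᵇ true)
... | yes (a , pa) = a , pa , suc-injective (trans (sym (count-∖ p pa)) h)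
... | no none with () ← trans (sym h) (count-none p (λ x → ¬-not (λ px → none (x , px))))

extract₁ : (p : Fin n → Bool) → countF p ≡ 1 →
  ∃ λ a → p a ≡ true × (∀ x → p x ≡ true → x ≡ a)
extract₁ p h with extract p h
... | a , pa , h₀ = a , pa , only
  where
  only : ∀ x → p x ≡ true → x ≡ a
  only x px with x ≟ a
  ... | yes e = e
  ... | no x≢a with () ← trans (sym (⇒∖ p px x≢a)) (count≡0 _ h₀ x)

extract₂ : (p : Fin n → Bool) → countF p ≡ 2 →
  ∃ λ a → ∃ λ b → a ≢ b × p a ≡ true × p b ≡ true × (∀ x → p x ≡ true → x ≡ a ⊎ x ≡ b)
extract₂ p h with extract p h
... | a , pa , h₁ with extract₁ (p ∖ a) h₁
...   | b , pb , only = a , b , (λ e → proj₂ (∖⇒ p pb) (sym e)) , pa , proj₁ (∖⇒ p pb) , one-of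
  where
  one-of : ∀ x → p x ≡ true → x ≡ a ⊎ x ≡ b
  one-of x px with x ≟ a
  ... | yes e   = inj₁ e
  ... | no x≢a = inj₂ (only x (⇒∖ p px x≢a))

-- Relations and bridges

Rel : ℕ → Set
Rel n = Fin n → Fin n → Bool

infix 4 _⊆ᴿ_ _≗ᴿ_
_⊆ᴿ_ _≗ᴿ_ : Rel n → Rel n → Set
R ⊆ᴿ S = ∀ u w → R u w ≡ true → S u w ≡ true
R ≗ᴿ S = ∀ u w → R u w ≡ S u w

Symmetric : Rel n → Set
Symmetric R = ∀ u w → R u w ≡ R w u

edge : Fin n → Fin n → Rel n
edge a b u w = u == a ∧ w == b ∨ u == b ∧ w == a

SameEdge : (a b u w : Fin n) → Set
SameEdge a b u w = (u ≡ a × w ≡ b) ⊎ (u ≡ b × w ≡ a)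

SameEdge-euclidean : {a b s t u w : Fin n} → SameEdge a b s t → SameEdge a b u w → SameEdge s t u w
SameEdge-euclidean (inj₁ (refl , refl)) e                    = e
SameEdge-euclidean (inj₂ (refl , refl)) (inj₁ (refl , refl)) = inj₂ (refl , refl)
SameEdge-euclidean (inj₂ (refl , refl)) (inj₂ (refl , refl)) = inj₁ (refl , refl)

edge⇒ : (a b : Fin n) {u w : Fin n} → edge a b u w ≡ true → SameEdge a b u w
edge⇒ a b {u} {w} h with u ≟ a | w ≟ b | u ≟ b | w ≟ a
... | yes p | yes q | _     | _     = inj₁ (p , q)
... | yes _ | no  _ | yes p | yes q = inj₂ (p , q)
... | no  _ | _     | yes p | yes q = inj₂ (p , q)

edge-refl : (a b : Fin n) → edge a b a b ≡ true
edge-refl a b rewrite ==-refl a | ==-refl b = refl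

edge-sym : (a b : Fin n) → Symmetric (edge a b)
edge-sym a b u w = trans (cong₂ _∨_ (∧-comm (u == a) _) (∧-comm (u == b) _)) (∨-comm (w == b ∧ u == a) _)

infixl 6 _⊕_
_⊕_ : Rel n → Fin n × Fin n → Rel n
(R ⊕ (a , b)) u w = R u w ∨ edge a b u w

⊕⇒ : (R : Rel n) {a b u w : Fin n} → (R ⊕ (a , b)) u w ≡ true → R u w ≡ true ⊎ SameEdge a b u w
⊕⇒ R {a} {b} {u} {w} h with R u w
... | true  = inj₁ refl
... | false = inj₂ (edge⇒ a b {u} {w} h)

deg-⊕ : {R : Rel n} {a b : Fin n} → Symmetric R → a ≢ b → R a b ≡ false →
  ∀ w → degR (R ⊕ (a , b)) w ≡ degR R w + (ι a w + ι b w)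
deg-⊕ {n} {R} {a} {b} R-sym a≢b Rab w = begin
  degR (R ⊕ (a , b)) w                                            ≡⟨ ∑-cong pointwise ⟩
  ∑ (λ x → bit (R w x) + (ι a w * ι b x + ι b w * ι a x))         ≡⟨ ∑-+ (bit ∘ R w) _ ⟩
  degR R w + ∑ (λ x → ι a w * ι b x + ι b w * ι a x)              ≡⟨ cong (degR R w +_) (∑-+ (λ x → ι a w * ι b x) _) ⟩
  degR R w + (∑ (λ x → ι a w * ι b x) + ∑ (λ x → ι b w * ι a x))  ≡⟨ cong (degR R w +_) (cong₂ _+_ (one a b) (one b a)) ⟩
  degR R w + (ι a w + ι b w)                                      ∎
  where
  open ≡-Reasoning
  one : ∀ s t → ∑ (λ x → ι s w * ι t x) ≡ ι s w
  one s t = trans (∑-* (ι s w) (ι t)) (trans (cong (ι s w *_) (∑-ι t)) (*-identityʳ _))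
  pointwise : ∀ x → bit ((R ⊕ (a , b)) w x) ≡ bit (R w x) + (ι a w * ι b x + ι b w * ι a x)
  pointwise x with w ≟ a | x ≟ b | w ≟ b | x ≟ a
  ... | yes refl | yes refl | yes e    | _        = ⊥-elim (a≢b e)
  ... | yes refl | yes refl | no _     | _        rewrite Rab = refl
  ... | yes refl | no _     | yes e    | _        = ⊥-elim (a≢b e)
  ... | yes refl | no _     | no _     | _        = cong bit (∨-identityʳ (R a x))
                                                      ⟨ trans ⟩ sym (+-identityʳ _)
  ... | no _     | _        | yes refl | yes refl rewrite R-sym b a | Rab = refl
  ... | no _     | _        | yes refl | no _     = cong bit (∨-identityʳ (R b x)) ⟨ trans ⟩ sym (+-identityʳ _)
  ... | no _     | _        | no _     | _        = cong bit (∨-identityʳ (R w x)) ⟨ trans ⟩ sym (+-identityʳ _)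

-- The cut witnesses that a and b lie in different components, without any notion of a walk.
Separated : Rel n → Fin n → Fin n → Set
Separated {n} R a b = ∃ λ (f : Fin n → Bool) →
  (∀ u w → R u w ≡ true → f u ≡ f w) × f a ≡ true × f b ≡ false

-- Every edge is a bridge; this is the form of acyclicity that survives the deletion of edges.
Acyclic : Rel n → Set
Acyclic {n} R = ∀ a b → R a b ≡ true → ∃ λ (f : Fin n → Bool) →
  (∀ u w → R u w ≡ true → f u ≡ f w ⊎ SameEdge a b u w) × f a ≢ f b

Acyclic-⊆ : {R S : Rel n} → R ⊆ᴿ S → Acyclic S → Acyclic R
Acyclic-⊆ R⊆S ac a b Rab with ac a b (R⊆S a b Rab)
... | f , const , fa≢fb = f , (λ u w Ruw → const u w (R⊆S u w Ruw)) , fa≢fb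

Separated-sym : {R : Rel n} {a b : Fin n} → Separated R a b → Separated R b a
Separated-sym (f , const , fa , fb) = not ∘ f , (λ u w Ruw → cong not (const u w Ruw)) , cong not fb , cong not fa

-- An isolated vertex is a side of a cut by itself; this is what makes pendant edges harmless.
Separated-isolated : {R : Rel n} → Symmetric R → {a b : Fin n} →
  (∀ w → R a w ≡ false) → b ≢ a → Separated R a b
Separated-isolated {R = R} R-sym {a} {b} Ra b≢a = (_== a) , const , ==-refl a , ≢⇒== b≢a
  where
  const : ∀ u w → R u w ≡ true → u == a ≡ w == a
  const u w h with u ≟ a | w ≟ a
  ... | yes _    | yes _    = refl
  ... | no _     | no _     = refl
  ... | yes refl | no _     with () ← trans (sym h) (Ra w)
  ... | no _     | yes refl with () ← trans (sym h) (trans (R-sym u a) (Ra u))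

-- On the side of the separator that does not contain the old edge, its cut function is made
-- constant, with the value it takes at the attached end of the new edge.
Acyclic-⊕ : {R : Rel n} {a b : Fin n} → Acyclic R → Separated R a b → Acyclic (R ⊕ (a , b))
Acyclic-⊕ {R = R} {a} {b} ac (g , g-const , ga , gb) s t Rst with ⊕⇒ R Rst
... | inj₂ e = g , const , differ e
  where
  const : ∀ u w → (R ⊕ (a , b)) u w ≡ true → g u ≡ g w ⊎ SameEdge s t u w
  const u w h with ⊕⇒ R h
  ... | inj₁ Ruw = inj₁ (g-const u w Ruw)
  ... | inj₂ e′  = inj₂ (SameEdge-euclidean e e′)
  differ : SameEdge a b s t → g s ≢ g t
  differ (inj₁ (refl , refl)) e with () ← trans (sym ga) (trans e gb)
  differ (inj₂ (refl , refl)) e with () ← trans (sym ga) (trans (sym e) gb)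
... | inj₁ Rst′ with ac s t Rst′ | g s in gs | g t in gt
...   | _ | true | false with () ← trans (sym gs) (trans (g-const s t Rst′) gt)
...   | _ | false | true with () ← trans (sym gs) (trans (g-const s t Rst′) gt)
...   | f , f-const , fs≢ft | true | true = h , const , λ e → fs≢ft (trans (sym (onTrue gs)) (trans e (onTrue gt)))
  where
  h : _ → Bool
  h x = if g x then f x else f a
  onTrue : ∀ {x} → g x ≡ true → h x ≡ f x
  onTrue e rewrite e = refl
  onFalse : ∀ {x} → g x ≡ false → h x ≡ f a
  onFalse e rewrite e = refl
  const : ∀ u w → (R ⊕ (a , b)) u w ≡ true → h u ≡ h w ⊎ SameEdge s t u w
  const u w e with ⊕⇒ R e
  ... | inj₂ (inj₁ (refl , refl)) = inj₁ (trans (onTrue ga) (sym (onFalse gb)))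
  ... | inj₂ (inj₂ (refl , refl)) = inj₁ (trans (onFalse gb) (sym (onTrue ga)))
  ... | inj₁ Ruw with g u in gu
  ...   | false = inj₁ (sym (onFalse (trans (sym (g-const u w Ruw)) gu)))
  ...   | true rewrite sym (g-const u w Ruw) | gu = f-const u w Ruw
...   | f , f-const , fs≢ft | false | false = h , const , λ e → fs≢ft (trans (sym (onFalse gs)) (trans e (onFalse gt)))
  where
  h : _ → Bool
  h x = if g x then f b else f x
  onTrue : ∀ {x} → g x ≡ true → h x ≡ f b
  onTrue e rewrite e = refl
  onFalse : ∀ {x} → g x ≡ false → h x ≡ f x
  onFalse e rewrite e = refl
  const : ∀ u w → (R ⊕ (a , b)) u w ≡ true → h u ≡ h w ⊎ SameEdge s t u w
  const u w e with ⊕⇒ R e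
  ... | inj₂ (inj₁ (refl , refl)) = inj₁ (trans (onTrue ga) (sym (onFalse gb)))
  ... | inj₂ (inj₂ (refl , refl)) = inj₁ (trans (onFalse gb) (sym (onTrue ga)))
  ... | inj₁ Ruw with g u in gu
  ...   | true = inj₁ (sym (onTrue (trans (sym (g-const u w Ruw)) gu)))
  ...   | false rewrite sym (g-const u w Ruw) | gu = f-const u w Ruw

-- Colourings with linear classes

same : Bool → Bool → Bool
same true  b = b
same false b = not b

same-refl : ∀ k → same k k ≡ true
same-refl true  = refl
same-refl false = refl

same-not : ∀ k → same k (not k) ≡ false
same-not true  = refl
same-not false = refl

same⇒≡ : ∀ {k l} → same k l ≡ true → k ≡ l
same⇒≡ {true}  {true}  _ = refl
same⇒≡ {false} {false} _ = refl

record Colouring (A : Rel n) : Set where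
  field
    colour     : Rel n
    colour-sym : Symmetric colour

  class : Bool → Rel n
  class k u w = A u w ∧ same k (colour u w)

  δ : Bool → Fin n → ℕ
  δ k = degR (class k)

  field
    δ≤2     : ∀ k w → δ k w ≤ 2
    acyclic : ∀ k → Acyclic (class k)

  class⇒ : ∀ {k u w} → class k u w ≡ true → A u w ≡ true
  class⇒ {k} {u} {w} h with A u w
  ... | true = refl

  class-sym : Symmetric A → ∀ k → Symmetric (class k)
  class-sym A-sym k u w = cong₂ _∧_ (A-sym u w) (cong (same k) (colour-sym u w))

  δ-sum : ∀ w → degR A w ≡ δ true w + δ false w
  δ-sum w = trans (∑-cong pointwise) (∑-+ (λ x → bit (class true w x)) (λ x → bit (class false w x)))
    where
    pointwise : ∀ x → bit (A w x) ≡ bit (class true w x) + bit (class false w x)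
    pointwise x with A w x | colour w x
    ... | false | _     = refl
    ... | true  | true  = refl
    ... | true  | false = refl

  δ-sum′ : ∀ k w → degR A w ≡ δ k w + δ (not k) w
  δ-sum′ true  w = δ-sum w
  δ-sum′ false w = trans (δ-sum w) (+-comm (δ true w) (δ false w))

  Mono : Fin n → Set
  Mono w = ∃ λ k → δ k w ≡ 2 × δ (not k) w ≡ 0

open Colouring public

-- The contribution of an edge ab of colour k to the degree of w in colour l. The same formula
-- counts the ends of a path, where a = b counts twice.
inc : Bool → Fin n → Fin n → Bool → Fin n → ℕ
inc k a b l w = if same k l then ι a w + ι b w else 0

record _▸_[_,_,_] {A : Rel n} (χ : Colouring A) (A′ : Rel n) (k : Bool) (a b : Fin n) : Set where
  field
    χ′     : Colouring A′
    δ′     : ∀ l w → δ χ′ l w ≡ δ χ l w + inc k a b l w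
    class′ : ∀ l u w → class χ′ l u w ≡ true → class χ l u w ≡ true ⊎ (k ≡ l × SameEdge a b u w)

-- The class of colour l after a new edge of colour k, at one pair of vertices: x is the old
-- adjacency, e the new edge, c the old colour. It serves both the addition and the removal of an
-- edge.
recolour : ∀ k l x e c → (e ≡ true → x ≡ false) →
  (x ∨ e) ∧ same l (if e then k else c) ≡ (if same k l then x ∧ same l c ∨ e else x ∧ same l c)
recolour k     l     true  true  c     h with () ← h refl
recolour true  true  false true  c     h = refl
recolour true  false false true  c     h = refl
recolour false true  false true  c     h = refl
recolour false false false true  c     h = refl
recolour k     l     x     false c     h rewrite ∨-identityʳ x | ∨-identityʳ (x ∧ same l c) with same k l
... | true  = refl
... | false = refl

-- A free place of colour k at both ends keeps the degrees at most 2, and the cut keeps the class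
-- acyclic; the class of the other colour does not change.
addEdge : {A A′ : Rel n} {a b : Fin n} → Symmetric A → a ≢ b → A a b ≡ false → A′ ≗ᴿ A ⊕ (a , b) →
  (χ : Colouring A) → ∀ k → δ χ k a ≤ 1 → δ χ k b ≤ 1 → Separated (class χ k) a b →
  χ ▸ A′ [ k , a , b ]
addEdge {n} {A} {A′} {a} {b} A-sym a≢b Aab A′≗ χ k ka kb sep = record
  { χ′ = record { colour = c′ ; colour-sym = c′-sym ; δ≤2 = le2 ; acyclic = ac }
  ; δ′ = degC
  ; class′ = λ l u w h → cl l u w (trans (sym (cls≗ l u w)) h) }
  where
  c′ : Rel n
  c′ u w = if edge a b u w then k else colour χ u w
  c′-sym : Symmetric c′
  c′-sym u w rewrite edge-sym a b u w | colour-sym χ u w = refl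
  C C′ : Bool → Rel n
  C′ l u w = A′ u w ∧ same l (c′ u w)
  C = class χ
  target : Bool → Rel n
  target l u w = if same k l then (C l ⊕ (a , b)) u w else C l u w
  none : ∀ {u w} → edge a b u w ≡ true → A u w ≡ false
  none {u} {w} h with edge⇒ a b {u} {w} h
  ... | inj₁ (refl , refl) = Aab
  ... | inj₂ (refl , refl) = trans (A-sym b a) Aab
  cls≗ : ∀ l → C′ l ≗ᴿ target l
  cls≗ l u w rewrite A′≗ u w = recolour k l (A u w) (edge a b u w) (colour χ u w) (none {u} {w})
  C-sym = class-sym χ A-sym
  Cab : ∀ l → C l a b ≡ false
  Cab l rewrite Aab = refl
  degT : ∀ l w → degR (target l) w ≡ δ χ l w + inc k a b l w
  degT l w with same k l
  ... | true  = deg-⊕ (C-sym l) a≢b (Cab l) w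
  ... | false = sym (+-identityʳ _)
  degC : ∀ l w → degR (C′ l) w ≡ δ χ l w + inc k a b l w
  degC l w = trans (count-cong (cls≗ l w)) (degT l w)
  small : ∀ {l} → k ≡ l → ∀ w → δ χ l w + (ι a w + ι b w) ≤ 2
  small {l} refl w with w ≟ a | w ≟ b
  ... | yes refl | yes e = ⊥-elim (a≢b e)
  ... | yes refl | no _  = +-monoˡ-≤ 1 ka
  ... | no _ | yes refl  = +-monoˡ-≤ 1 kb
  ... | no _ | no _      rewrite +-identityʳ (δ χ l w) = δ≤2 χ l w
  le2 : ∀ l w → degR (C′ l) w ≤ 2
  le2 l w rewrite degC l w with same k l in e
  ... | true  = small (same⇒≡ e) w
  ... | false rewrite +-identityʳ (δ χ l w) = δ≤2 χ l w
  acT : ∀ l → Acyclic (target l)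
  acT l with same k l in e
  ... | false = acyclic χ l
  ... | true with refl ← same⇒≡ {k} e = Acyclic-⊕ (acyclic χ l) sep
  ac : ∀ l → Acyclic (C′ l)
  ac l = Acyclic-⊆ (λ u w h → trans (sym (cls≗ l u w)) h) (acT l)
  cl : ∀ l u w → target l u w ≡ true → C l u w ≡ true ⊎ (k ≡ l × SameEdge a b u w)
  cl l u w h with same k l in e
  ... | false = inj₁ h
  ... | true with ⊕⇒ (C l) h
  ...   | inj₁ p = inj₁ p
  ...   | inj₂ p = inj₂ (same⇒≡ e , p)

Bool-ext : ∀ {x y} → (x ≡ true → y ≡ true) → (y ≡ true → x ≡ true) → x ≡ y
Bool-ext {true}  {_}     f g = sym (f refl)
Bool-ext {false} {true}  f g = g refl
Bool-ext {false} {false} f g = refl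

inc-off : ∀ k {a b w : Fin n} l → w ≢ a → w ≢ b → inc k a b l w ≡ 0
inc-off k l wa wb with same k l
... | true rewrite ι-diff wa | ι-diff wb = refl
... | false = refl

inc-left : ∀ k {a b : Fin n} l → a ≢ b → inc k a b l a ≡ bit (same k l)
inc-left k {a} l ab with same k l
... | true rewrite ι-same a | ι-diff ab = refl
... | false = refl

inc-right : ∀ k {a b : Fin n} l → a ≢ b → inc k a b l b ≡ bit (same k l)
inc-right k {a} {b} l ab with same k l
... | true rewrite ι-same b | ι-diff (ab ∘ sym) = refl
... | false = refl

-- Deletion and addition of a vertex

infixl 6 _⊖_
_⊖_ : Rel n → Fin n → Rel n
(A ⊖ v) u w = not (u == v) ∧ (A u ∖ v) w

⊖⇒ : (A : Rel n) (v : Fin n) {u w : Fin n} → (A ⊖ v) u w ≡ true → A u w ≡ true × u ≢ v × w ≢ v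
⊖⇒ A v {u} {w} h with u ≟ v
... | no u≢v with ∖⇒ (A u) h
...   | Auw , w≢v = Auw , u≢v , w≢v

⇒⊖ : (A : Rel n) (v : Fin n) {u w : Fin n} → A u w ≡ true → u ≢ v → w ≢ v → (A ⊖ v) u w ≡ true
⇒⊖ A v {u} {w} h u≢v w≢v rewrite ≢⇒== u≢v = ⇒∖ (A u) h w≢v

record Simple (A : Rel n) : Set where
  field
    symm   : Symmetric A
    irr    : ∀ v → A v v ≡ false

  adj⇒≢ : ∀ {u w} → A u w ≡ true → u ≢ w
  adj⇒≢ {u} h refl with () ← trans (sym h) (irr u)

  flip : ∀ {u w} → A u w ≡ true → A w u ≡ true
  flip {u} {w} h = trans (symm w u) h

open Simple public

⊖-simple : {A : Rel n} → Simple A → ∀ v → Simple (A ⊖ v)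
⊖-simple {A = A} S v = record
  { symm = λ u w → Bool-ext (fl u w) (fl w u)
  ; irr  = λ u → ¬-not (λ h → adj⇒≢ S (proj₁ (⊖⇒ A v {u} {u} h)) refl) }
  where
  fl : ∀ u w → (A ⊖ v) u w ≡ true → (A ⊖ v) w u ≡ true
  fl u w h with ⊖⇒ A v {u} {w} h
  ... | Auw , u≢v , w≢v = ⇒⊖ A v (flip S Auw) w≢v u≢v

⊖-isolates : (A : Rel n) (v : Fin n) → ∀ w → (A ⊖ v) v w ≡ false
⊖-isolates A v w rewrite ==-refl v = refl

⊖-⊆ : (A : Rel n) (v : Fin n) → A ⊖ v ⊆ᴿ A
⊖-⊆ A v u w h = proj₁ (⊖⇒ A v {u} {w} h)

Nbr₁ : Rel n → (v a : Fin n) → Set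
Nbr₁ A v a = A v a ≡ true × (∀ w → A v w ≡ true → w ≡ a)

Nbr₂ : Rel n → (v a b : Fin n) → Set
Nbr₂ A v a b = a ≢ b × A v a ≡ true × A v b ≡ true × (∀ w → A v w ≡ true → w ≡ a ⊎ w ≡ b)

⊕-⊇ : (R : Rel n) (a b : Fin n) {u w : Fin n} → R u w ≡ true → (R ⊕ (a , b)) u w ≡ true
⊕-⊇ R a b h rewrite h = refl

⊕-∋ : (R : Rel n) {a b u w : Fin n} → SameEdge a b u w → (R ⊕ (a , b)) u w ≡ true
⊕-∋ R {a} {b} (inj₁ (refl , refl)) rewrite edge-refl a b with R a b
... | true = refl
... | false = refl
⊕-∋ R {a} {b} (inj₂ (refl , refl)) rewrite edge-sym a b b a | edge-refl a b with R b a
... | true = refl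
... | false = refl

rebuild₁ : {A : Rel n} → Simple A → ∀ {v a} → Nbr₁ A v a → A ≗ᴿ A ⊖ v ⊕ (v , a)
rebuild₁ {A = A} S {v} {a} (va , only) u w = Bool-ext forth back
  where
  forth : A u w ≡ true → (A ⊖ v ⊕ (v , a)) u w ≡ true
  forth h = cases (u ≟ v) (w ≟ v)
    where
    cases : Dec (u ≡ v) → Dec (w ≡ v) → (A ⊖ v ⊕ (v , a)) u w ≡ true
    cases (yes refl) _          = ⊕-∋ (A ⊖ v) {v} {a} {u} {w} (inj₁ (refl , only w h))
    cases (no _)     (yes refl) = ⊕-∋ (A ⊖ v) {v} {a} {u} {w} (inj₂ (only u (flip S h) , refl))
    cases (no u≢v)   (no w≢v)   = ⊕-⊇ (A ⊖ v) v a {u} {w} (⇒⊖ A v h u≢v w≢v)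
  back : (A ⊖ v ⊕ (v , a)) u w ≡ true → A u w ≡ true
  back h with ⊕⇒ (A ⊖ v) {v} {a} {u} {w} h
  ... | inj₁ h′                  = ⊖-⊆ A v u w h′
  ... | inj₂ (inj₁ (refl , refl)) = va
  ... | inj₂ (inj₂ (refl , refl)) = flip S va

rebuild₂ : {A : Rel n} → Simple A → ∀ {v a b} → Nbr₂ A v a b → A ≗ᴿ A ⊖ v ⊕ (v , a) ⊕ (v , b)
rebuild₂ {A = A} S {v} {a} {b} (a≢b , va , vb , only) u w = Bool-ext forth back
  where
  B = A ⊖ v ⊕ (v , a)
  forth : A u w ≡ true → (B ⊕ (v , b)) u w ≡ true
  forth h = cases (u ≟ v) (w ≟ v)
    where
    cases : Dec (u ≡ v) → Dec (w ≡ v) → (B ⊕ (v , b)) u w ≡ true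
    cases (no u≢v) (no w≢v) = ⊕-⊇ B v b {u} {w} (⊕-⊇ (A ⊖ v) v a {u} {w} (⇒⊖ A v h u≢v w≢v))
    cases (yes refl) _ with only w h
    ... | inj₁ e = ⊕-⊇ B v b {u} {w} (⊕-∋ (A ⊖ v) {v} {a} {u} {w} (inj₁ (refl , e)))
    ... | inj₂ e = ⊕-∋ B {v} {b} {u} {w} (inj₁ (refl , e))
    cases (no _) (yes refl) with only u (flip S h)
    ... | inj₁ e = ⊕-⊇ B v b {u} {w} (⊕-∋ (A ⊖ v) {v} {a} {u} {w} (inj₂ (e , refl)))
    ... | inj₂ e = ⊕-∋ B {v} {b} {u} {w} (inj₂ (e , refl))
  back : (B ⊕ (v , b)) u w ≡ true → A u w ≡ true
  back h with ⊕⇒ B {v} {b} {u} {w} h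
  ... | inj₂ (inj₁ (refl , refl)) = vb
  ... | inj₂ (inj₂ (refl , refl)) = flip S vb
  ... | inj₁ h′ with ⊕⇒ (A ⊖ v) {v} {a} {u} {w} h′
  ...   | inj₁ h″                  = ⊖-⊆ A v u w h″
  ...   | inj₂ (inj₁ (refl , refl)) = va
  ...   | inj₂ (inj₂ (refl , refl)) = flip S va

restrict : {A B : Rel n} → B ⊆ᴿ A → (χ : Colouring A) →
  ∃ λ (ψ : Colouring B) → colour ψ ≡ colour χ × (∀ k → class ψ k ⊆ᴿ class χ k)
restrict {A = A} {B} B⊆A χ = record
  { colour     = colour χ
  ; colour-sym = colour-sym χ
  ; δ≤2        = λ k w → ≤-trans (count-mono {p = C k w} {q = class χ k w} (sub k w)) (δ≤2 χ k w)
  ; acyclic    = λ k → Acyclic-⊆ (sub k) (acyclic χ k) } , refl , sub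
  where
  C : Bool → Rel _
  C k u w = B u w ∧ same k (colour χ u w)
  sub : ∀ k → C k ⊆ᴿ class χ k
  sub k u w h with B u w in e
  ... | true rewrite B⊆A u w e = h

δ-removeEdge : {A A′ : Rel n} {a b : Fin n} → Symmetric A → a ≢ b → A a b ≡ false → A′ ≗ᴿ A ⊕ (a , b) →
  (χ : Colouring A) (χ′ : Colouring A′) → colour χ ≡ colour χ′ →
  ∀ l w → δ χ′ l w ≡ δ χ l w + inc (colour χ′ a b) a b l w
δ-removeEdge {A = A} {A′} {a} {b} A-sym a≢b Aab A′≗ χ χ′ same-colour l w =
  trans (count-cong (cls≗ w)) degT
  where
  k = colour χ′ a b
  target : Rel _
  target u w = if same k l then (class χ l ⊕ (a , b)) u w else class χ l u w
  col-e : ∀ u w → colour χ′ u w ≡ (if edge a b u w then k else colour χ u w)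
  col-e u w with edge a b u w in e
  ... | false = cong (λ c → c u w) (sym same-colour)
  ... | true with edge⇒ a b {u} {w} e
  ...   | inj₁ (refl , refl) = refl
  ...   | inj₂ (refl , refl) = colour-sym χ′ b a
  none : ∀ u w → edge a b u w ≡ true → A u w ≡ false
  none u w h with edge⇒ a b {u} {w} h
  ... | inj₁ (refl , refl) = Aab
  ... | inj₂ (refl , refl) = trans (A-sym b a) Aab
  cls≗ : class χ′ l ≗ᴿ target
  cls≗ u w = trans (cong₂ (λ x c → x ∧ same l c) (A′≗ u w) (col-e u w))
    (recolour k l (A u w) (edge a b u w) (colour χ u w) (none u w))
  degT : degR target w ≡ δ χ l w + inc k a b l w
  degT with same k l
  ... | true  = deg-⊕ (class-sym χ A-sym l) a≢b (cong (_∧ _) Aab) w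
  ... | false = sym (+-identityʳ _)

record Extends {A A′ : Rel n} (χ : Colouring A) (χ′ : Colouring A′) (v : Fin n)
    (i : Bool) (a : Fin n) (j : Bool) (b : Fin n) : Set where
  field
    δ″     : ∀ l w → δ χ′ l w ≡ δ χ l w + (inc i v a l w + inc j v b l w)
    class″ : ∀ l u w → class χ′ l u w ≡ true →
      class χ l u w ≡ true ⊎ (i ≡ l × SameEdge v a u w) ⊎ (j ≡ l × SameEdge v b u w)

open Extends public

⊕-sym : {R : Rel n} → Symmetric R → ∀ {a b} → Symmetric (R ⊕ (a , b))
⊕-sym R-sym {a} {b} u w = cong₂ _∨_ (R-sym u w) (edge-sym a b u w)

≗-simple : {A B : Rel n} → A ≗ᴿ B → Simple B → Simple A
≗-simple A≗B S = record
  { symm = λ u w → trans (A≗B u w) (trans (symm S u w) (sym (A≗B w u)))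
  ; irr  = λ v → trans (A≗B v v) (irr S v) }

isolated-δ : {A : Rel n} (χ : Colouring A) {v : Fin n} → (∀ w → A v w ≡ false) → ∀ k → δ χ k v ≡ 0
isolated-δ χ {v} h k = count-none (class χ k v) (λ w → cong (_∧ same k (colour χ v w)) (h w))

δ≡0⇒ : {A : Rel n} (χ : Colouring A) (k : Bool) {v : Fin n} → δ χ k v ≡ 0 → ∀ w → class χ k v w ≡ false
δ≡0⇒ χ k {v} = count≡0 (class χ k v)

-- The vertex v joins the side of a, which is its only possible neighbour in S.
Separated-extend : {R S : Rel n} {v a b : Fin n} → v ≢ b → (∀ w → R v w ≡ false) → Symmetric R →
  (∀ u w → S u w ≡ true → R u w ≡ true ⊎ SameEdge v a u w) → a ≢ v →
  Separated R a b → Separated S v b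
Separated-extend {R = R} {S} {v} {a} {b} v≢b Rv R-sym S⇒ a≢v (f , const , fa , fb) =
  g , g-const , g-v , trans (g-off (v≢b ∘ sym)) fb
  where
  g : _ → Bool
  g x = if x == v then true else f x
  g-v : g v ≡ true
  g-v rewrite ==-refl v = refl
  g-off : ∀ {x} → x ≢ v → g x ≡ f x
  g-off h rewrite ≢⇒== h = refl
  g-const : ∀ u w → S u w ≡ true → g u ≡ g w
  g-const u w h with S⇒ u w h
  ... | inj₂ (inj₁ (refl , refl)) = trans g-v (sym (trans (g-off a≢v) fa))
  ... | inj₂ (inj₂ (refl , refl)) = sym (trans g-v (sym (trans (g-off a≢v) fa)))
  ... | inj₁ Ruw = trans (g-off λ { refl → true≢false (trans (sym Ruw) (Rv w)) })
                     (trans (const u w Ruw) (sym (g-off λ { refl → true≢false (trans (sym Ruw) (trans (R-sym u v) (Rv u))) })))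

module _ {A A₀ : Rel n} (S : Simple A) {v : Fin n} (A₀≗ : A₀ ≗ᴿ A ⊖ v) where

  private
    S₀ : Simple A₀
    S₀ = ≗-simple A₀≗ (⊖-simple S v)

    v-isolated : ∀ w → A₀ v w ≡ false
    v-isolated w = trans (A₀≗ v w) (⊖-isolates A v w)

    ⊕-≗ : ∀ {B B′ : Rel n} {e} → B ≗ᴿ B′ → B ⊕ e ≗ᴿ B′ ⊕ e
    ⊕-≗ h u w = cong (_∨ _) (h u w)

    ≗-trans : ∀ {B B′ B″ : Rel n} → B ≗ᴿ B′ → B″ ≗ᴿ B′ → B″ ≗ᴿ B
    ≗-trans h h′ u w = trans (h′ u w) (sym (h u w))

  ⊖-base : A₀ ⊆ᴿ A
  ⊖-base u w h = ⊖-⊆ A v u w (trans (sym (A₀≗ u w)) h)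

  δ-absent : (χ : Colouring A₀) → ∀ k → δ χ k v ≡ 0
  δ-absent χ = isolated-δ χ v-isolated

  attach₁ : ∀ {a} → Nbr₁ A v a → (χ : Colouring A₀) → ∀ i → δ χ i a ≤ 1 → χ ▸ A [ i , v , a ]
  attach₁ {a} N@(va , _) χ i ia = addEdge (symm S₀) (adj⇒≢ S va) (v-isolated a)
    (≗-trans (⊕-≗ A₀≗) (rebuild₁ S N)) χ i
    (subst (_≤ 1) (sym (δ-absent χ i)) z≤n) ia
    (Separated-isolated (class-sym χ (symm S₀) i) (δ≡0⇒ χ i (δ-absent χ i)) (adj⇒≢ S va ∘ sym))

  -- If i and j differ, each class receives only a pendant edge at v. If they agree, the two edges
  -- join the components of a and b, which therefore have to be different.
  attach₂ : ∀ {a b} → Nbr₂ A v a b → (χ : Colouring A₀) → ∀ i j → δ χ i a ≤ 1 → δ χ j b ≤ 1 →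
    (i ≡ j → Separated (class χ i) a b) → ∃ λ (χ′ : Colouring A) → Extends χ χ′ v i a j b
  attach₂ {a} {b} N@(a≢b , va , vb , _) χ i j ia jb sep = χ₂ , record
    { δ″ = λ l w → trans (δ₂ l w) (trans (cong (_+ _) (δ₁ l w)) (+-assoc (δ χ l w) _ _))
    ; class″ = λ l u w h → [ (λ h′ → [ inj₁ , inj₂ ∘ inj₁ ]′ (cl₁ l u w h′)) , inj₂ ∘ inj₂ ]′ (cl₂ l u w h) }
    where
    v≢a = adj⇒≢ S va
    v≢b = adj⇒≢ S vb
    e₁ : χ ▸ (A₀ ⊕ (v , a)) [ i , v , a ]
    e₁ = addEdge (symm S₀) v≢a (v-isolated a) (λ _ _ → refl) χ i
      (subst (_≤ 1) (sym (δ-absent χ i)) z≤n) ia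
      (Separated-isolated (class-sym χ (symm S₀) i) (δ≡0⇒ χ i (δ-absent χ i)) (v≢a ∘ sym))
    open _▸_[_,_,_] e₁ renaming (χ′ to χ₁; δ′ to δ₁; class′ to cl₁)
    A₁-sym = ⊕-sym (symm S₀) {v} {a}
    v-sep : ∀ j → (i ≡ j → Separated (class χ i) a b) → Separated (class χ₁ j) v b
    v-sep j sep with same i j in e
    ... | true with refl ← same⇒≡ {i} e = Separated-extend v≢b (δ≡0⇒ χ i (δ-absent χ i))
      (class-sym χ (symm S₀) i)
      (λ u w h → [ inj₁ , inj₂ ∘ proj₂ ]′ (cl₁ i u w h)) (v≢a ∘ sym) (sep refl)
    ... | false = Separated-isolated (class-sym χ₁ A₁-sym j)
      (δ≡0⇒ χ₁ j (trans (δ₁ j v) (trans (cong₂ _+_ (δ-absent χ j) (trans (inc-left i j v≢a) (cong bit e))) refl)))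
      (v≢b ∘ sym)
    jv : δ χ₁ j v ≤ 1
    jv rewrite δ₁ j v | δ-absent χ j | inc-left i j v≢a with same i j
    ... | true = ≤-refl
    ... | false = z≤n
    jb₁ : δ χ₁ j b ≤ 1
    jb₁ rewrite δ₁ j b | inc-off i j (v≢b ∘ sym) (a≢b ∘ sym) | +-identityʳ (δ χ j b) = jb
    vb₁ : (A₀ ⊕ (v , a)) v b ≡ false
    vb₁ = ¬-not λ h → [ (λ h′ → ⊥-elim (true≢false (trans (sym h′) (v-isolated b))))
                      , [ a≢b ∘ sym ∘ proj₂ , v≢a ∘ proj₁ ]′ ]′ (⊕⇒ A₀ {v} {a} {v} {b} h)
    e₂ : χ₁ ▸ A [ j , v , b ]
    e₂ = addEdge A₁-sym v≢b vb₁ (≗-trans (⊕-≗ (⊕-≗ A₀≗)) (rebuild₂ S N)) χ₁ j jv jb₁ (v-sep j sep)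
    open _▸_[_,_,_] e₂ renaming (χ′ to χ₂; δ′ to δ₂; class′ to cl₂)

  -- The converse of `attach₂`. If both edges at v have colour i, the bridge cut of va leaves v and
  -- b on one side, because vb is another edge of the class; so it separates a from b when v is
  -- gone.
  detach₂ : ∀ {a b} → Nbr₂ A v a b → (χ : Colouring A) → let i = colour χ v a ; j = colour χ v b in
    ∃ λ (ψ : Colouring A₀) →
      (∀ l w → δ χ l w ≡ δ ψ l w + (inc i v a l w + inc j v b l w)) ×
      (i ≡ j → Separated (class ψ i) a b)
  detach₂ {a} {b} N@(a≢b , va , vb , _) χ = ψ , deg₂ , sep
    where
    v≢a = adj⇒≢ S va
    v≢b = adj⇒≢ S vb
    i = colour χ v a
    j = colour χ v b
    B = A₀ ⊕ (v , a)
    A≗ : A ≗ᴿ B ⊕ (v , b)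
    A≗ = ≗-trans (⊕-≗ (⊕-≗ A₀≗)) (rebuild₂ S N)
    ψ  = proj₁ (restrict ⊖-base χ)
    B⊆A : B ⊆ᴿ A
    B⊆A u w h = trans (A≗ u w) (⊕-⊇ B v b {u} {w} h)
    ψ₁ = proj₁ (restrict B⊆A χ)
    vb₁ : B v b ≡ false
    vb₁ = ¬-not λ h → [ (λ h′ → ⊥-elim (true≢false (trans (sym h′) (v-isolated b))))
                      , [ a≢b ∘ sym ∘ proj₂ , v≢a ∘ proj₁ ]′ ]′ (⊕⇒ A₀ {v} {a} {v} {b} h)
    deg₂ : ∀ l w → δ χ l w ≡ δ ψ l w + (inc i v a l w + inc j v b l w)
    deg₂ l w = trans (δ-removeEdge (⊕-sym (symm S₀) {v} {a}) v≢b vb₁ A≗ ψ₁ χ refl l w)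
      (trans (cong (_+ inc j v b l w) (δ-removeEdge (symm S₀) v≢a (v-isolated a) (λ _ _ → refl) ψ ψ₁ refl l w))
        (+-assoc (δ ψ l w) _ _))
    edge∈ : ∀ {x} → A v x ≡ true → class χ (colour χ v x) v x ≡ true
    edge∈ {x} h rewrite h = same-refl (colour χ v x)
    sep : i ≡ j → Separated (class ψ i) a b
    sep i≡j with acyclic χ i v a (edge∈ va)
    ... | f , const , fv≢fa = separate (f a) refl
      where
      fv≡fb : f v ≡ f b
      fv≡fb with const v b (subst (λ k → class χ k v b ≡ true) (sym i≡j) (edge∈ vb))
      ... | inj₁ e                = e
      ... | inj₂ (inj₁ (_ , b≡a)) = ⊥-elim (a≢b (sym b≡a))
      ... | inj₂ (inj₂ (v≡a , _)) = ⊥-elim (v≢a v≡a)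
      const₀ : ∀ u w → class ψ i u w ≡ true → f u ≡ f w
      const₀ u w h with const u w (proj₂ (proj₂ (restrict ⊖-base χ)) i u w h)
      ... | inj₁ e = e
      ... | inj₂ (inj₁ (refl , refl)) with () ← trans (sym (class⇒ ψ {i} {u} {w} h)) (v-isolated w)
      ... | inj₂ (inj₂ (refl , refl)) with () ← trans (sym (class⇒ ψ {i} {u} {w} h)) (trans (symm S₀ u v) (v-isolated u))
      separate : ∀ t → f a ≡ t → Separated (class ψ i) a b
      separate true fa = f , const₀ , fa , ¬-not (λ fb → fv≢fa (trans fv≡fb (trans fb (sym fa))))
      separate false fa = not ∘ f , (λ u w h → cong not (const₀ u w h)) , cong not fa ,
        cong not (trans (sym fv≡fb) (¬-not (λ fv → fv≢fa (trans fv (sym fa)))))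

-- Degenerate graphs

-- Twice the number of edges.
‖_‖ : Rel n → ℕ
‖ A ‖ = ∑ (degR A)

‖‖-cong : {A B : Rel n} → A ≗ᴿ B → ‖ A ‖ ≡ ‖ B ‖
‖‖-cong h = ∑-cong (λ w → count-cong (h w))

‖⊕‖ : {R : Rel n} {a b : Fin n} → Symmetric R → a ≢ b → R a b ≡ false → ‖ R ⊕ (a , b) ‖ ≡ 2 + ‖ R ‖
‖⊕‖ {R = R} {a} {b} R-sym a≢b Rab = begin
  ‖ R ⊕ (a , b) ‖                          ≡⟨ ∑-cong (deg-⊕ R-sym a≢b Rab) ⟩
  ∑ (λ w → degR R w + (ι a w + ι b w))     ≡⟨ ∑-+ (degR R) _ ⟩
  ‖ R ‖ + ∑ (λ w → ι a w + ι b w)          ≡⟨ cong (‖ R ‖ +_) (trans (∑-+ (ι a) (ι b)) (cong₂ _+_ (∑-ι a) (∑-ι b))) ⟩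
  ‖ R ‖ + 2                                ≡⟨ +-comm ‖ R ‖ 2 ⟩
  2 + ‖ R ‖                                ∎
  where open ≡-Reasoning

⊖-fresh : (A : Rel n) {v a b : Fin n} → v ≢ a → b ≢ a → (A ⊖ v ⊕ (v , a)) v b ≡ false
⊖-fresh A {v} {a} {b} v≢a b≢a rewrite ⊖-isolates A v b | ≢⇒== b≢a | ≢⇒== v≢a | ∧-zeroʳ (v == v) = refl

⊖-vacuous : {A : Rel n} → Simple A → ∀ {v} → (∀ w → A v w ≡ false) → A ≗ᴿ A ⊖ v
⊖-vacuous {A = A} S {v} none u w = Bool-ext
  (λ h → ⇒⊖ A v h (λ { refl → true≢false (trans (sym h) (none w)) })
                  (λ { refl → true≢false (trans (sym (flip S h)) (none u)) }))
  (⊖-⊆ A v u w)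

‖⊖‖₁ : {A : Rel n} → Simple A → ∀ {v a} → Nbr₁ A v a → ‖ A ‖ ≡ 2 + ‖ A ⊖ v ‖
‖⊖‖₁ {A = A} S {v} {a} N@(va , _) = trans (‖‖-cong (rebuild₁ S N))
  (‖⊕‖ (symm (⊖-simple S v)) (adj⇒≢ S va) (⊖-isolates A v a))

‖⊖‖₂ : {A : Rel n} → Simple A → ∀ {v a b} → Nbr₂ A v a b → ‖ A ‖ ≡ 4 + ‖ A ⊖ v ‖
‖⊖‖₂ {A = A} S {v} {a} {b} N@(a≢b , va , vb , _) = trans (‖‖-cong (rebuild₂ S N))
  (trans (‖⊕‖ (⊕-sym (symm (⊖-simple S v)) {v} {a}) (adj⇒≢ S vb) (⊖-fresh A (adj⇒≢ S va) (a≢b ∘ sym)))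
    (cong (2 +_) (‖⊕‖ (symm (⊖-simple S v)) (adj⇒≢ S va) (⊖-isolates A v a))))

-- Only vertex sets P occur because the induced subgraph has the largest degrees among the subgraphs
-- on P. In this form the property passes to every subrelation.
Degenerate : Rel n → Set
Degenerate {n} A = (P : Fin n → Bool) → (∃ λ v → P v ≡ true) →
  ∃ λ v → P v ≡ true × countF (λ w → A v w ∧ P w) ≤ 2

-- Deleted vertices stay in `Fin n` as isolated points outside W, so nothing is ever renumbered;
-- `countF W` plays the part of |V|.
record GraphOn (A : Rel n) (W : Fin n → Bool) : Set where
  field
    simple     : Simple A
    inside     : ∀ u w → A u w ≡ true → W u ≡ true
    maxDegree  : ∀ v → degR A v ≤ 4
    degenerate : Degenerate A

  inside₂ : ∀ u w → A u w ≡ true → W w ≡ true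
  inside₂ u w h = inside w u (flip simple h)

  low : ∀ {m} → countF W ≡ suc m → ∃ λ v → W v ≡ true × degR A v ≤ 2
  low h with extract W h
  ... | a , Wa , _ with degenerate W (a , Wa)
  ...   | v , Wv , le = v , Wv , subst (_≤ 2) (count-cong pointwise) le
    where
    pointwise : ∀ w → A v w ∧ W w ≡ A v w
    pointwise w with A v w in e
    ... | false = refl
    ... | true  = inside₂ v w e

open GraphOn public

deg-mono : {A B : Rel n} → A ⊆ᴿ B → ∀ v → degR A v ≤ degR B v
deg-mono {A = A} {B} sub v = count-mono {p = A v} {q = B v} (sub v)

∧-mono : ∀ {a b c} → (a ≡ true → b ≡ true) → a ∧ c ≡ true → b ∧ c ≡ true
∧-mono {true} f h rewrite f refl = h

Degenerate-⊆ : {A B : Rel n} → A ⊆ᴿ B → Degenerate B → Degenerate A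
Degenerate-⊆ {A = A} {B} sub dgn P ne with dgn P ne
... | v , Pv , le = v , Pv , ≤-trans
  (count-mono {p = λ w → A v w ∧ P w} {q = λ w → B v w ∧ P w} (λ w → ∧-mono (sub v w))) le

delete : {A : Rel n} {W : Fin n → Bool} → GraphOn A W → ∀ v → GraphOn (A ⊖ v) (W ∖ v)
delete {A = A} {W} G v = record
  { simple     = ⊖-simple (simple G) v
  ; inside     = λ u w h → let Auw , u≢v , _ = ⊖⇒ A v {u} {w} h in ⇒∖ W (inside G u w Auw) u≢v
  ; maxDegree  = λ u → ≤-trans (deg-mono (⊖-⊆ A v) u) (maxDegree G u)
  ; degenerate = Degenerate-⊆ (⊖-⊆ A v) (degenerate G) }

data Low (A : Rel n) (v : Fin n) : Set where
  low₀ : (∀ w → A v w ≡ false) → Low A v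
  low₁ : ∀ {a} → Nbr₁ A v a → Low A v
  low₂ : ∀ {a b} → Nbr₂ A v a b → Low A v

classify : (A : Rel n) (v : Fin n) → degR A v ≤ 2 → Low A v
classify A v h with degR A v in e
... | 0 = low₀ (count≡0 (A v) e)
... | 1 with extract₁ (A v) e
...   | a , N = low₁ N
classify A v h | 2 with extract₂ (A v) e
...   | a , b , N = low₂ N
classify A v (s≤s (s≤s ())) | suc (suc (suc _))

singleton-empty : {A : Rel n} {W : Fin n → Bool} → GraphOn A W → countF W ≡ 1 → ∀ u w → A u w ≡ false
singleton-empty {A = A} {W} G h u w = ¬-not λ Auw →
  let _ , _ , only = extract₁ W h in
  adj⇒≢ (simple G) Auw (trans (only u (inside G u w Auw)) (sym (only w (inside₂ G u w Auw))))

empty-‖‖ : {A : Rel n} → (∀ u w → A u w ≡ false) → ‖ A ‖ ≡ 0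
empty-‖‖ {n} {A} h = trans (∑-cong (λ u → count-none (A u) (h u))) (∑-zero n)

countW : (W : Fin n → Bool) {v : Fin n} {m : ℕ} → W v ≡ true → countF W ≡ suc m → countF (W ∖ v) ≡ m
countW W Wv h = suc-injective (trans (sym (count-∖ W Wv)) h)

-- Deleting a vertex of degree at most 2 takes at most 4 from `‖ A ‖` and exactly 4 from the right
-- side. The induction stops at two vertices, where a single edge gives equality.
edge-bound : ∀ m {A : Rel n} {W : Fin n → Bool} → GraphOn A W → countF W ≡ suc (suc m) →
  6 + ‖ A ‖ ≤ suc (suc m) * 4
edge-bound m {A} {W} G h with low G h
... | v , Wv , le = go m (countW W Wv h) (classify A v le)
  where
  S = simple G
  go : ∀ m → countF (W ∖ v) ≡ suc m → Low A v → 6 + ‖ A ‖ ≤ suc (suc m) * 4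
  go zero h′ L with singleton-empty (delete G v) h′
  ... | none with L
  ...   | low₀ N rewrite ‖‖-cong (⊖-vacuous S N) | empty-‖‖ none = m≤m+n 6 2
  ...   | low₁ N rewrite ‖⊖‖₁ S N | empty-‖‖ none = ≤-refl
  ...   | low₂ {a} {b} (a≢b , va , vb , _) = ⊥-elim (a≢b (trans (only a (∈ a va)) (sym (only b (∈ b vb)))))
    where
    only = proj₂ (proj₂ (extract₁ (W ∖ v) h′))
    ∈ : ∀ x → A v x ≡ true → (W ∖ v) x ≡ true
    ∈ x vx = ⇒∖ W (inside₂ G v x vx) (adj⇒≢ S vx ∘ sym)
  go (suc m) h′ L with edge-bound m (delete G v) h′
  ... | ih with L
  ...   | low₀ N rewrite ‖‖-cong (⊖-vacuous S N) = m≤n⇒m≤o+n 4 ih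
  ...   | low₁ N rewrite ‖⊖‖₁ S N = +-mono-≤ (m≤m+n 2 2) ih
  ...   | low₂ N rewrite ‖⊖‖₂ S N = +-monoʳ-≤ 4 ih

-- Graphs with 2|V| − 3 edges

Path State : Set → Set
Path X  = Bool × X × X
State X = Path X × Path X × Path X

mapPath : (X → Y) → Path X → Path Y
mapPath f (c , a , b) = c , f a , f b

mapState : (X → Y) → State X → State Y
mapState f (p , q , r) = mapPath f p , mapPath f q , mapPath f r

reversed inverted : Path X → Path X
reversed (c , a , b) = c , b , a
inverted (c , a , b) = not c , a , b

ends : Bool → Fin n → Path (Fin n) → ℕ
ends k w (c , a , b) = inc c a b k w

-- Paths are known only by their ends, and a later addition may start from any of them, so one cut
-- records the sides of all four.
Apart : {A : Rel n} → Colouring A → Path (Fin n) → Path (Fin n) → Set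
Apart {n} χ (c , a , b) (c′ , a′ , b′) = c ≡ c′ → ∃ λ (f : Fin n → Bool) →
  (∀ u w → class χ c u w ≡ true → f u ≡ f w) ×
  f a ≡ true × f b ≡ true × f a′ ≡ false × f b′ ≡ false

-- If 6 + ‖ A ‖ ≡ 4 |W|, the two colour classes, as spanning subgraphs of W, have exactly three
-- components in all, and these are paths, possibly of length 0; p, q and r are their colours and ends.
record Real {A : Rel n} (W : Fin n → Bool) (χ : Colouring A) (p q r : Path (Fin n)) : Set where
  field
    count : ∀ k w → δ χ k w + (ends k w p + (ends k w q + ends k w r)) ≡ (if W w then 2 else 0)
    apart₁₂ : Apart χ p q
    apart₁₃ : Apart χ p r
    apart₂₃ : Apart χ q r

open Real

Realised : (A : Rel n) (W : Fin n → Bool) → State (Fin n) → Set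
Realised A W (p , q , r) = ∃ λ (χ : Colouring A) → Real W χ p q r

module _ {A : Rel n} {W : Fin n → Bool} {χ : Colouring A} where

  Apart-sym : ∀ p q → Apart χ p q → Apart χ q p
  Apart-sym _ _ apart refl with apart refl
  ... | f , const , a , b , a′ , b′ = not ∘ f , (λ u w h → cong not (const u w h)) ,
    cong not a′ , cong not b′ , cong not a , cong not b

  swap₁₂ : ∀ {p q r} → Real W χ p q r → Real W χ q p r
  swap₁₂ {p} {q} {r} R = record
    { count   = λ k w → trans (cong (δ χ k w +_) (exchange (ends k w q) (ends k w p) _)) (count R k w)
    ; apart₁₂ = Apart-sym p q (apart₁₂ R)
    ; apart₁₃ = apart₂₃ R
    ; apart₂₃ = apart₁₃ R }
    where
    exchange : ∀ x y z → x + (y + z) ≡ y + (x + z)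
    exchange x y z = trans (sym (+-assoc x y z)) (trans (cong (_+ z) (+-comm x y)) (+-assoc y x z))

  swap₂₃ : ∀ {p q r} → Real W χ p q r → Real W χ p r q
  swap₂₃ {p} {q} {r} R = record
    { count   = λ k w → trans (cong (λ x → δ χ k w + (ends k w p + x)) (+-comm (ends k w r) _)) (count R k w)
    ; apart₁₂ = apart₁₃ R
    ; apart₁₃ = apart₁₂ R
    ; apart₂₃ = Apart-sym q r (apart₂₃ R) }

  ends-reversed : ∀ k w (p : Path (Fin n)) → ends k w (reversed p) ≡ ends k w p
  ends-reversed k w (c , a , b) with same c k
  ... | true  = +-comm (ι b w) (ι a w)
  ... | false = refl

  Apart-reversed : ∀ p q → Apart χ p q → Apart χ (reversed p) q
  Apart-reversed _ _ apart e with apart e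
  ... | f , const , a , b , rest = f , const , b , a , rest

  reverse₁ : ∀ p {q r} → Real W χ p q r → Real W χ (reversed p) q r
  reverse₁ p {q} {r} R = record
    { count   = λ k w → trans (cong (λ x → δ χ k w + (x + _)) (ends-reversed k w p)) (count R k w)
    ; apart₁₂ = Apart-reversed p q (apart₁₂ R)
    ; apart₁₃ = Apart-reversed p r (apart₁₃ R)
    ; apart₂₃ = apart₂₃ R }

invertColours : {A : Rel n} → Colouring A → Colouring A
invertColours {A = A} χ = record
  { colour     = λ u w → not (colour χ u w)
  ; colour-sym = λ u w → cong not (colour-sym χ u w)
  ; δ≤2        = λ k w → subst (_≤ 2) (sym (count-cong (cls≗ k w))) (δ≤2 χ (not k) w)
  ; acyclic    = λ k → Acyclic-⊆ (λ u w h → trans (sym (cls≗ k u w)) h) (acyclic χ (not k)) }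
  where
  cls≗ : ∀ k u w → A u w ∧ same k (not (colour χ u w)) ≡ class χ (not k) u w
  cls≗ true  u w = refl
  cls≗ false u w with colour χ u w
  ... | true  = refl
  ... | false = refl

same-not-left : ∀ k c → same k (not c) ≡ same (not k) c
same-not-left true  c = refl
same-not-left false true = refl
same-not-left false false = refl

-- The families list triples of paths only up to an exchange of the two colours.
invert : {A : Rel n} {W : Fin n → Bool} {χ : Colouring A} → ∀ p q r → Real W χ p q r →
  Real W (invertColours χ) (inverted p) (inverted q) (inverted r)
invert {A = A} {W} {χ} p q r R = record
  { count = λ k w → trans
      (cong₂ _+_ (count-cong (cls≗ k w))
        (cong₂ _+_ (ends≡ k w p) (cong₂ _+_ (ends≡ k w q) (ends≡ k w r))))
      (count R (not k) w)
  ; apart₁₂ = apart p q (apart₁₂ R)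
  ; apart₁₃ = apart p r (apart₁₃ R)
  ; apart₂₃ = apart q r (apart₂₃ R) }
  where
  cls≗ : ∀ k u w → class (invertColours χ) k u w ≡ class χ (not k) u w
  cls≗ k u w = cong (A u w ∧_) (same-not-left k (colour χ u w))
  ends≡ : ∀ k w p → ends k w (inverted p) ≡ ends (not k) w p
  ends≡ k w (c , a , b) = cong (λ t → if t then ι a w + ι b w else 0) (sym (same-not-left c k))
  apart : ∀ p q → Apart χ p q → Apart (invertColours χ) (inverted p) (inverted q)
  apart (c , _) q ap e with ap (not-injective e)
  ... | f , const , rest = f , (λ u w h → const u w (class-not c u w h)) , rest
    where
    class-not : ∀ c u w → class (invertColours χ) (not c) u w ≡ true → class χ c u w ≡ true
    class-not c u w h = subst (λ k → class χ k u w ≡ true) (not-involutive c) (trans (sym (cls≗ (not c) u w)) h)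

-- How a new vertex of degree 2 changes the three paths

part : Bool → Fin n → Bool → Fin n → ℕ
part c a k w = if same c k then ι a w else 0

inc-part : ∀ c (a b : Fin n) k w → inc c a b k w ≡ part c a k w + part c b k w
inc-part c a b k w with same c k
... | true  = refl
... | false = refl

part-both : ∀ c (v : Fin n) k w → part c v k w + part (not c) v k w ≡ ι v w
part-both true  v true  w = +-identityʳ _
part-both true  v false w = refl
part-both false v true  w = refl
part-both false v false w = +-identityʳ _

m+n≤2∧1≤n⇒m≤1 : ∀ {m n} → m + n ≤ 2 → 1 ≤ n → m ≤ 1
m+n≤2∧1≤n⇒m≤1 {m} {n} h h′ = +-cancelʳ-≤ 1 m 1 (≤-trans (+-monoʳ-≤ m h′) h)

-- By `count`, degree and path ends of one colour at x share at most two places; the end at x takes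
-- one of them.
Real-room : {A : Rel n} {W : Fin n → Bool} {χ : Colouring A} → ∀ {c x a q r} →
  Real W χ (c , x , a) q r → δ χ c x ≤ 1
Real-room {W = W} {χ} {c} {x} {a} R = m+n≤2∧1≤n⇒m≤1
  (≤-trans (≤-reflexive (count R c x)) (cap (W x)))
  (≤-trans counted (m≤m+n _ _))
  where
  cap : ∀ b → (if b then 2 else 0) ≤ 2
  cap true  = ≤-refl
  cap false = z≤n
  counted : 1 ≤ inc c x a c x
  counted rewrite same-refl c | ι-same x = s≤s z≤n

-- Outside W the right side of `count` is 0. Applied to the vertex about to be added, this shows
-- that it is no end of an old path.
dead-end : {A : Rel n} {W : Fin n → Bool} {χ : Colouring A} → ∀ {c a b q r v} → W v ≡ false →
  Real W χ (c , a , b) q r → a ≢ v × b ≢ v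
dead-end {W = W} {χ} {c} {a} {b} {q} {r} {v} Wv R = (λ { refl → left {a} {b} sum0 }) , (λ { refl → right {a} {b} sum0 })
  where
  sum0 : inc c a b c v ≡ 0
  sum0 = m+n≡0⇒m≡0 (inc c a b c v) (m+n≡0⇒n≡0 (δ χ c v)
    (trans (count R c v) (cong (λ t → if t then 2 else 0) Wv)))
  left : ∀ {a b} → inc c a b c a ≡ 0 → ⊥
  left {a} {b} h rewrite same-refl c | ι-same a with () ← h
  right : ∀ {a b} → inc c a b c b ≡ 0 → ⊥
  right {a} {b} h rewrite same-refl c | ι-same b with () ← m+n≡0⇒n≡0 (ι a b) h

module _ {A : Rel n} {W : Fin n → Bool} (G : GraphOn A W) {v x y : Fin n} (Wv : W v ≡ true)
    (N : Nbr₂ A v x y) {χ : Colouring (A ⊖ v)} where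

  private
    S = simple G
    W₀ = W ∖ v

    W₀v : W₀ v ≡ false
    W₀v rewrite ==-refl v = ∧-zeroʳ (W v)

    demand : ∀ w → (if W₀ w then 2 else 0) + (ι v w + ι v w) ≡ (if W w then 2 else 0)
    demand w with w ≟ v
    ... | yes refl rewrite Wv = refl
    ... | no _ with W w
    ...   | true  = refl
    ...   | false = refl

  module Attach {i j : Bool} {χ′ : Colouring A} (E : Extends χ χ′ v i x j y) where

    raise : (Fin n → Bool) → Fin n → Bool
    raise f z = z == v ∨ f z

    raise-v : ∀ f → raise f v ≡ true
    raise-v f rewrite ==-refl v = refl

    raise-off : ∀ f {z} → z ≢ v → raise f z ≡ f z
    raise-off f h rewrite ≢⇒== h = refl

    raise-true : ∀ f z → f z ≡ true → raise f z ≡ true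
    raise-true f z h with z == v
    ... | true  = refl
    ... | false = h

    -- Every new edge contains v, which is put on the `true` side; the cut survives if the
    -- neighbours of v in colour k are on that side too.
    raise-const : ∀ f k → (∀ u w → class χ k u w ≡ true → f u ≡ f w) →
      (i ≡ k → f x ≡ true) → (j ≡ k → f y ≡ true) →
      ∀ u w → class χ′ k u w ≡ true → raise f u ≡ raise f w
    raise-const f k const fx fy u w h with class″ E k u w h
    ... | inj₁ old = let _ , u≢v , w≢v = ⊖⇒ A v {u} {w} (class⇒ χ {k} {u} {w} old) in
      trans (raise-off f u≢v) (trans (const u w old) (sym (raise-off f w≢v)))
    ... | inj₂ (inj₁ (e , inj₁ (refl , refl))) = trans (raise-v f) (sym (raise-true f w (fx e)))
    ... | inj₂ (inj₁ (e , inj₂ (refl , refl))) = trans (raise-true f u (fx e)) (sym (raise-v f))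
    ... | inj₂ (inj₂ (e , inj₁ (refl , refl))) = trans (raise-v f) (sym (raise-true f w (fy e)))
    ... | inj₂ (inj₂ (e , inj₂ (refl , refl))) = trans (raise-true f u (fy e)) (sym (raise-v f))

  -- With two colours at v, each edge prolongs its path, and v replaces x as an end in colour c and
  -- y as an end in the other colour.
  Real-extend : ∀ {c a b r} → Real W₀ χ (c , x , a) (not c , y , b) r →
    Realised A W ((c , v , a) , (not c , v , b) , r)
  Real-extend {c} {a} {b} {r@(e , r₁ , r₂)} R
    with attach₂ S (λ _ _ → refl) N χ c (not c) (Real-room R) (Real-room (swap₁₂ R)) (λ h → ⊥-elim (not-¬ refl h))
  ... | χ′ , E = χ′ , record
    { count   = counts
    ; apart₁₂ = λ h → ⊥-elim (not-¬ refl h)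
    ; apart₁₃ = ap₁₃
    ; apart₂₃ = ap₂₃ }
    where
    open Attach E
    dead₃ = dead-end W₀v (swap₁₂ (swap₂₃ R))
    counts : ∀ k w → δ χ′ k w + (inc c v a k w + (inc (not c) v b k w + ends k w r)) ≡ (if W w then 2 else 0)
    counts k w = begin
      δ χ′ k w + (inc c v a k w + (inc (not c) v b k w + ρ))
        ≡⟨ cong₂ _+_ (δ″ E k w) (cong₂ _+_ (inc-part c v a k w) (cong (_+ ρ) (inc-part (not c) v b k w))) ⟩
      d + (inc c v x k w + inc (not c) v y k w) + ((pv + pa) + ((qv + pb) + ρ))
        ≡⟨ cong (λ t → d + t + ((pv + pa) + ((qv + pb) + ρ))) (cong₂ _+_ (inc-part c v x k w) (inc-part (not c) v y k w)) ⟩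
      d + ((pv + px) + (qv + py)) + ((pv + pa) + ((qv + pb) + ρ))
        -- What x and y lose as ends they gain in degree. At v each colour has one edge and one end,
        -- which is the quota of 2 that v brings into W.
        ≡⟨ rearrange d pv px qv py pa pb ρ ⟩
      d + ((px + pa) + ((py + pb) + ρ)) + ((pv + qv) + (pv + qv))
        ≡⟨ cong₂ _+_ (cong (d +_) (cong₂ _+_ (sym (inc-part c x a k w)) (cong (_+ ρ) (sym (inc-part (not c) y b k w)))))
             (cong₂ _+_ (part-both c v k w) (part-both c v k w)) ⟩
      d + (inc c x a k w + (inc (not c) y b k w + ρ)) + (ι v w + ι v w)
        ≡⟨ cong (_+ (ι v w + ι v w)) (count R k w) ⟩
      (if W₀ w then 2 else 0) + (ι v w + ι v w)
        ≡⟨ demand w ⟩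
      (if W w then 2 else 0) ∎
      where
      open ≡-Reasoning
      d = δ χ k w
      ρ = ends k w r
      pv = part c v k w ; px = part c x k w ; pa = part c a k w
      qv = part (not c) v k w ; py = part (not c) y k w ; pb = part (not c) b k w
      rearrange : ∀ d pv px qv py pa pb ρ →
        d + ((pv + px) + (qv + py)) + ((pv + pa) + ((qv + pb) + ρ)) ≡
        d + ((px + pa) + ((py + pb) + ρ)) + ((pv + qv) + (pv + qv))
      rearrange = solve 8 (λ d pv px qv py pa pb ρ →
        d :+ ((pv :+ px) :+ (qv :+ py)) :+ ((pv :+ pa) :+ ((qv :+ pb) :+ ρ)) :=
        d :+ ((px :+ pa) :+ ((py :+ pb) :+ ρ)) :+ ((pv :+ qv) :+ (pv :+ qv))) refl
        where open +-*-Solver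
    ap₁₃ : Apart χ′ (c , v , a) r
    ap₁₃ refl with apart₁₃ R refl
    ... | f , const , fx , fa , f₁ , f₂ = raise f ,
      raise-const f c const (λ _ → fx) (λ h → ⊥-elim (not-¬ refl (sym h))) ,
      raise-v f , raise-true f a fa , trans (raise-off f (proj₁ dead₃)) f₁ , trans (raise-off f (proj₂ dead₃)) f₂
    ap₂₃ : Apart χ′ (not c , v , b) r
    ap₂₃ refl with apart₂₃ R refl
    ... | f , const , fy , fb , f₁ , f₂ = raise f ,
      raise-const f (not c) const (λ h → ⊥-elim (not-¬ refl h)) (λ _ → fy) ,
      raise-v f , raise-true f b fb , trans (raise-off f (proj₁ dead₃)) f₁ , trans (raise-off f (proj₂ dead₃)) f₂

  -- With one colour at v the two paths become a single one through v. The other colour gains v as a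
  -- path of length 0, so there are again three paths.
  Real-merge : ∀ {c a b r} → Real W₀ χ (c , x , a) (c , y , b) r →
    Realised A W ((c , a , b) , (not c , v , v) , r)
  Real-merge {c} {a} {b} {r@(e , r₁ , r₂)} R
    with attach₂ S (λ _ _ → refl) N χ c c (Real-room R) (Real-room (swap₁₂ R)) (λ _ → sep (apart₁₂ R refl))
    where
    sep : _ → Separated (class χ c) x y
    sep (f , const , fx , _ , fy , _) = f , const , fx , fy
  ... | χ′ , E = χ′ , record
    { count   = counts
    ; apart₁₂ = λ h → ⊥-elim (not-¬ refl h)
    ; apart₁₃ = ap₁₃
    ; apart₂₃ = ap₂₃ }
    where
    open Attach E
    dead₃ = dead-end W₀v (swap₁₂ (swap₂₃ R))
    counts : ∀ k w → δ χ′ k w + (inc c a b k w + (inc (not c) v v k w + ends k w r)) ≡ (if W w then 2 else 0)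
    counts k w = begin
      δ χ′ k w + (inc c a b k w + (inc (not c) v v k w + ρ))
        ≡⟨ cong₂ _+_ (δ″ E k w) (cong₂ _+_ (inc-part c a b k w) (cong (_+ ρ) (inc-part (not c) v v k w))) ⟩
      d + (inc c v x k w + inc c v y k w) + ((pa + pb) + ((qv + qv) + ρ))
        ≡⟨ cong (λ t → d + t + ((pa + pb) + ((qv + qv) + ρ))) (cong₂ _+_ (inc-part c v x k w) (inc-part c v y k w)) ⟩
      d + ((pv + px) + (pv + py)) + ((pa + pb) + ((qv + qv) + ρ))
        -- Here v has two edges of colour c, and its path of length 0 supplies two ends in the other
        -- colour.
        ≡⟨ rearrange d pv px qv py pa pb ρ ⟩
      d + ((px + pa) + ((py + pb) + ρ)) + ((pv + qv) + (pv + qv))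
        ≡⟨ cong₂ _+_ (cong (d +_) (cong₂ _+_ (sym (inc-part c x a k w)) (cong (_+ ρ) (sym (inc-part c y b k w)))))
             (cong₂ _+_ (part-both c v k w) (part-both c v k w)) ⟩
      d + (inc c x a k w + (inc c y b k w + ρ)) + (ι v w + ι v w)
        ≡⟨ cong (_+ (ι v w + ι v w)) (count R k w) ⟩
      (if W₀ w then 2 else 0) + (ι v w + ι v w)
        ≡⟨ demand w ⟩
      (if W w then 2 else 0) ∎
      where
      open ≡-Reasoning
      d = δ χ k w
      ρ = ends k w r
      pv = part c v k w ; px = part c x k w ; pa = part c a k w
      qv = part (not c) v k w ; py = part c y k w ; pb = part c b k w
      rearrange : ∀ d pv px qv py pa pb ρ →
        d + ((pv + px) + (pv + py)) + ((pa + pb) + ((qv + qv) + ρ)) ≡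
        d + ((px + pa) + ((py + pb) + ρ)) + ((pv + qv) + (pv + qv))
      rearrange = solve 8 (λ d pv px qv py pa pb ρ →
        d :+ ((pv :+ px) :+ (pv :+ py)) :+ ((pa :+ pb) :+ ((qv :+ qv) :+ ρ)) :=
        d :+ ((px :+ pa) :+ ((py :+ pb) :+ ρ)) :+ ((pv :+ qv) :+ (pv :+ qv))) refl
        where open +-*-Solver
    ap₁₃ : Apart χ′ (c , a , b) r
    ap₁₃ refl with apart₁₃ R refl | apart₂₃ R refl
    -- The union of the sides that cut off the two old paths from r contains both parts of the
    -- merged path and still misses r.
    ... | f , f-const , fx , fa , f₁ , f₂ | g , g-const , gy , gb , g₁ , g₂ =
      raise h , raise-const h c (λ u w z → cong₂ _∨_ (f-const u w z) (g-const u w z))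
        (λ _ → cong (_∨ g x) fx) (λ _ → left gy) ,
      raise-true h a (cong (_∨ g a) fa) , raise-true h b (left gb) ,
      trans (raise-off h (proj₁ dead₃)) (cong₂ _∨_ f₁ g₁) , trans (raise-off h (proj₂ dead₃)) (cong₂ _∨_ f₂ g₂)
      where
      h : Fin n → Bool
      h z = f z ∨ g z
      left : ∀ {z} → g z ≡ true → h z ≡ true
      left {z} e rewrite e with f z
      ... | true  = refl
      ... | false = refl
    ap₂₃ : Apart χ′ (not c , v , v) r
    -- No edge at v has the other colour, so v alone is a side.
    ap₂₃ refl = raise off , raise-const off (not c) (λ _ _ _ → refl)
        (λ h → ⊥-elim (not-¬ refl h)) (λ h → ⊥-elim (not-¬ refl h)) ,
      raise-v off , raise-v off , raise-off off (proj₁ dead₃) , raise-off off (proj₂ dead₃)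
      where
      off : Fin n → Bool
      off _ = false

-- The families of path lists

record Family : Set where
  constructor family
  field
    labels : ℕ
    states : List (State ℕ)

open Family

red blue : ℕ → ℕ → Path ℕ
red a b  = true , a , b
blue a b = false , a , b

-- The families were found by a computer search. Every graph with 6 + ‖ A ‖ ≡ 4 |W| and |W| ≥ 2
-- admits, for one of the families, an assignment of its deficient vertices to the labels under
-- which all the states of the family are realised.
type0 : Family
type0 = family 2
  ( (red 0 0 , red 1 1 , blue 0 1)
  ∷ [] )

type1 : Family
type1 = family 3
  ( (red 0 0 , red 1 2 , blue 1 2)
  ∷ (red 0 1 , red 2 2 , blue 0 1)
  ∷ (red 0 2 , red 1 1 , blue 0 2)
  ∷ [] )

type2 : Family
type2 = family 4
  ( (red 0 2 , red 1 3 , blue 2 3)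
  ∷ (red 0 2 , red 3 3 , blue 1 2)
  ∷ (red 0 2 , blue 1 2 , blue 3 3)
  ∷ (red 0 3 , red 1 2 , blue 2 3)
  ∷ (red 0 3 , red 2 2 , blue 1 3)
  ∷ (red 0 3 , blue 1 3 , blue 2 2)
  ∷ [] )

type3 : Family
type3 = family 4
  ( (red 0 1 , red 2 3 , blue 2 3)
  ∷ (red 0 2 , red 1 3 , blue 2 3)
  ∷ (red 0 2 , red 3 3 , blue 1 2)
  ∷ (red 0 2 , blue 1 2 , blue 3 3)
  ∷ (red 0 3 , red 2 2 , blue 1 3)
  ∷ (red 0 3 , blue 1 3 , blue 2 2)
  ∷ [] )

type4 : Family
type4 = family 5
  ( (red 0 1 , red 2 4 , blue 3 4)
  ∷ (red 0 1 , red 3 4 , blue 2 4)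
  ∷ (red 0 1 , blue 2 3 , blue 4 4)
  ∷ (red 0 2 , red 3 4 , blue 1 4)
  ∷ (red 0 2 , red 4 4 , blue 1 3)
  ∷ (red 0 2 , blue 1 3 , blue 4 4)
  ∷ (red 0 3 , red 1 4 , blue 2 4)
  ∷ (red 0 3 , red 2 4 , blue 1 4)
  ∷ (red 0 3 , red 4 4 , blue 1 2)
  ∷ (red 0 3 , blue 1 2 , blue 4 4)
  ∷ (red 0 4 , red 1 2 , blue 3 4)
  ∷ (red 0 4 , blue 1 2 , blue 3 4)
  ∷ (red 0 4 , blue 1 3 , blue 2 4)
  ∷ [] )

type5 : Family
type5 = family 5
  ( (red 0 2 , red 1 4 , blue 3 4)
  ∷ (red 0 2 , red 3 4 , blue 1 4)
  ∷ (red 0 2 , red 4 4 , blue 1 3)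
  ∷ (red 0 2 , blue 1 3 , blue 4 4)
  ∷ (red 0 3 , red 1 4 , blue 2 4)
  ∷ (red 0 3 , red 2 4 , blue 1 4)
  ∷ (red 0 3 , red 4 4 , blue 1 2)
  ∷ (red 0 3 , blue 1 2 , blue 4 4)
  ∷ (red 0 4 , red 1 2 , blue 3 4)
  ∷ (red 0 4 , red 1 3 , blue 2 4)
  ∷ (red 0 4 , blue 1 2 , blue 3 4)
  ∷ (red 0 4 , blue 1 3 , blue 2 4)
  ∷ [] )

type6 : Family
type6 = family 5
  ( (red 0 1 , red 2 4 , blue 3 4)
  ∷ (red 0 1 , red 3 4 , blue 2 4)
  ∷ (red 0 2 , red 3 4 , blue 1 4)
  ∷ (red 0 2 , red 4 4 , blue 1 3)
  ∷ (red 0 2 , blue 1 3 , blue 4 4)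
  ∷ (red 0 3 , red 1 4 , blue 2 4)
  ∷ (red 0 3 , red 4 4 , blue 1 2)
  ∷ (red 0 3 , blue 1 2 , blue 4 4)
  ∷ (red 0 4 , red 1 2 , blue 3 4)
  ∷ (red 0 4 , red 2 3 , blue 1 4)
  ∷ (red 0 4 , blue 1 2 , blue 3 4)
  ∷ (red 0 4 , blue 1 4 , blue 2 3)
  ∷ [] )

type7 : Family
type7 = family 5
  ( (red 0 2 , red 1 4 , blue 3 4)
  ∷ (red 0 2 , red 3 4 , blue 1 4)
  ∷ (red 0 2 , red 4 4 , blue 1 3)
  ∷ (red 0 2 , blue 1 3 , blue 4 4)
  ∷ (red 0 3 , red 1 4 , blue 2 4)
  ∷ (red 0 3 , red 4 4 , blue 1 2)
  ∷ (red 0 3 , blue 1 2 , blue 4 4)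
  ∷ (red 0 4 , red 1 2 , blue 3 4)
  ∷ (red 0 4 , red 1 3 , blue 2 4)
  ∷ (red 0 4 , red 2 3 , blue 1 4)
  ∷ (red 0 4 , blue 1 2 , blue 3 4)
  ∷ (red 0 4 , blue 1 4 , blue 2 3)
  ∷ [] )

opaque
  families : Vec Family 8
  families = type0 ∷ type1 ∷ type2 ∷ type3 ∷ type4 ∷ type5 ∷ type6 ∷ type7 ∷ []

  -- Row i lists ways of filling the labels of type i, by the labels that follow an addition of a
  -- vertex: 0 for the new vertex and suc m for the old label m.
  relabellings : Vec (List (List ℕ)) 8
  relabellings
    = []
    ∷ ( (2 ∷ 1 ∷ 0 ∷ [])
      ∷ (4 ∷ 3 ∷ 0 ∷ [])
      ∷ [] )
    ∷ ( (2 ∷ 1 ∷ 3 ∷ 0 ∷ [])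
      ∷ (2 ∷ 1 ∷ 5 ∷ 0 ∷ [])
      ∷ (3 ∷ 1 ∷ 2 ∷ 0 ∷ [])
      ∷ (3 ∷ 2 ∷ 1 ∷ 0 ∷ [])
      ∷ (3 ∷ 2 ∷ 4 ∷ 0 ∷ [])
      ∷ (4 ∷ 1 ∷ 3 ∷ 0 ∷ [])
      ∷ (4 ∷ 2 ∷ 5 ∷ 0 ∷ [])
      ∷ (4 ∷ 3 ∷ 5 ∷ 0 ∷ [])
      ∷ [] )
    ∷ ( (3 ∷ 1 ∷ 0 ∷ 4 ∷ [])
      ∷ (3 ∷ 1 ∷ 0 ∷ 5 ∷ [])
      ∷ (3 ∷ 2 ∷ 0 ∷ 4 ∷ [])
      ∷ (3 ∷ 2 ∷ 0 ∷ 5 ∷ [])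
      ∷ (3 ∷ 2 ∷ 5 ∷ 0 ∷ [])
      ∷ (4 ∷ 1 ∷ 0 ∷ 3 ∷ [])
      ∷ (4 ∷ 1 ∷ 5 ∷ 0 ∷ [])
      ∷ (4 ∷ 2 ∷ 0 ∷ 3 ∷ [])
      ∷ (4 ∷ 3 ∷ 5 ∷ 0 ∷ [])
      ∷ [] )
    ∷ ( (2 ∷ 1 ∷ 3 ∷ 4 ∷ 0 ∷ [])
      ∷ (3 ∷ 2 ∷ 1 ∷ 5 ∷ 0 ∷ [])
      ∷ (4 ∷ 1 ∷ 2 ∷ 5 ∷ 0 ∷ [])
      ∷ (4 ∷ 3 ∷ 1 ∷ 5 ∷ 0 ∷ [])
      ∷ (4 ∷ 3 ∷ 2 ∷ 5 ∷ 0 ∷ [])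
      ∷ [] )
    ∷ ( (4 ∷ 3 ∷ 2 ∷ 1 ∷ 0 ∷ [])
      ∷ (5 ∷ 1 ∷ 4 ∷ 3 ∷ 0 ∷ [])
      ∷ (5 ∷ 2 ∷ 4 ∷ 3 ∷ 0 ∷ [])
      ∷ (5 ∷ 3 ∷ 2 ∷ 1 ∷ 0 ∷ [])
      ∷ [] )
    ∷ ( (4 ∷ 3 ∷ 1 ∷ 5 ∷ 0 ∷ [])
      ∷ (4 ∷ 3 ∷ 2 ∷ 5 ∷ 0 ∷ [])
      ∷ [] )
    ∷ ( (2 ∷ 1 ∷ 3 ∷ 5 ∷ 0 ∷ [])
      ∷ (2 ∷ 1 ∷ 4 ∷ 5 ∷ 0 ∷ [])
      ∷ (4 ∷ 3 ∷ 1 ∷ 5 ∷ 0 ∷ [])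
      ∷ (4 ∷ 3 ∷ 2 ∷ 5 ∷ 0 ∷ [])
      ∷ (5 ∷ 3 ∷ 2 ∷ 1 ∷ 0 ∷ [])
      ∷ (5 ∷ 4 ∷ 1 ∷ 2 ∷ 0 ∷ [])
      ∷ [] )
    ∷ []

  families-start : lookup families zero ≡ type0
  families-start = refl

-- The finite check that the families are closed under additions

perms : {X : Set} → State X → List (State X)
perms (p , q , r) =
  (p , q , r) ∷ (q , p , r) ∷ (p , r , q) ∷ (r , p , q) ∷ (q , r , p) ∷ (r , q , p) ∷ []

samePath : Path ℕ → Path ℕ → Bool
samePath (c , a , b) (c′ , a′ , b′) = same c c′ ∧ ((a ≡ᵇ a′) ∧ (b ≡ᵇ b′) ∨ (a ≡ᵇ b′) ∧ (b ≡ᵇ a′))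

sameState : State ℕ → State ℕ → Bool
sameState (p , q , r) (p′ , q′ , r′) = samePath p p′ ∧ samePath q q′ ∧ samePath r r′

invertState : {X : Set} → State X → State X
invertState (p , q , r) = inverted p , inverted q , inverted r

-- Realisability depends neither on the order of the three paths, nor on their directions, nor on
-- the names of the colours.
equivalent : State ℕ → State ℕ → Bool
equivalent s t = any (λ t′ → sameState s t′ ∨ sameState s (invertState t′)) (perms t)

orient : ℕ → Path ℕ → List (Bool × ℕ)
orient x (c , a , b) = (if a ≡ᵇ x then (c , b) ∷ [] else []) ++ (if b ≡ᵇ x then (c , a) ∷ [] else [])

step : Bool × ℕ → Bool × ℕ → Path ℕ → State ℕ
step (c , a) (c′ , b) r = if same c c′
  then ((c , suc a , suc b) , (not c , 0 , 0) , mapPath suc r)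
  else ((c , 0 , suc a) , (not c , 0 , suc b) , mapPath suc r)

-- The ends x and y are taken from two different paths p and q: joining v to both ends of one path
-- by edges of its colour would close a cycle.
moves : ℕ → ℕ → State ℕ → List (State ℕ)
moves x y s = concatMap (λ (p , q , r) →
  concatMap (λ pa → map (λ qb → step pa qb r) (orient y q)) (orient x p)) (perms s)

at : List ℕ → ℕ → ℕ
at []       _       = 0
at (x ∷ xs) zero    = x
at (x ∷ xs) (suc m) = at xs m

injectiveOn : ℕ → ℕ → List ℕ → Bool
injectiveOn k k′ ρ = all (λ m →
  (at ρ m ≤ᵇ k) ∧ all (λ m′ → (m ≡ᵇ m′) ∨ not (at ρ m ≡ᵇ at ρ m′)) (upTo k′)) (upTo k′)

-- One relabelling has to serve all states of the target at once, because a family is realised under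
-- a single assignment of vertices; its states may come from different colourings.
leadsTo : ℕ → List (State ℕ) → Family → List ℕ → Bool
leadsTo k ms t ρ = injectiveOn k (labels t) ρ ∧
  all (λ s → any (equivalent (mapState (at ρ) s)) ms) (states t)

opaque
  continues : Family → ℕ → ℕ → Bool
  continues t x y = go (concatMap (moves x y) (states t))
    where
    go : List (State ℕ) → Bool
    go ms = any (λ i → any (leadsTo (labels t) ms (lookup families i)) (lookup relabellings i)) (allFin 8)

-- The neighbours of the new vertex are distinct and their order is irrelevant, so pairs with x < y
-- are enough.
closedAt : Family → ℕ → ℕ → Bool
closedAt t x y = (y ≤ᵇ x) ∨ continues t x y

closedFrom : Family → ℕ → Bool
closedFrom t x = all (closedAt t x) (upTo (labels t))

closed : Family → Bool
closed t = all (closedFrom t) (upTo (labels t))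

all-lookup : {X : Set} (p : X → Bool) {xs : List X} {x : X} → T (all p xs) → x ∈ xs → T (p x)
all-lookup p h (here refl) = proj₁ (Equivalence.to T-∧ h)
all-lookup p h (there i)   = all-lookup p (proj₂ (Equivalence.to T-∧ h)) i

opaque
  unfolding families continues

  -- A proof by evaluation: `tt` is accepted because the check over all eight families and all pairs
  -- of labels reduces to `true`.
  families-closed : ∀ i → T (closed (lookup families i))
  families-closed i = all-lookup (closed ∘ lookup families) {allFin 8} tt (∈-allFin i)

-- Soundness of the check

∧⇒ : ∀ {x y} → T (x ∧ y) → T x × T y
∧⇒ = Equivalence.to T-∧

∨⇒ : ∀ {x y} → T (x ∨ y) → T x ⊎ T y
∨⇒ = Equivalence.to T-∨

any-find : {X : Set} (p : X → Bool) (xs : List X) → T (any p xs) → ∃ λ x → x ∈ xs × T (p x)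
any-find p xs h = find (any⁻ p xs h)

T⇒≡true : ∀ {b} → T b → b ≡ true
T⇒≡true = Equivalence.to T-≡

Real-perm : {A : Rel n} {W : Fin n → Bool} (f : ℕ → Fin n) {s t : State ℕ} → t ∈ perms s →
  Realised A W (mapState f s) → Realised A W (mapState f t)
Real-perm f (here refl) R = R
Real-perm f (there (here refl)) (χ , R) = χ , swap₁₂ R
Real-perm f (there (there (here refl))) (χ , R) = χ , swap₂₃ R
Real-perm f (there (there (there (here refl)))) (χ , R) = χ , swap₁₂ (swap₂₃ R)
Real-perm f (there (there (there (there (here refl))))) (χ , R) = χ , swap₂₃ (swap₁₂ R)
Real-perm f (there (there (there (there (there (here refl)))))) (χ , R) = χ , swap₁₂ (swap₂₃ (swap₁₂ R))

samePath⇒ : ∀ p q → T (samePath p q) → p ≡ q ⊎ p ≡ reversed q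
samePath⇒ (c , a , b) (c′ , a′ , b′) h with ∧⇒ {same c c′} h
... | hc , hab with same⇒≡ {c} (T⇒≡true hc) | ∨⇒ {(a ≡ᵇ a′) ∧ (b ≡ᵇ b′)} hab
...   | refl | inj₁ e with ∧⇒ {a ≡ᵇ a′} e
...     | ea , eb rewrite ≡ᵇ⇒≡ a a′ ea | ≡ᵇ⇒≡ b b′ eb = inj₁ refl
samePath⇒ (c , a , b) (c′ , a′ , b′) h | hc , hab | refl | inj₂ e with ∧⇒ {a ≡ᵇ b′} e
...     | ea , eb rewrite ≡ᵇ⇒≡ a b′ ea | ≡ᵇ⇒≡ b a′ eb = inj₂ refl

Real-samePath : {A : Rel n} {W : Fin n → Bool} {χ : Colouring A} (f : ℕ → Fin n) → ∀ p q → T (samePath p q) →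
  ∀ {r s} → Real W χ (mapPath f q) r s → Real W χ (mapPath f p) r s
Real-samePath f p q h R with samePath⇒ p q h
... | inj₁ refl = R
... | inj₂ refl = reverse₁ (mapPath f q) R

Real-sameState : {A : Rel n} {W : Fin n → Bool} (f : ℕ → Fin n) → ∀ s t → T (sameState s t) →
  Realised A W (mapState f t) → Realised A W (mapState f s)
Real-sameState f (p , q , r) (p′ , q′ , r′) h (χ , R) with ∧⇒ {samePath p p′} h
... | hp , h′ with ∧⇒ {samePath q q′} h′
...   | hq , hr = χ , swap₁₂ (swap₂₃ (swap₁₂ (Real-samePath f r r′ hr
    (swap₁₂ (swap₂₃ (Real-samePath f q q′ hq (swap₁₂ (Real-samePath f p p′ hp R))))))))

Real-equivalent : {A : Rel n} {W : Fin n → Bool} (f : ℕ → Fin n) → ∀ s t → T (equivalent s t) →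
  Realised A W (mapState f t) → Realised A W (mapState f s)
Real-equivalent f s t h R with any-find _ (perms t) h
... | t′@(p , q , r) , t′∈ , h′ with Real-perm f t′∈ R | ∨⇒ {sameState s t′} h′
...   | R′     | inj₁ e = Real-sameState f s t′ e R′
...   | χ , R′ | inj₂ e = Real-sameState f s (invertState t′) e
  (invertColours χ , invert (mapPath f p) (mapPath f q) (mapPath f r) R′)

cons : Fin n → (ℕ → Fin n) → ℕ → Fin n
cons v ℓ zero    = v
cons v ℓ (suc m) = ℓ m

orient⇒ : ∀ x p {c b} → (c , b) ∈ orient x p → p ≡ (c , x , b) ⊎ p ≡ (c , b , x)
orient⇒ x (c , a , b) h with ∈-++⁻ (if a ≡ᵇ x then (c , b) ∷ [] else []) h
... | inj₁ h′ with a ≡ᵇ x in e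
...   | true with refl ← ≡ᵇ⇒≡ a x (Equivalence.from T-≡ e) with here refl ← h′ = inj₁ refl
orient⇒ x (c , a , b) h | inj₂ h′ with b ≡ᵇ x in e
...   | true with refl ← ≡ᵇ⇒≡ b x (Equivalence.from T-≡ e) with here refl ← h′ = inj₂ refl

module _ {A : Rel n} {W : Fin n → Bool} (G : GraphOn A W) {v : Fin n} (Wv : W v ≡ true)
    (ℓ : ℕ → Fin n) {x y : ℕ} (N : Nbr₂ A v (ℓ x) (ℓ y)) where

  Real-oriented : {χ : Colouring (A ⊖ v)} → ∀ z p {c b q r} → (c , b) ∈ orient z p →
    Real (W ∖ v) χ (mapPath ℓ p) q r → Real (W ∖ v) χ (c , ℓ z , ℓ b) q r
  Real-oriented z p i R with orient⇒ z p i
  ... | inj₁ refl = R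
  ... | inj₂ refl = reverse₁ (mapPath ℓ p) R

  step-sound : {χ : Colouring (A ⊖ v)} → ∀ {c a c′ b r} →
    Real (W ∖ v) χ (c , ℓ x , ℓ a) (c′ , ℓ y , ℓ b) (mapPath ℓ r) →
    Realised A W (mapState (cons v ℓ) (step (c , a) (c′ , b) r))
  step-sound {c = true}  {c′ = true}  R = Real-merge G Wv N R
  step-sound {c = true}  {c′ = false} R = Real-extend G Wv N R
  step-sound {c = false} {c′ = true}  R = Real-extend G Wv N R
  step-sound {c = false} {c′ = false} R = Real-merge G Wv N R

  moves-sound : ∀ s {m} → m ∈ moves x y s → Realised (A ⊖ v) (W ∖ v) (mapState ℓ s) →
    Realised A W (mapState (cons v ℓ) m)
  moves-sound s m∈ R with find (∈-concatMap⁻ _ {xs = perms s} m∈)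
  ... | (p , q , r) , t∈ , m∈′ with find (∈-concatMap⁻ _ {xs = orient x p} m∈′)
  ...   | (c , a) , a∈ , m∈″ with ∈-map⁻ (λ qb → step (c , a) qb r) {xs = orient y q} m∈″
  ...     | (c′ , b) , b∈ , refl with Real-perm ℓ t∈ R
  ...       | χ , R′ = step-sound {r = r}
    (swap₁₂ (Real-oriented y q b∈ (swap₁₂ (Real-oriented x p a∈ R′))))

-- Reading monochromatic vertices off the path lists

endsᴸ : Bool → ℕ → Path ℕ → ℕ
endsᴸ k m (c , a , b) = if same c k then bit (m ≡ᵇ a) + bit (m ≡ᵇ b) else 0

total : Bool → ℕ → State ℕ → ℕ
total k m (p , q , r) = endsᴸ k m p + (endsᴸ k m q + endsᴸ k m r)

-- At a vertex of W the total of a colour is 2 minus the degree in it: total 0 means two edges of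
-- that colour, total 2 means none. The degree is therefore 4 minus the sum of both totals.
mono? : ℕ → State ℕ → Bool
mono? m s = (total true m s ≡ᵇ 0) ∧ (total false m s ≡ᵇ 2) ∨ (total false m s ≡ᵇ 0) ∧ (total true m s ≡ᵇ 2)

oddTotal? : ℕ → State ℕ → Bool
oddTotal? m s = (total true m s + total false m s ≡ᵇ 1) ∨ (total true m s + total false m s ≡ᵇ 3)

-- A monochromatic vertex has degree 2, so it is deficient and carries a label; a test of the labels
-- is enough.
onlyMono? : ℕ → ℕ → State ℕ → Bool
onlyMono? k u s = (mono? u s ∨ oddTotal? u s) ∧ all (λ m → (m ≡ᵇ u) ∨ not (mono? m s)) (upTo k)

endLabels : State ℕ → List ℕ
endLabels ((_ , a , b) , (_ , a′ , b′) , (_ , a″ , b″)) = a ∷ b ∷ a′ ∷ b′ ∷ a″ ∷ b″ ∷ []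

ends< : ℕ → State ℕ → Bool
ends< k s = all (_<ᵇ k) (endLabels s)

ends<⇒ : ∀ {k s m} → T (ends< k s) → m ∈ endLabels s → m < k
ends<⇒ {k} {s} {m} h m∈ = <ᵇ⇒< m k (all-lookup (_<ᵇ k) {endLabels s} h m∈)

nonEmpty endsIn outcomes : Family → Bool
nonEmpty t = any (λ _ → true) (states t)
endsIn t   = all (ends< (labels t)) (states t)
outcomes t = all (λ u → any (onlyMono? (labels t) u) (states t)) (upTo (labels t))

record WellFormed (t : Family) : Set where
  field
    has-state    : T (nonEmpty t)
    ends-in      : T (endsIn t)
    has-outcomes : T (outcomes t)

open WellFormed

opaque
  unfolding families

  families-wellFormed : ∀ i → WellFormed (lookup families i)
  families-wellFormed i = record
    { has-state    = all-lookup (nonEmpty ∘ lookup families) {allFin 8} tt (∈-allFin i)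
    ; ends-in      = all-lookup (endsIn ∘ lookup families) {allFin 8} tt (∈-allFin i)
    ; has-outcomes = all-lookup (outcomes ∘ lookup families) {allFin 8} tt (∈-allFin i) }

closed⇒ : ∀ t → T (closed t) → ∀ {x y} → x < labels t → y < labels t → x < y → T (continues t x y)
closed⇒ t h {x} {y} x< y< x<y =
  [ (λ y≤x → ⊥-elim (<⇒≱ x<y (≤ᵇ⇒≤ y x y≤x))) , id ]′
  (∨⇒ {y ≤ᵇ x} (all-lookup (closedAt t x) (all-lookup (closedFrom t) h (∈-upTo⁺ x<)) (∈-upTo⁺ y<)))

record Labelled (A : Rel n) (W : Fin n → Bool) (t : Family) : Set where
  field
    ℓ         : ℕ → Fin n
    alive     : ∀ {m} → m < labels t → W (ℓ m) ≡ true
    injective : ∀ {a b} → a < labels t → b < labels t → ℓ a ≡ ℓ b → a ≡ b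
    realised  : ∀ {s} → s ∈ states t → Realised A W (mapState ℓ s)

open Labelled

inc-miss : ∀ k {a b w : Fin n} l → a ≢ w → b ≢ w → inc k a b l w ≡ 0
inc-miss k l aw bw = inc-off k l (aw ∘ sym) (bw ∘ sym)

-- A vertex of W at which no path ends has two edges of each colour, hence degree 4.
find-label : {A : Rel n} {W : Fin n → Bool} (ℓ : ℕ → Fin n) → ∀ s → Realised A W (mapState ℓ s) →
  ∀ {w} → W w ≡ true → degR A w ≤ 3 → ∃ λ m → m ∈ endLabels s × ℓ m ≡ w
find-label {A = A} {W} ℓ s@((c , a , b) , (c′ , a′ , b′) , (c″ , a″ , b″)) (χ , R) {w} Ww dw
  with Any.any? (λ m → ℓ m ≟ w) (endLabels s)
... | yes p  = find p
... | no  ¬p = ⊥-elim (<⇒≱ {3} ≤-refl (subst (_≤ 3) four dw))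
  where
  miss : ∀ {m} → m ∈ endLabels s → ℓ m ≢ w
  miss m∈ e = ¬p (lose m∈ e)
  no-ends : ∀ l → ends l w (c , ℓ a , ℓ b) + (ends l w (c′ , ℓ a′ , ℓ b′) + ends l w (c″ , ℓ a″ , ℓ b″)) ≡ 0
  no-ends l = cong₂ _+_ (inc-miss c l (miss (here refl)) (miss (there (here refl))))
    (cong₂ _+_ (inc-miss c′ l (miss (there (there (here refl)))) (miss (there (there (there (here refl))))))
      (inc-miss c″ l (miss (there (there (there (there (here refl))))))
        (miss (there (there (there (there (there (here refl)))))))))
  full : ∀ l → δ χ l w ≡ 2
  full l = trans (sym (+-identityʳ _)) (trans (cong (δ χ l w +_) (sym (no-ends l)))
    (trans (count R l w) (cong (λ t → if t then 2 else 0) Ww)))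
  four : degR A w ≡ 4
  four = trans (δ-sum χ w) (cong₂ _+_ (full true) (full false))

ι-label : {ℓ : ℕ → Fin n} {k : ℕ} → (∀ {a b} → a < k → b < k → ℓ a ≡ ℓ b → a ≡ b) →
  ∀ {m a} → m < k → a < k → ι (ℓ a) (ℓ m) ≡ bit (m ≡ᵇ a)
ι-label {ℓ = ℓ} inj {m} {a} m< a< with m ≡ᵇ a in e
... | true with refl ← ≡ᵇ⇒≡ m a (Equivalence.from T-≡ e) = ι-same (ℓ a)
... | false = ι-diff (λ h → false≢T (subst T e (≡⇒≡ᵇ m a (inj m< a< h))))
  where
  false≢T : T false → ⊥
  false≢T ()

ends-label : {ℓ : ℕ → Fin n} {k : ℕ} → (∀ {a b} → a < k → b < k → ℓ a ≡ ℓ b → a ≡ b) →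
  ∀ {m} → m < k → ∀ l s → T (ends< k s) → let p , q , r = mapState ℓ s in
  ends l (ℓ m) p + (ends l (ℓ m) q + ends l (ℓ m) r) ≡ total l m s
ends-label {ℓ = ℓ} {k} inj {m} m< l s@((c , a , b) , (c′ , a′ , b′) , (c″ , a″ , b″)) wf =
  cong₂ _+_ (one c (here refl) (there (here refl)))
    (cong₂ _+_ (one c′ (there (there (here refl))) (there (there (there (here refl)))))
      (one c″ (there (there (there (there (here refl))))) (there (there (there (there (there (here refl))))))))
  where
  one : ∀ c {a b} → a ∈ endLabels s → b ∈ endLabels s → ends l (ℓ m) (c , ℓ a , ℓ b) ≡ endsᴸ l m (c , a , b)
  one c a∈ b∈ with same c l
  ... | true  = cong₂ _+_ (ι-label inj m< (ends<⇒ {s = s} wf a∈)) (ι-label inj m< (ends<⇒ {s = s} wf b∈))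
  ... | false = refl

-- A pendant vertex needs only the first half. The triangle also needs that u misses one colour and
-- sees the other; this holds if u is monochromatic and if its degree is 1.
Outcome : Rel n → Fin n → Set
Outcome A u = ∃ λ (χ : Colouring A) →
  (∀ w → Mono χ w → w ≡ u) × (Mono χ u ⊎ degR A u ≡ 1 ⊎ degR A u ≡ 3)

module _ {A : Rel n} {W : Fin n → Bool} {t : Family} (wf : WellFormed t) (τ : Labelled A W t) where

  private
    k = labels t

  label-of : ∀ {w} → W w ≡ true → degR A w ≤ 3 → ∃ λ m → m < k × ℓ τ m ≡ w
  label-of Ww dw with any-find (λ _ → true) (states t) (has-state wf)
  ... | s , s∈ , _ with find-label (ℓ τ) s (realised τ s∈) Ww dw
  ...   | m , m∈ , e = m , ends<⇒ {s = s} (all-lookup (ends< k) (ends-in wf) s∈) m∈ , e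

  outcome : ∀ {u} → W u ≡ true → degR A u ≤ 3 → Outcome A u
  outcome {u} Wu du with label-of Wu du
  ... | m , m< , refl with any-find (onlyMono? k m) (states t)
    (all-lookup (λ u → any (onlyMono? k u) (states t)) (has-outcomes wf) (∈-upTo⁺ m<))
  ...   | s , s∈ , h with all-lookup (ends< k) (ends-in wf) s∈ | realised τ s∈ | ∧⇒ {mono? m s ∨ oddTotal? m s} h
  ...     | wfs | χ , R | at-m , others = χ , only , kind
    where
    split : ∀ {m} → m < k → W (ℓ τ m) ≡ true → ∀ l → δ χ l (ℓ τ m) + total l m s ≡ 2
    split {m} m< Wm l = begin
      δ χ l (ℓ τ m) + total l m s   ≡⟨ cong (δ χ l (ℓ τ m) +_) (sym (ends-label (injective τ) m< l s wfs)) ⟩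
      _                             ≡⟨ count R l (ℓ τ m) ⟩
      (if W (ℓ τ m) then 2 else 0)  ≡⟨ cong (λ t → if t then 2 else 0) Wm ⟩
      2 ∎
      where open ≡-Reasoning
    lives : ∀ l w → δ χ l w ≡ 2 → W w ≡ true
    lives l w e with W w | count R l w
    ... | true  | _ = refl
    ... | false | c with () ← trans (sym e) (m+n≡0⇒m≡0 (δ χ l w) c)
    full⇒ : ∀ {d t} → d + t ≡ 2 → d ≡ 2 → t ≡ 0
    full⇒ e refl = suc-injective (suc-injective e)
    none⇒ : ∀ {d t} → d + t ≡ 2 → d ≡ 0 → t ≡ 2
    none⇒ e refl = e
    full⇐ : ∀ {d t} → d + t ≡ 2 → t ≡ 0 → d ≡ 2
    full⇐ {d} e refl = trans (sym (+-identityʳ d)) e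
    none⇐ : ∀ {d t} → d + t ≡ 2 → t ≡ 2 → d ≡ 0
    none⇐ {d} e refl = +-cancelʳ-≡ 2 d 0 e
    mono⇒ : ∀ {m} → m < k → Mono χ (ℓ τ m) → T (mono? m s)
    mono⇒ {m} m< (true , two , zer)
      rewrite full⇒ (split m< (lives true _ two) true) two
            | none⇒ (split m< (lives true _ two) false) zer = tt
    mono⇒ {m} m< (false , two , zer)
      rewrite full⇒ (split m< (lives false _ two) false) two
            | none⇒ (split m< (lives false _ two) true) zer = tt
    only : ∀ w → Mono χ w → w ≡ ℓ τ m
    only w M@(c , two , zer) with label-of (lives c w two) (≤-trans (≤-reflexive (trans (δ-sum′ χ c w) (cong₂ _+_ two zer))) (n≤1+n 2))
    ... | m′ , m′< , refl with ∨⇒ {m′ ≡ᵇ m} (all-lookup (λ m′ → (m′ ≡ᵇ m) ∨ not (mono? m′ s)) others (∈-upTo⁺ m′<))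
    ...   | inj₁ e = cong (ℓ τ) (≡ᵇ⇒≡ m′ m e)
    ...   | inj₂ e = ⊥-elim (clash (mono? m′ s) (mono⇒ m′< M) e)
      where
      clash : ∀ b → T b → T (not b) → ⊥
      clash true _ ()
    kind : Mono χ (ℓ τ m) ⊎ degR A (ℓ τ m) ≡ 1 ⊎ degR A (ℓ τ m) ≡ 3
    kind with ∨⇒ {mono? m s} at-m
    ... | inj₁ M with ∨⇒ {(total true m s ≡ᵇ 0) ∧ (total false m s ≡ᵇ 2)} M
    ...   | inj₁ e = let e₁ , e₂ = ∧⇒ {total true m s ≡ᵇ 0} e in
      inj₁ (true , full⇐ (split m< Wu true) (≡ᵇ⇒≡ _ 0 e₁) , none⇐ (split m< Wu false) (≡ᵇ⇒≡ _ 2 e₂))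
    ...   | inj₂ e = let e₁ , e₂ = ∧⇒ {total false m s ≡ᵇ 0} e in
      inj₁ (false , full⇐ (split m< Wu false) (≡ᵇ⇒≡ _ 0 e₁) , none⇐ (split m< Wu true) (≡ᵇ⇒≡ _ 2 e₂))
    kind | inj₂ o = inj₂ ([ (λ e → inj₂ (odd 3 refl (≡ᵇ⇒≡ _ 1 e))) , (λ e → inj₁ (odd 1 refl (≡ᵇ⇒≡ _ 3 e))) ]′
      (∨⇒ {total true m s + total false m s ≡ᵇ 1} o))
      where
      odd : ∀ d {t} → d + t ≡ 4 → total true m s + total false m s ≡ t → degR A (ℓ τ m) ≡ d
      odd d {t} e h = +-cancelʳ-≡ t _ _ (trans (cong₂ _+_ (δ-sum χ (ℓ τ m)) (sym h))
        (trans (interchange (δ χ true (ℓ τ m)) _ _ _)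
          (trans (cong₂ _+_ (split m< Wu true) (split m< Wu false)) (sym e))))

-- The induction for graphs with 2|V| - 3 edges

open _▸_[_,_,_]

deg-⊖ : {A : Rel n} {v w : Fin n} → w ≢ v → A w v ≡ true → degR A w ≡ suc (degR (A ⊖ v) w)
deg-⊖ {A = A} {v} {w} w≢v wv = trans (count-∖ (A w) wv) (cong suc (count-cong pointwise))
  where
  pointwise : ∀ x → (A w ∖ v) x ≡ (A ⊖ v) w x
  pointwise x rewrite ≢⇒== w≢v = refl

Nbr₂-sym : {A : Rel n} {v a b : Fin n} → Nbr₂ A v a b → Nbr₂ A v b a
Nbr₂-sym (a≢b , va , vb , only) = a≢b ∘ sym , vb , va , λ w h → [ inj₂ , inj₁ ]′ (only w h)

module _ {A : Rel n} {W : Fin n → Bool} (G : GraphOn A W) {v : Fin n} (Wv : W v ≡ true) where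

  W∖v⇒ : ∀ {w} → (W ∖ v) w ≡ true → W w ≡ true × w ≢ v
  W∖v⇒ = ∖⇒ W

  ∈W∖v : ∀ {w} → A v w ≡ true → (W ∖ v) w ≡ true
  ∈W∖v {w} vw = ⇒∖ W (inside₂ G v w vw) (adj⇒≢ (simple G) vw ∘ sym)

  room : ∀ {w} → A v w ≡ true → degR (A ⊖ v) w ≤ 3
  room {w} vw = s≤s⁻¹ (subst (_≤ 4) (deg-⊖ {A = A} (adj⇒≢ (simple G) vw ∘ sym) (flip (simple G) vw)) (maxDegree G w))

  module _ {t : Family} (τ : Labelled (A ⊖ v) (W ∖ v) t) {x y : ℕ} (N : Nbr₂ A v (ℓ τ x) (ℓ τ y)) where

    relabel : ∀ {t′} ρ → T (leadsTo (labels t) (concatMap (moves x y) (states t)) t′ ρ) → Labelled A W t′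
    relabel {t′} ρ h with ∧⇒ {injectiveOn (labels t) (labels t′) ρ} h
    ... | inj , reach = record
      { ℓ         = cons v (ℓ τ) ∘ at ρ
      ; alive     = λ {m} m< → alive⁺ (at ρ m) (bound m<)
      ; injective = injective⁺
      ; realised  = realised⁺ }
      where
      k  = labels t
      k′ = labels t′
      row : ℕ → Bool
      row m = (at ρ m ≤ᵇ k) ∧ all (λ m′ → (m ≡ᵇ m′) ∨ not (at ρ m ≡ᵇ at ρ m′)) (upTo k′)
      at-row : ∀ {m} → m < k′ → T (at ρ m ≤ᵇ k) × T (all (λ m′ → (m ≡ᵇ m′) ∨ not (at ρ m ≡ᵇ at ρ m′)) (upTo k′))
      at-row m< = ∧⇒ (all-lookup row inj (∈-upTo⁺ m<))
      bound : ∀ {m} → m < k′ → at ρ m ≤ k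
      bound {m} m< = ≤ᵇ⇒≤ _ _ (proj₁ (at-row m<))
      alive⁺ : ∀ m → m ≤ k → W (cons v (ℓ τ) m) ≡ true
      alive⁺ zero    _  = Wv
      alive⁺ (suc m) m< = proj₁ (W∖v⇒ (alive τ m<))
      cons-injective : ∀ m m′ → m ≤ k → m′ ≤ k → cons v (ℓ τ) m ≡ cons v (ℓ τ) m′ → m ≡ m′
      cons-injective zero    zero     _  _   _ = refl
      cons-injective zero    (suc m′) _  m′< e = ⊥-elim (proj₂ (W∖v⇒ (alive τ m′<)) (sym e))
      cons-injective (suc m) zero     m< _   e = ⊥-elim (proj₂ (W∖v⇒ (alive τ m<)) e)
      cons-injective (suc m) (suc m′) m< m′< e = cong suc (injective τ m< m′< e)
      injective⁺ : ∀ {a b} → a < k′ → b < k′ → cons v (ℓ τ) (at ρ a) ≡ cons v (ℓ τ) (at ρ b) → a ≡ b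
      injective⁺ {a} {b} a< b< e
        with ∨⇒ {a ≡ᵇ b} (all-lookup (λ m′ → (a ≡ᵇ m′) ∨ not (at ρ a ≡ᵇ at ρ m′)) (proj₂ (at-row a<)) (∈-upTo⁺ b<))
      ... | inj₁ a≡b = ≡ᵇ⇒≡ a b a≡b
      ... | inj₂ ne = ⊥-elim (clash (at ρ a ≡ᵇ at ρ b) ne (≡⇒≡ᵇ _ _ (cons-injective (at ρ a) (at ρ b) (bound a<) (bound b<) e)))
        where
        clash : ∀ b → T (not b) → T b → ⊥
        clash false _ ()
      realised⁺ : ∀ {s} → s ∈ states t′ → Realised A W (mapState (cons v (ℓ τ) ∘ at ρ) s)
      realised⁺ {s} s∈ with any-find (equivalent (mapState (at ρ) s)) (concatMap (moves x y) (states t))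
        (all-lookup (λ s → any (equivalent (mapState (at ρ) s)) (concatMap (moves x y) (states t))) reach s∈)
      ... | m , m∈ , eq with find (∈-concatMap⁻ (moves x y) {xs = states t} m∈)
      ...   | s₀ , s₀∈ , m∈₀ = Real-equivalent (cons v (ℓ τ)) (mapState (at ρ) s) m eq
        (moves-sound G Wv (ℓ τ) N s₀ m∈₀ (realised τ s₀∈))

    opaque
      unfolding continues

      advance : T (continues t x y) → ∃ λ i → Labelled A W (lookup families i)
      advance h with any-find (λ i → any (leadsTo (labels t) (concatMap (moves x y) (states t)) (lookup families i))
                                         (lookup relabellings i)) (allFin 8) h
      ... | i , _ , h′ with any-find (leadsTo (labels t) (concatMap (moves x y) (states t)) (lookup families i))
                             (lookup relabellings i) h′
      ...   | ρ , _ , h″ = i , relabel ρ h″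

emptyColouring : {A : Rel n} → (∀ u w → A u w ≡ false) → Colouring A
emptyColouring {A = A} none = record
  { colour = λ _ _ → true ; colour-sym = λ _ _ → refl
  ; δ≤2 = λ k w → ≤-trans (≤-reflexive (count-none _ (λ x → cong (_∧ same k true) (none w x)))) z≤n
  ; acyclic = λ k a b h → ⊥-elim (true≢false (trans (sym h) (cong (_∧ same k true) (none a b)))) }

singleEdge : {A : Rel n} {W : Fin n → Bool} (G : GraphOn A W) {v a : Fin n} → W v ≡ true → Nbr₁ A v a →
  (∀ u w → (A ⊖ v) u w ≡ false) → (∀ w → W w ≡ true → w ≡ v ⊎ w ≡ a) → Labelled A W type0
singleEdge {n} {A} {W} G {v} {a} Wv N@(va , _) none only = record
  { ℓ         = cons v (λ _ → a)
  ; alive     = λ { {zero} _ → Wv ; {suc zero} _ → Wa ; {suc (suc _)} (s≤s (s≤s ())) }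
  ; injective = inj
  ; realised  = λ { (here refl) → χ′ e , record
    { count   = counts
    ; apart₁₂ = λ _ → (_== v) , (λ u w h → ⊥-elim (no-true u w h)) , ==-refl v , ==-refl v , ≢⇒== (v≢a ∘ sym) , ≢⇒== (v≢a ∘ sym)
    ; apart₁₃ = λ ()
    ; apart₂₃ = λ () } } }
  where
  v≢a = adj⇒≢ (simple G) va
  Wa = inside₂ G v a va
  χ = emptyColouring none
  δχ : ∀ k w → δ χ k w ≡ 0
  δχ k w = count-none (class χ k w) (λ x → cong (_∧ same k true) (none w x))
  -- The edge is blue in `type0`; in red both vertices are then paths of length 0.
  e : χ ▸ A [ false , v , a ]
  e = attach₁ (simple G) (λ _ _ → refl) N χ false (≤-trans (≤-reflexive (δχ false a)) z≤n)
  no-true : ∀ u w → class (χ′ e) true u w ≡ true → ⊥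
  no-true u w h with class′ e true u w h
  ... | inj₁ h′ = true≢false (trans (sym h′) (cong (_∧ same true true) (none u w)))
  inj : ∀ {x y} → x < 2 → y < 2 → cons v (λ _ → a) x ≡ cons v (λ _ → a) y → x ≡ y
  inj {zero}        {zero}        _ _ _ = refl
  inj {zero}        {suc zero}    _ _ h = ⊥-elim (v≢a h)
  inj {suc zero}    {zero}        _ _ h = ⊥-elim (v≢a (sym h))
  inj {suc zero}    {suc zero}    _ _ _ = refl
  inj {suc (suc _)} (s≤s (s≤s ()))
  inj {zero} {suc (suc _)} _ (s≤s (s≤s ()))
  inj {suc zero} {suc (suc _)} _ (s≤s (s≤s ()))
  counts : ∀ k w → δ (χ′ e) k w + (inc true v v k w + (inc true a a k w + inc false v a k w)) ≡ (if W w then 2 else 0)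
  counts k w rewrite δ′ e k w | δχ k w with w ≟ v | w ≟ a
  ... | yes refl | yes h = ⊥-elim (v≢a h)
  counts true  w | yes refl | no _ rewrite Wv = refl
  counts false w | yes refl | no _ rewrite Wv = refl
  counts true  w | no _ | yes refl rewrite Wa = refl
  counts false w | no _ | yes refl rewrite Wa = refl
  ... | no w≢v | no w≢a with W w in Ww
  ...   | true = ⊥-elim ([ w≢v , w≢a ]′ (only w Ww))
  counts true  w | no _ | no _ | false = refl
  counts false w | no _ | no _ | false = refl

tight : ∀ m {A : Rel n} {W : Fin n → Bool} → GraphOn A W → countF W ≡ suc (suc m) →
  6 + ‖ A ‖ ≡ suc (suc m) * 4 → ∃ λ i → Labelled A W (lookup families i)
tight m {A} {W} G size D with low G size
... | v , Wv , le = go m (countW W Wv size) D (classify A v le)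
  where
  S = simple G
  go : ∀ m → countF (W ∖ v) ≡ suc m → 6 + ‖ A ‖ ≡ suc (suc m) * 4 → Low A v → ∃ λ i → Labelled A W (lookup families i)
  go zero size₀ D L with singleton-empty (delete G v) size₀
  ... | none with L
  ...   | low₀ N with () ← trans (sym (cong (6 +_) (trans (‖‖-cong (⊖-vacuous S N)) (empty-‖‖ none)))) D
  ...   | low₂ N with () ← trans (sym (cong (6 +_) (trans (‖⊖‖₂ S N) (cong (4 +_) (empty-‖‖ none))))) D
  ...   | low₁ {a} N@(va , _) = zero , subst (Labelled A W) (sym families-start) (singleEdge G Wv N none only)
    where
    only : ∀ w → W w ≡ true → w ≡ v ⊎ w ≡ a
    only w Ww with w ≟ v
    ... | yes e = inj₁ e
    ... | no w≢v = let _ , _ , one = extract₁ (W ∖ v) size₀ in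
      inj₂ (trans (one w (⇒∖ W Ww w≢v)) (sym (one a (∈W∖v G Wv va))))
  go (suc m) size₀ D (low₀ N) = ⊥-elim (<⇒≱ (m<n+m _ {4} (s≤s z≤n)) (subst (_≤ suc (suc m) * 4)
    (trans (cong (6 +_) (sym (‖‖-cong (⊖-vacuous S N)))) D) (edge-bound m (delete G v) size₀)))
  go (suc m) size₀ D (low₁ N) = ⊥-elim (<⇒≱ (m<n+m _ {2} (s≤s z≤n)) (subst (_≤ suc (suc m) * 4)
    (suc-injective (suc-injective (trans (cong (6 +_) (sym (‖⊖‖₁ S N))) D))) (edge-bound m (delete G v) size₀)))
  go (suc m) size₀ D (low₂ {a} {b} N@(a≢b , va , vb , _))
    with tight m (delete G v) size₀ (+-cancelˡ-≡ 4 _ _ (trans (cong (6 +_) (sym (‖⊖‖₂ S N))) D))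
  -- Without v its neighbours have degree at most 3, so both carry labels of the family.
  ... | i , τ with label-of (families-wellFormed i) τ (∈W∖v G Wv va) (room G Wv va)
                 | label-of (families-wellFormed i) τ (∈W∖v G Wv vb) (room G Wv vb)
  ...   | x , x< , refl | y , y< , refl with <-cmp x y
  ...     | tri< x<y _ _ = advance G Wv τ N (closed⇒ (lookup families i) (families-closed i) x< y< x<y)
  ...     | tri≈ _ refl _ = ⊥-elim (a≢b refl)
  ...     | tri> _ _ y<x = advance G Wv τ (Nbr₂-sym {A = A} N) (closed⇒ (lookup families i) (families-closed i) y< x< y<x)

opaque
  deficient-outcome : ∀ m {A : Rel n} {W : Fin n → Bool} → GraphOn A W → countF W ≡ suc (suc m) →
    6 + ‖ A ‖ ≡ suc (suc m) * 4 → ∀ {u} → W u ≡ true → degR A u ≤ 3 → Outcome A u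
  deficient-outcome m G size D Wu du with tight m G size D
  ... | i , τ = outcome (families-wellFormed i) τ Wu du

-- Reducible configurations

data Reducible (A : Rel n) (W : Fin n → Bool) : Set where
  isolated : ∀ {v} → W v ≡ true → (∀ w → A v w ≡ false) → Reducible A W
  pendant  : ∀ {v a} → W v ≡ true → Nbr₁ A v a → Reducible A W
  lean     : ∀ {v a b} → W v ≡ true → Nbr₂ A v a b → degR A a ≡ 3 → Reducible A W
  triangle : ∀ {u x y} → Nbr₂ A x u y → Nbr₂ A y u x → Reducible A W
  diamond  : ∀ {u w x y} → x ≢ y → Nbr₂ A x u w → Nbr₂ A y u w → Reducible A W
  fork     : ∀ {u x y x′ y′} → x ≢ y → x′ ≢ y → y′ ≢ x → x′ ≢ y′ →
             Nbr₂ A x u x′ → Nbr₂ A y u y′ → Reducible A W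

through : {A : Rel n} {x u : Fin n} → degR A x ≡ 2 → A x u ≡ true → ∃ λ x′ → Nbr₂ A x u x′
through {A = A} {x} {u} dx xu with extract₂ (A x) dx
... | a , b , N@(_ , _ , _ , only) with only u xu
...   | inj₁ refl = b , N
...   | inj₂ refl = a , Nbr₂-sym {A = A} N

two-of : (p : Fin n → Bool) → 2 ≤ countF p → ∃ λ x → ∃ λ y → x ≢ y × p x ≡ true × p y ≡ true
two-of p h with countF p in e
two-of p (s≤s (s≤s _)) | suc (suc k) with extract p e
... | x , px , e′ with extract (p ∖ x) e′
...   | y , py , _ = x , y , (λ h → proj₂ (∖⇒ p py) (sym h)) , px , proj₁ (∖⇒ p py)

count-split : (p q : Fin n → Bool) → countF p ≡ countF (λ x → p x ∧ q x) + countF (λ x → p x ∧ not (q x))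
count-split p q = trans (∑-cong pointwise) (∑-+ (λ x → bit (p x ∧ q x)) (λ x → bit (p x ∧ not (q x))))
  where
  pointwise : ∀ x → bit (p x) ≡ bit (p x ∧ q x) + bit (p x ∧ not (q x))
  pointwise x with p x | q x
  ... | false | _     = refl
  ... | true  | true  = refl
  ... | true  | false = refl

module _ {A : Rel n} {W : Fin n → Bool} (G : GraphOn A W) where

  private
    S = simple G

  two-thin : ∀ {u x y} → x ≢ y → A u x ≡ true → A u y ≡ true → degR A x ≡ 2 → degR A y ≡ 2 → Reducible A W
  two-thin {u} {x} {y} x≢y ux uy dx dy
    with through {A = A} dx (flip S ux) | through {A = A} dy (flip S uy)
  ... | x′ , Nx@(_ , xu , xx′ , onlyx) | y′ , Ny@(_ , yu , yy′ , onlyy) with x′ ≟ y | x′ ≟ y′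
  ...   | no x′≢y | yes refl = diamond x≢y Nx Ny
  ...   | no x′≢y | no x′≢y′ = fork x≢y x′≢y y′≢x x′≢y′ Nx Ny
    where
    y′≢x : y′ ≢ x
    y′≢x refl with onlyx y (flip S yy′)
    ... | inj₁ e = adj⇒≢ S uy (sym e)
    ... | inj₂ e = x′≢y (sym e)
  ...   | yes refl | _ with onlyy x (flip S xx′)
  ...     | inj₁ e = ⊥-elim (adj⇒≢ S ux (sym e))
  ...     | inj₂ refl = triangle Nx Ny

  thin : Fin n → Bool
  thin w = degR A w ≡ᵇ 2

  thin⇒ : ∀ {w} → thin w ≡ true → degR A w ≡ 2
  thin⇒ {w} h = ≡ᵇ⇒≡ _ 2 (Equivalence.from T-≡ h)

  reduce : ∀ {m} → countF W ≡ suc m → Reducible A W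
  reduce size with any? (λ v → (W v ≟ᵇ true) ×-dec (degR A v ≤? 1))
  ... | yes (v , Wv , le) = small (degR A v) refl le
    where
    small : ∀ d → degR A v ≡ d → d ≤ 1 → Reducible A W
    small zero          e _ = isolated Wv (count≡0 (A v) e)
    small (suc zero)    e _ = pendant Wv (proj₂ (extract₁ (A v) e))
    small (suc (suc _)) e (s≤s ())
  ... | no none with any? (λ v → any? (λ a →
      (W v ≟ᵇ true) ×-dec (degR A v ℕ.≟ 2) ×-dec (A v a ≟ᵇ true) ×-dec (degR A a ℕ.≟ 3)))
  ...   | yes (v , a , Wv , dv , va , da) = lean Wv (proj₂ (through {A = A} dv va)) da
  ...   | no no-lean with any? (λ w → (W w ≟ᵇ true) ×-dec (thin w ≟ᵇ false))
  ...     | no all-thin with extract W size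
  -- All degrees are 2 here, so any vertex can be the common neighbour u.
  ...       | u , Wu , _ with two-of (A u) (≤-reflexive (sym (thin⇒ (all-thin′ Wu))))
    where
    all-thin′ : ∀ {w} → W w ≡ true → thin w ≡ true
    all-thin′ {w} Ww = ¬-not (λ h → all-thin (w , Ww , h))
  ...         | x , y , x≢y , ux , uy = two-thin x≢y ux uy (thin-nbr ux) (thin-nbr uy)
    where
    thin-nbr : ∀ {w} → A u w ≡ true → degR A w ≡ 2
    thin-nbr {w} uw = thin⇒ (¬-not (λ h → all-thin (w , inside₂ G u w uw , h)))
  reduce size | no none | no no-lean | yes (w₀ , Ww₀ , fat₀)
    with degenerate G (λ w → W w ∧ not (thin w)) (w₀ , cong₂ (λ a b → a ∧ not b) Ww₀ fat₀)
  ... | u , Hu , le with two-of (λ w → A u w ∧ thin w) two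
    where
    Wu : W u ≡ true
    Wu with W u
    ... | true = refl
    fat : degR A u ≢ 2
    fat e with W u | degR A u ≡ᵇ 2 in h
    fat e | true | false with () ← trans (sym h) (Equivalence.to T-≡ (≡⇒≡ᵇ _ 2 e))
    degree : degR A u ≡ countF (λ w → A u w ∧ thin w) + countF (λ w → A u w ∧ not (thin w))
    degree = count-split (A u) thin
    le′ : countF (λ w → A u w ∧ not (thin w)) ≤ 2
    le′ = ≤-trans (count-mono {p = λ w → A u w ∧ not (thin w)} {q = λ w → A u w ∧ (W w ∧ not (thin w))} pointwise) le
      where
      pointwise : ∀ w → A u w ∧ not (thin w) ≡ true → A u w ∧ (W w ∧ not (thin w)) ≡ true
      pointwise w h with A u w in e
      ... | true rewrite inside₂ G u w e = h
    -- The degree of u is at least 3, and at most two of its neighbours have a degree other than 2.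
    -- Without a neighbour of degree 2 its degree would be at most 2; with exactly one it would be
    -- 3, and that neighbour would be `lean`.
    two : 2 ≤ countF (λ w → A u w ∧ thin w)
    two with countF (λ w → A u w ∧ thin w) in t
    ... | suc (suc k) = s≤s (s≤s z≤n)
    ... | zero = ⊥-elim (bad (degR A u) refl (subst (_≤ 2)
      (sym (trans degree (cong (_+ countF (λ w → A u w ∧ not (thin w))) t))) le′))
      where
      bad : ∀ d → degR A u ≡ d → d ≤ 2 → ⊥
      bad zero          e _ = none (u , Wu , subst (_≤ 1) (sym e) z≤n)
      bad (suc zero)    e _ = none (u , Wu , subst (_≤ 1) (sym e) (s≤s z≤n))
      bad (suc (suc zero)) e _ = fat e
      bad (suc (suc (suc _))) e (s≤s (s≤s ()))
    ... | suc zero with extract (λ w → A u w ∧ thin w) t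
    ...   | s , hs , _ = ⊥-elim (bad (degR A u) refl (subst (_≤ 3)
      (sym (trans degree (cong (_+ countF (λ w → A u w ∧ not (thin w))) t))) (s≤s le′)))
      where
      us : A u s ≡ true
      us with A u s
      ... | true = refl
      ds : degR A s ≡ 2
      ds with A u s
      ... | true = thin⇒ hs
      bad : ∀ d → degR A u ≡ d → d ≤ 3 → ⊥
      bad zero          e _ = none (u , Wu , subst (_≤ 1) (sym e) z≤n)
      bad (suc zero)    e _ = none (u , Wu , subst (_≤ 1) (sym e) (s≤s z≤n))
      bad (suc (suc zero)) e _ = fat e
      bad (suc (suc (suc zero))) e _ = no-lean (s , u , inside₂ G u s us , ds , flip S us , e)
      bad (suc (suc (suc (suc _)))) e (s≤s (s≤s (s≤s ())))
  ...   | x , y , x≢y , hx , hy = two-thin x≢y (proj₁ (∧-split (A u x) hx)) (proj₁ (∧-split (A u y) hy))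
      (thin⇒ (proj₂ (∧-split (A u x) hx))) (thin⇒ (proj₂ (∧-split (A u y) hy)))

-- Transfer of colourings

MonoPair : (Bool → ℕ) → Set
MonoPair d = ∃ λ k → d k ≡ 2 × d (not k) ≡ 0

MonoPair-cong : {d d′ : Bool → ℕ} → (∀ k → d k ≡ d′ k) → MonoPair d → MonoPair d′
MonoPair-cong h (k , a , b) = k , trans (sym (h k)) a , trans (sym (h (not k))) b

mixed : {d : Bool → ℕ} → (∀ k → 1 ≤ d k) → ¬ MonoPair d
mixed {d} h (k , _ , zer) = <⇒≢ (h (not k)) (sym zer)

by-colour : {P : Bool → Set} → ∀ k → P k → P (not k) → ∀ l → P l
by-colour true  a b true  = a
by-colour true  a b false = b
by-colour false a b true  = b
by-colour false a b false = a

1≤+bit : ∀ m k → 1 ≤ m + bit (same k k)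
1≤+bit m k rewrite same-refl k = m≤n⇒m≤o+n m ≤-refl

1≢2 : 1 ≢ 2
1≢2 ()

-- If a colour is missing, it is taken: its degree becomes 1, neither 0 nor 2. If both are present
-- the vertex stays bichromatic, and with at most three edges one of them has room.
pick : (d : Bool → ℕ) → d true + d false ≤ 3 →
  ∃ λ i → d i ≤ 1 × ¬ MonoPair (λ k → d k + bit (same i k))
pick d h with d true in t | d false in f
... | zero | _ = true , subst (_≤ 1) (sym t) z≤n , λ
  { (true  , a , _) → 1≢2 (trans (sym (cong (_+ 1) t)) a)
  ; (false , _ , b) → 1+n≢0 (trans (sym (cong (_+ 1) t)) b) }
... | suc _ | zero = false , subst (_≤ 1) (sym f) z≤n , λ
  { (false , a , _) → 1≢2 (trans (sym (cong (_+ 1) f)) a)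
  ; (true  , _ , b) → 1+n≢0 (trans (sym (cong (_+ 1) f)) b) }
... | suc zero | suc _ = true , ≤-reflexive t ,
  mixed λ { true → m≤n⇒m≤o+n (d true) ≤-refl ; false → ≤-trans (≤-trans (s≤s z≤n) (≤-reflexive (sym f))) (m≤m+n (d false) 0) }
... | suc (suc _) | suc zero = false , ≤-reflexive f ,
  mixed λ { true → ≤-trans (≤-trans (s≤s z≤n) (≤-reflexive (sym t))) (m≤m+n (d true) 0) ; false → m≤n⇒m≤o+n (d false) ≤-refl }
... | suc (suc a) | suc (suc b) = ⊥-elim (<⇒≱ (s≤s (s≤s (≤-trans (m≤m+n 2 b) (m≤n+m (suc (suc b)) a)))) h)

-- In `mono k` the colour k is the missing one, which is the colour that later edges at the vertex
-- receive.
data Shape (d : Bool → ℕ) : Set where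
  mono  : ∀ k → d k ≡ 0 → d (not k) ≡ 2 → Shape d
  spare : (∀ k → d k ≤ 1) → Shape d

shape : (d : Bool → ℕ) → d true + d false ≤ 2 → Shape d
shape d h with d true in t | d false in f
... | zero | zero = spare λ { true → subst (_≤ 1) (sym t) z≤n ; false → subst (_≤ 1) (sym f) z≤n }
... | zero | suc zero = spare λ { true → subst (_≤ 1) (sym t) z≤n ; false → ≤-reflexive f }
... | suc zero | zero = spare λ { true → ≤-reflexive t ; false → subst (_≤ 1) (sym f) z≤n }
... | suc zero | suc zero = spare λ { true → ≤-reflexive t ; false → ≤-reflexive f }
... | zero | suc (suc zero) = mono true t f
... | suc (suc zero) | zero = mono false f t
shape d (s≤s (s≤s ())) | zero | suc (suc (suc _))
shape d (s≤s (s≤s ())) | suc zero | suc (suc _)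
shape d (s≤s (s≤s ())) | suc (suc (suc _)) | _
shape d (s≤s (s≤s ())) | suc (suc zero) | suc _

shape⇒MonoPair : {d : Bool → ℕ} → ∀ k → d k ≡ 0 → d (not k) ≡ 2 → MonoPair d
shape⇒MonoPair {d} k zer two = not k , two , trans (cong d (not-involutive k)) zer

NoMono AtMostOne : {A : Rel n} → Colouring A → Set
NoMono χ    = ∀ w → ¬ Mono χ w
AtMostOne χ = ∀ w w′ → Mono χ w → Mono χ w′ → w ≡ w′

only⇒AtMostOne : {A : Rel n} (χ : Colouring A) {x : Fin n} → (∀ w → Mono χ w → w ≡ x) → AtMostOne χ
only⇒AtMostOne χ h w w′ M M′ = trans (h w M) (sym (h w′ M′))

-- One statement for two inductions: `AtMostOne` serves D = 10, and the preservation of `NoMono`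
-- serves D = 8.
Lifts : Rel n → Rel n → Set
Lifts A₀ A = ∀ (χ : Colouring A₀) → AtMostOne χ →
  ∃ λ (χ′ : Colouring A) → AtMostOne χ′ × (NoMono χ → NoMono χ′)

fewer : {A₀ A : Rel n} (χ : Colouring A₀) → AtMostOne χ → (χ′ : Colouring A) → (∀ w → Mono χ′ w → Mono χ w) →
  ∃ λ (χ′ : Colouring A) → AtMostOne χ′ × (NoMono χ → NoMono χ′)
fewer χ one χ′ h = χ′ , (λ w w′ M M′ → one w w′ (h w M) (h w′ M′)) , λ none w M → none w (h w M)

-- The monochromatic vertex z is traded for x. The claim about `NoMono` is vacuous because of z.
moved : {A₀ A : Rel n} (χ : Colouring A₀) {z x : Fin n} → Mono χ z → (χ′ : Colouring A) → (∀ w → Mono χ′ w → w ≡ x) →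
  ∃ λ (χ′ : Colouring A) → AtMostOne χ′ × (NoMono χ → NoMono χ′)
moved χ {z} M χ′ h = χ′ , only⇒AtMostOne χ′ h , λ none → ⊥-elim (none z M)

transport : {A B : Rel n} → A ≗ᴿ B → (χ : Colouring B) → ∃ λ (ψ : Colouring A) → ∀ w → Mono ψ w → Mono χ w
transport {A = A} {B} A≗B χ with restrict {B = A} (λ u w h → trans (sym (A≗B u w)) h) χ
... | ψ , same-colour , _ = ψ , λ w → MonoPair-cong (λ k → count-cong λ x →
  cong₂ (λ a c → a ∧ same k c) (A≗B w x) (cong (λ c → c w x) same-colour))

-- Putting back a single vertex

lift-isolated : {A : Rel n} → Simple A → ∀ {v} → (∀ w → A v w ≡ false) → Lifts (A ⊖ v) A
lift-isolated S none χ one with transport (⊖-vacuous S none) χ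
... | ψ , h = fewer χ one ψ h

module _ {A₀ A : Rel n} {χ : Colouring A₀} {χ′ : Colouring A} {v a b : Fin n} {i j : Bool}
    (E : Extends χ χ′ v i a j b) (v≢a : v ≢ a) (v≢b : v ≢ b) (a≢b : a ≢ b) where

  at-new : (∀ k → δ χ k v ≡ 0) → ∀ l → δ χ′ l v ≡ bit (same i l) + bit (same j l)
  at-new zer l rewrite δ″ E l v | zer l | inc-left i l v≢a | inc-left j l v≢b = refl

  at-first : ∀ l → δ χ′ l a ≡ δ χ l a + bit (same i l)
  at-first l rewrite δ″ E l a | inc-right i l v≢a | inc-off j l (v≢a ∘ sym) a≢b
    | +-identityʳ (bit (same i l)) = refl

  at-second : ∀ l → δ χ′ l b ≡ δ χ l b + bit (same j l)
  at-second l rewrite δ″ E l b | inc-right j l v≢b | inc-off i l (v≢b ∘ sym) (a≢b ∘ sym) = refl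

  at-other : ∀ {w} → w ≢ v → w ≢ a → w ≢ b → ∀ l → δ χ′ l w ≡ δ χ l w
  at-other {w} wv wa wb l rewrite δ″ E l w | inc-off i l wv wa | inc-off j l wv wb = +-identityʳ _

both-colours : ∀ k l → 1 ≤ bit (same k l) + bit (same (not k) l)
both-colours true  true  = ≤-refl
both-colours true  false = ≤-refl
both-colours false true  = ≤-refl
both-colours false false = ≤-refl

one-edge : ∀ k → ¬ MonoPair (λ l → bit (same k l))
one-edge true  (true , () , _)
one-edge true  (false , () , _)
one-edge false (true , () , _)
one-edge false (false , () , _)

module _ {A : Rel n} {W : Fin n → Bool} (G : GraphOn A W) where

  private
    S = simple G

  δ-room : ∀ {v w} → W v ≡ true → A v w ≡ true → (χ : Colouring (A ⊖ v)) → δ χ true w + δ χ false w ≤ 3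
  δ-room Wv vw χ = subst (_≤ 3) (δ-sum χ _) (room G Wv vw)

  -- The colour from `pick` makes a harmless even if a was monochromatic, and v has degree 1.
  extend-pendant : ∀ {v a} → W v ≡ true → Nbr₁ A v a → (χ : Colouring (A ⊖ v)) → (∀ w → Mono χ w → w ≡ a) →
    ∃ λ (χ′ : Colouring A) → NoMono χ′
  extend-pendant {v} {a} Wv N@(va , _) χ only with pick (λ k → δ χ k a) (δ-room Wv va χ)
  ... | i , i≤1 , a-fine = χ′ e , none
    where
    v≢a = adj⇒≢ S va
    e = attach₁ S (λ _ _ → refl) N χ i i≤1
    none : NoMono (χ′ e)
    none w M = go (w ≟ v) (w ≟ a)
      where
      go : Dec (w ≡ v) → Dec (w ≡ a) → ⊥
      go (yes refl) _ = one-edge i (MonoPair-cong (λ l → trans (δ′ e l w)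
          (cong₂ _+_ (δ-absent S (λ _ _ → refl) χ l) (inc-left i l v≢a))) M)
      go (no _) (yes refl) = a-fine (MonoPair-cong (λ l → trans (δ′ e l w) (cong (δ χ l w +_) (inc-right i l v≢a))) M)
      go (no w≢v) (no w≢a) = w≢a (only w (MonoPair-cong (λ l → trans (δ′ e l w)
          (trans (cong (δ χ l w +_) (inc-off i l w≢v w≢a)) (+-identityʳ _))) M))

  lift-lean : ∀ {v a b} → W v ≡ true → Nbr₂ A v a b → degR A a ≡ 3 → Lifts (A ⊖ v) A
  lift-lean {v} {a} {b} Wv N@(a≢b , va , vb , _) da χ one
    with shape (λ k → δ χ k a) (≤-reflexive two) | pick (λ k → δ χ k b) (δ-room Wv vb χ)
    where
    two : δ χ true a + δ χ false a ≡ 2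
    two = trans (sym (δ-sum χ a)) (suc-injective (trans (sym (deg-⊖ {A = A} (adj⇒≢ S va ∘ sym) (flip S va))) da))
  -- Without v, the vertex a has one edge of each colour and accepts any further one; so va can get
  -- the colour opposite to vb.
  ... | spare a≤1 | i , i≤1 , b-fine = fewer χ one χ₁ sub
    where
    v≢a = adj⇒≢ S va
    v≢b = adj⇒≢ S vb
    att = attach₂ S (λ _ _ → refl) N χ (not i) i (a≤1 (not i)) i≤1 (λ h → ⊥-elim (not-¬ refl (sym h)))
    χ₁ = proj₁ att
    E = proj₂ att
    two : δ χ true a + δ χ false a ≡ 2
    two = trans (sym (δ-sum χ a)) (suc-injective (trans (sym (deg-⊖ {A = A} (v≢a ∘ sym) (flip S va))) da))
    a≥1 : ∀ k → 1 ≤ δ χ k a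
    a≥1 true  = +-cancelʳ-≤ 1 1 _ (≤-trans (≤-reflexive (sym two)) (+-monoʳ-≤ (δ χ true a) (a≤1 false)))
    a≥1 false = +-cancelˡ-≤ 1 1 _ (≤-trans (≤-reflexive (sym two)) (+-monoˡ-≤ (δ χ false a) (a≤1 true)))
    sub : ∀ w → Mono χ₁ w → Mono χ w
    sub w M = go (w ≟ v) (w ≟ a) (w ≟ b)
      where
      go : Dec (w ≡ v) → Dec (w ≡ a) → Dec (w ≡ b) → Mono χ w
      go (yes refl) _ _ = ⊥-elim (mixed (λ l → ≤-trans (both-colours i l) (≤-reflexive (+-comm (bit (same i l)) _)))
          (MonoPair-cong (at-new E v≢a v≢b a≢b (δ-absent S (λ _ _ → refl) χ)) M))
      go (no _) (yes refl) _ = ⊥-elim (mixed (λ l → ≤-trans (a≥1 l) (m≤m+n _ _)) (MonoPair-cong (at-first E v≢a v≢b a≢b) M))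
      go (no _) (no _) (yes refl) = ⊥-elim (b-fine (MonoPair-cong (at-second E v≢a v≢b a≢b) M))
      go (no wv) (no wa) (no wb) = MonoPair-cong (at-other E v≢a v≢b a≢b wv wa wb) M
  -- Here a is the monochromatic vertex. Its missing colour on va cures it, and at worst v takes its
  -- place.
  ... | mono k zer two | i , i≤1 , b-fine = moved χ {a} M₀ χ₁ only
    where
    v≢a = adj⇒≢ S va
    v≢b = adj⇒≢ S vb
    M₀ : Mono χ a
    M₀ = shape⇒MonoPair {λ k → δ χ k a} k zer two
    sep : k ≡ i → Separated (class χ k) a b
    sep _ = Separated-isolated (class-sym χ (symm (⊖-simple S v)) k) (δ≡0⇒ χ k zer) (a≢b ∘ sym)
    att = attach₂ S (λ _ _ → refl) N χ k i (≤-trans (≤-reflexive zer) z≤n) i≤1 sep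
    χ₁ = proj₁ att
    E = proj₂ att
    only : ∀ w → Mono χ₁ w → w ≡ v
    only w M = go (w ≟ v) (w ≟ a) (w ≟ b)
      where
      go : Dec (w ≡ v) → Dec (w ≡ a) → Dec (w ≡ b) → w ≡ v
      go (yes e) _ _ = e
      go (no _) (yes refl) _ = ⊥-elim (mixed (by-colour {P = λ l → 1 ≤ δ χ l w + bit (same k l)} k
            (1≤+bit (δ χ k w) k) (≤-trans (≤-trans (s≤s z≤n) (≤-reflexive (sym two))) (m≤m+n _ _)))
          (MonoPair-cong (at-first E v≢a v≢b a≢b) M))
      go (no _) (no _) (yes refl) = ⊥-elim (b-fine (MonoPair-cong (at-second E v≢a v≢b a≢b) M))
      go (no wv) (no wa) (no wb) = ⊥-elim (wa (one w a (MonoPair-cong (at-other E v≢a v≢b a≢b wv wa wb) M) M₀))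

-- Putting back two vertices of degree 2

Nbr₂-⊖ : {A : Rel n} {x a b v : Fin n} → x ≢ v → a ≢ v → b ≢ v → Nbr₂ A x a b → Nbr₂ (A ⊖ v) x a b
Nbr₂-⊖ {A = A} {x} {v = v} x≢v a≢v b≢v (a≢b , xa , xb , only) =
  a≢b , ⇒⊖ A v xa x≢v a≢v , ⇒⊖ A v xb x≢v b≢v , λ w h → only w (⊖-⊆ A v x w h)

inc-part-off : ∀ k {a b z : Fin n} l → z ≢ a → inc k a b l z ≡ part k b l z
inc-part-off k {a} {b} {z} l z≢a rewrite inc-part k a b l z | ι-diff z≢a with same k l
... | true  = refl
... | false = refl

part-off : ∀ k {a z : Fin n} l → z ≢ a → part k a l z ≡ 0
part-off k l z≢a rewrite ι-diff z≢a with same k l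
... | true  = refl
... | false = refl

⊖-comm : (A : Rel n) (x y : Fin n) → A ⊖ y ⊖ x ≗ᴿ A ⊖ x ⊖ y
⊖-comm A x y u w = Bool-ext (swap x y) (swap y x)
  where
  swap : ∀ x y → (A ⊖ y ⊖ x) u w ≡ true → (A ⊖ x ⊖ y) u w ≡ true
  swap x y h with ⊖⇒ (A ⊖ y) x {u} {w} h
  ... | h′ , u≢x , w≢x with ⊖⇒ A y {u} {w} h′
  ...   | Auw , u≢y , w≢y = ⇒⊖ (A ⊖ x) y {u} {w} (⇒⊖ A x Auw u≢x w≢x) u≢y w≢y

-- The colours are p on xu, ξ on xx′, q on yu and η on yy′. The choice η = `not q` keeps y
-- bichromatic and spares a cut for its attachment. As A₂ is fixed only up to `≗ᴿ`, the same ψ can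
-- be used with x and y exchanged.
module Pair {A : Rel n} {W : Fin n → Bool} (G : GraphOn A W) {u x y x′ y′ : Fin n}
    (x≢y : x ≢ y) (x′≢y : x′ ≢ y) (y′≢x : y′ ≢ x) (Nx : Nbr₂ A x u x′) (Ny : Nbr₂ A y u y′)
    {A₂ : Rel n} (A₂≗ : A₂ ≗ᴿ A ⊖ y ⊖ x) (ψ : Colouring A₂) where

  private
    S    = simple G
    u≢x′ = proj₁ Nx
    u≢y′ = proj₁ Ny
    x≢u  = adj⇒≢ S (proj₁ (proj₂ Nx))
    x≢x′ = adj⇒≢ S (proj₁ (proj₂ (proj₂ Nx)))
    y≢u  = adj⇒≢ S (proj₁ (proj₂ Ny))
    y≢y′ = adj⇒≢ S (proj₁ (proj₂ (proj₂ Ny)))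

  module _ (p ξ q η : Bool) (η≡ : η ≡ not q) where

    record Attached : Set where
      field
        χ    : Colouring A
        at-x : ∀ l → δ χ l x ≡ bit (same p l) + bit (same ξ l)
        at-y : ∀ l → δ χ l y ≡ bit (same q l) + bit (same η l)
        at-u : ∀ l → δ χ l u ≡ δ ψ l u + bit (same p l) + bit (same q l)
        at-z : ∀ {z} → z ≢ x → z ≢ y → z ≢ u → ∀ l → δ χ l z ≡ δ ψ l z + (part ξ x′ l z + part η y′ l z)

    attach : δ ψ p u ≤ 1 → δ ψ ξ x′ ≤ 1 → (p ≡ ξ → Separated (class ψ p) u x′) →
      δ ψ q u + bit (same p q) ≤ 1 → δ ψ η y′ + inc ξ x x′ η y′ ≤ 1 → Attached
    attach pu ξx′ sep qu ηy′ = record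
      { χ    = χ₂
      ; at-x = λ l → trans (at-other E₂ y≢u y≢y′ u≢y′ x≢y x≢u (y′≢x ∘ sym) l)
                 (at-new E₁ x≢u x≢x′ u≢x′ (δ-absent S₁ A₂≗ ψ) l)
      ; at-y = at-new E₂ y≢u y≢y′ u≢y′ (δ-absent S (λ _ _ → refl) χ₁)
      ; at-u = λ l → trans (at-first E₂ y≢u y≢y′ u≢y′ l) (cong (_+ bit (same q l)) (u₁ l))
      ; at-z = λ {z} z≢x z≢y z≢u l → begin
          δ χ₂ l z
            ≡⟨ δ″ E₂ l z ⟩
          δ χ₁ l z + (inc q y u l z + inc η y y′ l z)
            ≡⟨ cong₂ _+_ (δ″ E₁ l z) (cong₂ _+_ (inc-off q l z≢y z≢u) (inc-part-off η l z≢y)) ⟩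
          δ ψ l z + (inc p x u l z + inc ξ x x′ l z) + part η y′ l z
            ≡⟨ cong (λ t → δ ψ l z + t + part η y′ l z) (cong₂ _+_ (inc-off p l z≢x z≢u) (inc-part-off ξ l z≢x)) ⟩
          δ ψ l z + part ξ x′ l z + part η y′ l z
            ≡⟨ +-assoc (δ ψ l z) _ _ ⟩
          δ ψ l z + (part ξ x′ l z + part η y′ l z) ∎ }
      where
      open ≡-Reasoning
      S₁ = ⊖-simple S y
      att₁ = attach₂ S₁ A₂≗ (Nbr₂-⊖ {A = A} x≢y (y≢u ∘ sym) x′≢y Nx) ψ p ξ pu ξx′ sep
      χ₁ = proj₁ att₁
      E₁ = proj₂ att₁
      u₁ : ∀ l → δ χ₁ l u ≡ δ ψ l u + bit (same p l)
      u₁ = at-first E₁ x≢u x≢x′ u≢x′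
      y′₁ : δ χ₁ η y′ ≡ δ ψ η y′ + inc ξ x x′ η y′
      y′₁ rewrite δ″ E₁ η y′ | inc-off p η y′≢x (u≢y′ ∘ sym) = refl
      att₂ = attach₂ S (λ _ _ → refl) Ny χ₁ q η (≤-trans (≤-reflexive (u₁ q)) qu)
        (≤-trans (≤-reflexive y′₁) ηy′) (λ q≡η → ⊥-elim (not-¬ refl (trans q≡η η≡)))
      χ₂ = proj₁ att₂
      E₂ = proj₂ att₂

    module _ (a : Attached) where
      open Attached a

      y-mixed : ¬ Mono χ y
      y-mixed = mixed (λ l → ≤-trans (≤-trans (both-colours q l)
        (≤-reflexive (cong (λ t → bit (same q l) + bit (same t l)) (sym η≡)))) (≤-reflexive (sym (at-y l))))

      only-x : (∀ l → 1 ≤ δ ψ l u + bit (same p l) + bit (same q l)) →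
        (∀ z → z ≢ x → z ≢ y → z ≢ u → ¬ MonoPair (λ l → δ ψ l z + (part ξ x′ l z + part η y′ l z))) →
        ∀ w → Mono χ w → w ≡ x
      only-x u-fine z-fine w M = go (w ≟ x) (w ≟ y) (w ≟ u)
        where
        go : Dec (w ≡ x) → Dec (w ≡ y) → Dec (w ≡ u) → w ≡ x
        go (yes e) _ _ = e
        go (no _) (yes refl) _ = ⊥-elim (y-mixed M)
        go (no _) (no _) (yes refl) = ⊥-elim (mixed u-fine (MonoPair-cong at-u M))
        go (no w≢x) (no w≢y) (no w≢u) = ⊥-elim (z-fine w w≢x w≢y w≢u (MonoPair-cong (at-z w≢x w≢y w≢u) M))

      only-old : p ≡ not ξ → (∀ l → 1 ≤ δ ψ l u + bit (same p l) + bit (same q l)) →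
        ∀ w → Mono χ w → w ≢ x × w ≢ u × MonoPair (λ l → δ ψ l w + (part ξ x′ l w + part η y′ l w))
      only-old p≡ u-fine w M = go (w ≟ x) (w ≟ y) (w ≟ u)
        where
        go : Dec (w ≡ x) → Dec (w ≡ y) → Dec (w ≡ u) → _
        go (yes refl) _ _ = ⊥-elim (mixed (λ l → ≤-trans (≤-trans (both-colours ξ l)
          (≤-reflexive (trans (+-comm (bit (same ξ l)) _) (cong (λ t → bit (same t l) + bit (same ξ l)) (sym p≡)))))
          (≤-reflexive (sym (at-x l)))) M)
        go (no _) (yes refl) _ = ⊥-elim (y-mixed M)
        go (no _) (no _) (yes refl) = ⊥-elim (mixed u-fine (MonoPair-cong at-u M))
        go (no w≢x) (no w≢y) (no w≢u) = w≢x , w≢u , MonoPair-cong (at-z w≢x w≢y w≢u) M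

bit≤1 : ∀ b → bit b ≤ 1
bit≤1 true  = ≤-refl
bit≤1 false = z≤n

inc-wrong : ∀ k {a b z : Fin n} l → same k l ≡ false → inc k a b l z ≡ 0
inc-wrong k l h rewrite h = refl

same-notˡ : ∀ k → same (not k) k ≡ false
same-notˡ true  = refl
same-notˡ false = refl

parts-off : ∀ ξ η {a b z : Fin n} m l → z ≢ a → z ≢ b → m + (part ξ a l z + part η b l z) ≡ m
parts-off ξ η m l za zb rewrite part-off ξ l za | part-off η l zb = +-identityʳ m

positive : ∀ {m k} → m ≡ suc k → 1 ≤ m
positive refl = s≤s z≤n

module _ {A : Rel n} {W : Fin n → Bool} (G : GraphOn A W) where

  private
    S = simple G

  pivot-low : ∀ {u x y} → x ≢ y → A x u ≡ true → A y u ≡ true → degR (A ⊖ y ⊖ x) u ≤ 2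
  pivot-low {u} {x} {y} x≢y xu yu = s≤s⁻¹ (s≤s⁻¹ (subst (_≤ 4) twice (maxDegree G u)))
    where
    u≢x = adj⇒≢ S xu ∘ sym
    u≢y = adj⇒≢ S yu ∘ sym
    twice : degR A u ≡ suc (suc (degR (A ⊖ y ⊖ x) u))
    twice = trans (deg-⊖ {A = A} u≢y (flip S yu)) (cong suc (deg-⊖ {A = A ⊖ y} u≢x (⇒⊖ A y (flip S xu) u≢y x≢y)))

  triangle-nbr : ∀ {u x y} → Nbr₂ A x u y → Nbr₂ A y u x → Nbr₁ (A ⊖ y) x u
  triangle-nbr {u} {x} {y} (_ , xu , xy , only) (_ , yu , _) =
    ⇒⊖ A y xu (adj⇒≢ S xy) (adj⇒≢ S yu ∘ sym) , λ w h → rest w (⊖⇒ A y {x} {w} h)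
    where
    rest : ∀ w → A x w ≡ true × x ≢ y × w ≢ y → w ≡ u
    rest w (xw , _ , w≢y) with only w xw
    ... | inj₁ e = e
    ... | inj₂ e = ⊥-elim (w≢y e)

  module _ {u x y : Fin n} (Nx : Nbr₂ A x u y) (Ny : Nbr₂ A y u x) (ψ : Colouring (A ⊖ y ⊖ x)) where

    private
      x≢u = adj⇒≢ S (proj₁ (proj₂ Nx))
      y≢u = adj⇒≢ S (proj₁ (proj₂ Ny))
      x≢y = adj⇒≢ S (proj₁ (proj₂ (proj₂ Nx)))
      S₁  = ⊖-simple S y
      N₁  = triangle-nbr Nx Ny

    -- The edges ux, uy, xy get p, q and `not q`. Thus y always sees both colours, and x is
    -- monochromatic only if p and q differ.
    extend-triangle : ∀ p q → δ ψ p u ≤ 1 → δ ψ q u + bit (same p q) ≤ 1 →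
      (∀ l → 1 ≤ δ ψ l u + bit (same p l) + bit (same q l)) →
      ∃ λ (χ : Colouring A) → ∀ w → Mono χ w →
        (w ≡ x × MonoPair (λ l → bit (same p l) + bit (same (not q) l))) ⊎ (Mono ψ w × w ≢ u)
    extend-triangle p q pu qu u-fine = χ₂ , result
      where
      e₁ = attach₁ S₁ (λ _ _ → refl) N₁ ψ p pu
      u₁ : ∀ l → δ (χ′ e₁) l u ≡ δ ψ l u + bit (same p l)
      u₁ l = trans (δ′ e₁ l u) (cong (δ ψ l u +_) (inc-right p l x≢u))
      x₁ : ∀ l → δ (χ′ e₁) l x ≡ bit (same p l)
      x₁ l = trans (δ′ e₁ l x) (cong₂ _+_ (δ-absent S₁ (λ _ _ → refl) ψ l) (inc-left p l x≢u))
      att = attach₂ S (λ _ _ → refl) Ny (χ′ e₁) q (not q) (≤-trans (≤-reflexive (u₁ q)) qu)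
        (≤-trans (≤-reflexive (x₁ (not q))) (bit≤1 (same p (not q)))) (λ h → ⊥-elim (not-¬ refl h))
      χ₂ = proj₁ att
      E = proj₂ att
      result : ∀ w → Mono χ₂ w → _
      result w M = go (w ≟ x) (w ≟ y) (w ≟ u)
        where
        go : Dec (w ≡ x) → Dec (w ≡ y) → Dec (w ≡ u) → _
        go (yes refl) _ _ = inj₁ (refl , MonoPair-cong
          (λ l → trans (at-second E y≢u (x≢y ∘ sym) (x≢u ∘ sym) l) (cong (_+ bit (same (not q) l)) (x₁ l))) M)
        go (no _) (yes refl) _ = ⊥-elim (mixed (both-colours q)
          (MonoPair-cong (at-new E y≢u (x≢y ∘ sym) (x≢u ∘ sym) (δ-absent S (λ _ _ → refl) (χ′ e₁))) M))
        go (no _) (no _) (yes refl) = ⊥-elim (mixed u-fine (MonoPair-cong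
          (λ l → trans (at-first E y≢u (x≢y ∘ sym) (x≢u ∘ sym) l) (cong (_+ bit (same q l)) (u₁ l))) M))
        go (no w≢x) (no w≢y) (no w≢u) = inj₂ (MonoPair-cong
          (λ l → trans (at-other E y≢u (x≢y ∘ sym) (x≢u ∘ sym) w≢y w≢u w≢x l)
            (trans (δ′ e₁ l w) (trans (cong (δ ψ l w +_) (inc-off p l w≢x w≢u)) (+-identityʳ _)))) M , w≢u)

    -- Both edges at u get the missing colour k and xy gets the other one; then u, x and y all see
    -- both colours.
    triangle-none : (∀ w → Mono ψ w → w ≡ u) → ∀ k → δ ψ k u ≡ 0 → 1 ≤ δ ψ (not k) u → ∃ λ (χ : Colouring A) → NoMono χ
    triangle-none only k zer pos with extend-triangle k k (≤-trans (≤-reflexive zer) z≤n)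
      (subst (λ t → t + bit (same k k) ≤ 1) (sym zer) (bit≤1 (same k k)))
      (by-colour {P = λ l → 1 ≤ δ ψ l u + bit (same k l) + bit (same k l)} k (1≤+bit _ k)
        (≤-trans pos (≤-trans (m≤m+n _ _) (m≤m+n _ _))))
    ... | χ , h = χ , λ w M → [ (λ (_ , m) → mixed (both-colours k) m) , (λ (M′ , w≢u) → w≢u (only w M′)) ]′ (h w M)

    -- As u is not monochromatic, it has room in both colours; ux and uy get different ones, and x
    -- is the only possible monochromatic vertex.
    triangle-one : NoMono ψ → ∃ λ (χ : Colouring A) → AtMostOne χ
    triangle-one none with shape (λ k → δ ψ k u) (subst (_≤ 2) (δ-sum ψ u) (pivot-low x≢y (proj₁ (proj₂ Nx)) (proj₁ (proj₂ Ny))))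
    ... | mono k zer two = ⊥-elim (none u (shape⇒MonoPair {λ k → δ ψ k u} k zer two))
    ... | spare ≤1 with extend-triangle true false (≤1 true) (≤-trans (≤-reflexive (+-identityʳ _)) (≤1 false))
      (λ { true → ≤-trans (m≤n+m 1 (δ ψ true u)) (m≤m+n _ 0) ; false → m≤n+m 1 (δ ψ false u + 0) })
    ...   | χ , h = χ , only⇒AtMostOne χ (λ w M → [ proj₁ , (λ (M′ , _) → ⊥-elim (none w M′)) ]′ (h w M))

  -- The colour k that u misses goes to ux, uy and xw, the other one to yw. This cures u, gives w
  -- both colours, and x becomes the monochromatic vertex.
  diamond-mono : ∀ {u w x y} → x ≢ y → Nbr₂ A x u w → Nbr₂ A y u w →
    (ψ : Colouring (A ⊖ y ⊖ x)) → AtMostOne ψ → ∀ k → δ ψ k u ≡ 0 → δ ψ (not k) u ≡ 2 → (∀ k → δ ψ k w ≤ 1) →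
    ∃ λ (χ : Colouring A) → AtMostOne χ × (NoMono ψ → NoMono χ)
  diamond-mono {u} {w} {x} {y} x≢y Nx@(u≢w , xu , xw , _) Ny@(_ , yu , yw , _) ψ one k zer two w≤1 =
    moved ψ Mu (Attached.χ att) (only-x k k k (not k) refl att
      (by-colour {P = λ l → 1 ≤ δ ψ l u + bit (same k l) + bit (same k l)} k (1≤+bit _ k)
        (≤-trans (positive two) (≤-trans (m≤m+n _ _) (m≤m+n _ _))))
      z-fine)
    where
    open Pair G x≢y (adj⇒≢ S yw ∘ sym) (adj⇒≢ S xw ∘ sym) Nx Ny (λ _ _ → refl) ψ
    Mu : Mono ψ u
    Mu = shape⇒MonoPair {λ k → δ ψ k u} k zer two
    att : Attached k k k (not k) refl
    att = attach k k k (not k) refl (≤-trans (≤-reflexive zer) z≤n) (w≤1 k)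
      (λ _ → Separated-isolated (class-sym ψ (symm (⊖-simple (⊖-simple S y) x)) k) (δ≡0⇒ ψ k zer) (u≢w ∘ sym))
      (subst (λ t → t + bit (same k k) ≤ 1) (sym zer) (bit≤1 (same k k)))
      (≤-trans (≤-reflexive (trans (cong (δ ψ (not k) w +_) (inc-wrong k {x} {w} {w} (not k) (same-not k))) (+-identityʳ _))) (w≤1 (not k)))
    z-fine : ∀ z → z ≢ x → z ≢ y → z ≢ u → ¬ MonoPair (λ l → δ ψ l z + (part k w l z + part (not k) w l z))
    z-fine z _ _ z≢u M = go (z ≟ w)
      where
      go : Dec (z ≡ w) → ⊥
      go (yes refl) = mixed (λ l → ≤-trans (≤-reflexive (sym (trans (part-both k w l w) (ι-same w)))) (m≤n+m _ (δ ψ l w))) M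
      go (no z≢w) = z≢u (one z u (MonoPair-cong (λ l → parts-off k (not k) _ l z≢w z≢w) M) Mu)

  lift-diamond : ∀ {u w x y} → x ≢ y → Nbr₂ A x u w → Nbr₂ A y u w → Lifts (A ⊖ y ⊖ x) A
  lift-diamond {u} {w} {x} {y} x≢y Nx@(u≢w , xu , xw , _) Ny@(_ , yu , yw , _) ψ one
    with shape (λ k → δ ψ k u) (subst (_≤ 2) (δ-sum ψ u) (pivot-low x≢y xu yu))
       | shape (λ k → δ ψ k w) (subst (_≤ 2) (δ-sum ψ w) (pivot-low x≢y xw yw))
  ... | mono k z t | mono l z′ t′ = ⊥-elim (u≢w (one u w (shape⇒MonoPair {λ k → δ ψ k u} k z t) (shape⇒MonoPair {λ k → δ ψ k w} l z′ t′)))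
  ... | mono k z t | spare w≤1 = diamond-mono x≢y Nx Ny ψ one k z t w≤1
  ... | spare u≤1 | mono k z t = diamond-mono x≢y (Nbr₂-sym {A = A} Nx) (Nbr₂-sym {A = A} Ny) ψ one k z t u≤1
  ... | spare u≤1 | spare w≤1 =
    fewer ψ one (Attached.χ att) old
    where
    open Pair G x≢y (adj⇒≢ S yw ∘ sym) (adj⇒≢ S xw ∘ sym) Nx Ny (λ _ _ → refl) ψ
    -- One colour for ux and yw, the other for xw and uy: all four vertices see both.
    att : Attached true false false true refl
    att = attach true false false true refl (u≤1 true) (w≤1 false) (λ ())
      (≤-trans (≤-reflexive (+-identityʳ _)) (u≤1 false)) (≤-trans (≤-reflexive (+-identityʳ _)) (w≤1 true))
    old : ∀ z → Mono (Attached.χ att) z → Mono ψ z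
    old z M with only-old true false false true refl att refl
      (λ { true → ≤-trans (m≤n+m 1 (δ ψ true u)) (m≤m+n _ 0) ; false → m≤n+m 1 (δ ψ false u + 0) }) z M
    ... | _ , _ , M′ = go (z ≟ w)
      where
      go : Dec (z ≡ w) → Mono ψ z
      go (yes refl) = ⊥-elim (mixed (λ l → ≤-trans (≤-reflexive (sym (trans (part-both false w l w) (ι-same w)))) (m≤n+m _ (δ ψ l w))) M′)
      go (no z≢w) = MonoPair-cong (λ l → parts-off false true _ l z≢w z≢w) M′

  -- B is A without y, with x joined to x′ and y′ instead: x stands for both old vertices.
  lift-fork : ∀ {u x y x′ y′} → x ≢ y → x′ ≢ y → y′ ≢ x → x′ ≢ y′ → Nbr₂ A x u x′ → Nbr₂ A y u y′ →
    {B : Rel n} → Simple B → Nbr₂ B x x′ y′ → A ⊖ y ⊖ x ≗ᴿ B ⊖ x → Lifts B A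
  lift-fork {u} {x} {y} {x′} {y′} x≢y x′≢y y′≢x x′≢y′ Nx@(u≢x′ , xu , xx′ , _) Ny@(u≢y′ , yu , yy′ , _) {B} SB N A₂≗ χ* one
    with detach₂ SB A₂≗ N χ*
  ... | ψ , δ* , sep = core (colour χ* x x′) (colour χ* x y′) δ* sep
    where
    x≢u = adj⇒≢ S xu
    x≢x′ = adj⇒≢ S xx′
    S₂ = symm (⊖-simple (⊖-simple S y) x)
    core : ∀ ξ η → (∀ l w → δ χ* l w ≡ δ ψ l w + (inc ξ x x′ l w + inc η x y′ l w)) →
      (ξ ≡ η → Separated (class ψ ξ) x′ y′) → ∃ λ (χ : Colouring A) → AtMostOne χ × (NoMono χ* → NoMono χ)
    core ξ η δ* sep = result (ξ ≟ᵇ η) (shape (λ k → δ ψ k u) (subst (_≤ 2) (δ-sum ψ u) (pivot-low x≢y xu yu)))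
      where
      module P = Pair G x≢y x′≢y y′≢x Nx Ny (λ _ _ → refl) ψ
      module Q = Pair G (x≢y ∘ sym) y′≢x x′≢y Ny Nx (⊖-comm A x y) ψ
      x′≤1 : δ ψ ξ x′ ≤ 1
      x′≤1 = m+n≤2∧1≤n⇒m≤1 (≤-trans (≤-reflexive (sym (δ* ξ x′))) (δ≤2 χ* ξ x′))
        (≤-trans (≤-reflexive (sym (trans (inc-right ξ ξ x≢x′) (cong bit (same-refl ξ))))) (m≤m+n _ _))
      y′≤1 : δ ψ η y′ ≤ 1
      y′≤1 = m+n≤2∧1≤n⇒m≤1 (≤-trans (≤-reflexive (sym (δ* η y′))) (δ≤2 χ* η y′))
        (≤-trans (≤-reflexive (sym (trans (inc-right η η (y′≢x ∘ sym)) (cong bit (same-refl η))))) (m≤n+m _ _))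
      x′-room : δ ψ ξ x′ + inc η y y′ ξ x′ ≤ 1
      x′-room = ≤-trans (≤-reflexive (trans (cong (δ ψ ξ x′ +_) (inc-off η ξ x′≢y x′≢y′)) (+-identityʳ _))) x′≤1
      y′-room : δ ψ η y′ + inc ξ x x′ η y′ ≤ 1
      y′-room = ≤-trans (≤-reflexive (trans (cong (δ ψ η y′ +_) (inc-off ξ η y′≢x (x′≢y′ ∘ sym))) (+-identityʳ _))) y′≤1
      -- Away from u, x and y the new colour degrees are those in B, so monochromatic vertices there
      -- are already accounted for.
      star-z : ∀ {z} → z ≢ x → ∀ l → δ ψ l z + (part ξ x′ l z + part η y′ l z) ≡ δ χ* l z
      star-z {z} z≢x l = sym (trans (δ* l z) (cong (δ ψ l z +_) (cong₂ _+_ (inc-part-off ξ l z≢x) (inc-part-off η l z≢x))))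
      star-u : ∀ l → δ ψ l u ≡ δ χ* l u
      star-u l = trans (sym (parts-off ξ η _ l u≢x′ u≢y′)) (star-z (x≢u ∘ sym) l)
      swapped : ∀ {z} l → δ ψ l z + (part η y′ l z + part ξ x′ l z) ≡ δ ψ l z + (part ξ x′ l z + part η y′ l z)
      swapped {z} l = cong (δ ψ l z +_) (+-comm (part η y′ l z) _)

      result : Dec (ξ ≡ η) → Shape (λ k → δ ψ k u) → ∃ λ (χ : Colouring A) → AtMostOne χ × (NoMono χ* → NoMono χ)
      -- x, y and u can all be made bichromatic.
      result (no ξ≢η) (spare ≤1) = fewer χ* one (P.Attached.χ att) λ z M →
        let z≢x , _ , M′ = P.only-old (not ξ) ξ ξ η η≡ att refl (λ l → ≤-trans (both-colours ξ l) (≤-trans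
              (≤-reflexive (+-comm (bit (same ξ l)) _)) (+-monoˡ-≤ (bit (same ξ l)) (m≤n+m _ (δ ψ l u))))) z M
        in MonoPair-cong (star-z {z} z≢x) M′
        where
        η≡ : η ≡ not ξ
        η≡ = ¬-not (ξ≢η ∘ sym)
        att : P.Attached (not ξ) ξ ξ η η≡
        att = P.attach (not ξ) ξ ξ η η≡ (≤1 (not ξ)) x′≤1 (λ h → ⊥-elim (not-¬ refl (sym h)))
          (≤-trans (≤-reflexive (trans (cong (λ b → δ ψ ξ u + bit b) (same-notˡ ξ)) (+-identityʳ _))) (≤1 ξ)) y′-room
      -- u is monochromatic in B, and both new edges at u get the colour that it misses.
      result (no ξ≢η) (mono k zer two) = go (k ≟ᵇ ξ)
        where
        Mu : Mono χ* u
        Mu = MonoPair-cong star-u (shape⇒MonoPair {λ k → δ ψ k u} k zer two)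
        u≤1 : δ ψ k u ≤ 1
        u≤1 = ≤-trans (≤-reflexive zer) z≤n
        u-room : δ ψ k u + bit (same k k) ≤ 1
        u-room = subst (λ t → t + bit (same k k) ≤ 1) (sym zer) (bit≤1 (same k k))
        u-fine : ∀ l → 1 ≤ δ ψ l u + bit (same k l) + bit (same k l)
        u-fine = by-colour {P = λ l → 1 ≤ δ ψ l u + bit (same k l) + bit (same k l)} k (1≤+bit _ k)
          (≤-trans (positive two) (≤-trans (m≤m+n _ _) (m≤m+n _ _)))
        u-sep : ∀ {z} → u ≢ z → Separated (class ψ k) u z
        u-sep u≢z = Separated-isolated (class-sym ψ S₂ k) (δ≡0⇒ ψ k zer) (u≢z ∘ sym)
        atP : ξ ≡ k → η ≡ not k → ∃ λ (χ : Colouring A) → AtMostOne χ × (NoMono χ* → NoMono χ)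
        atP ξ≡k η≡ = moved χ* Mu (P.Attached.χ att) (P.only-x k ξ k η η≡ att u-fine
          λ z z≢x _ z≢u M → z≢u (one z u (MonoPair-cong (star-z {z} z≢x) M) Mu))
          where
          att : P.Attached k ξ k η η≡
          att = P.attach k ξ k η η≡ u≤1 x′≤1 (λ _ → u-sep u≢x′) u-room y′-room
        atQ : η ≡ k → ξ ≡ not k → ∃ λ (χ : Colouring A) → AtMostOne χ × (NoMono χ* → NoMono χ)
        atQ η≡k ξ≡ = moved χ* Mu (Q.Attached.χ att) (Q.only-x k η k ξ ξ≡ att u-fine
          λ z _ z≢x z≢u M → z≢u (one z u (MonoPair-cong (star-z {z} z≢x) (MonoPair-cong (swapped {z}) M)) Mu))
          where
          att : Q.Attached k η k ξ ξ≡
          att = Q.attach k η k ξ ξ≡ u≤1 y′≤1 (λ _ → u-sep u≢y′) u-room x′-room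
        go : Dec (k ≡ ξ) → ∃ λ (χ : Colouring A) → AtMostOne χ × (NoMono χ* → NoMono χ)
        go (yes refl) = atP refl (¬-not (ξ≢η ∘ sym))
        go (no k≢ξ)  = atQ (trans (¬-not (ξ≢η ∘ sym)) (sym (¬-not k≢ξ))) (¬-not (k≢ξ ∘ sym))
      result (yes refl) s = go s
        where
        Mx : Mono χ* x
        Mx = MonoPair-cong {d = λ l → bit (same ξ l) + bit (same ξ l)}
          (λ l → sym (trans (δ* l x) (cong₂ _+_ (isolated-δ ψ (⊖-isolates (A ⊖ y) x) l)
            (cong₂ _+_ (inc-left ξ l x≢x′) (inc-left ξ l (y′≢x ∘ sym))))))
          (ξ , cong (λ b → bit b + bit b) (same-refl ξ) , cong (λ b → bit b + bit b) (same-not ξ))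
        -- The cut that separates x′ from y′ tells which of x and y may become monochromatic.
        go : Shape (λ k → δ ψ k u) → ∃ λ (χ : Colouring A) → AtMostOne χ × (NoMono χ* → NoMono χ)
        -- The vertex x already is the one monochromatic vertex in B, so u is not.
        go (mono k zer two) = ⊥-elim (x≢u (one x u Mx (MonoPair-cong star-u (shape⇒MonoPair {λ k → δ ψ k u} k zer two))))
        go (spare ≤1) with sep refl
        ... | f , const , fx′ , fy′ = side (f u) refl
          where
          u-room : δ ψ (not ξ) u + bit (same ξ (not ξ)) ≤ 1
          u-room = ≤-trans (≤-reflexive (trans (cong (λ b → δ ψ (not ξ) u + bit b) (same-not ξ)) (+-identityʳ _))) (≤1 (not ξ))
          u-fine : ∀ l → 1 ≤ δ ψ l u + bit (same ξ l) + bit (same (not ξ) l)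
          u-fine l = ≤-trans (both-colours ξ l) (+-monoˡ-≤ _ (m≤n+m _ (δ ψ l u)))
          ξ≡ : ξ ≡ not (not ξ)
          ξ≡ = sym (not-involutive ξ)
          side : ∀ b → f u ≡ b → ∃ λ (χ : Colouring A) → AtMostOne χ × (NoMono χ* → NoMono χ)
          side false fu = moved χ* Mx (P.Attached.χ att) (P.only-x ξ ξ (not ξ) ξ ξ≡ att u-fine
            λ z z≢x _ _ M → z≢x (one z x (MonoPair-cong (star-z {z} z≢x) M) Mx))
            where
            att : P.Attached ξ ξ (not ξ) ξ ξ≡
            att = P.attach ξ ξ (not ξ) ξ ξ≡ (≤1 ξ) x′≤1 (λ _ → Separated-sym (f , const , fx′ , fu)) u-room y′-room
          side true fu = moved χ* Mx (Q.Attached.χ att) (Q.only-x ξ ξ (not ξ) ξ ξ≡ att u-fine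
            λ z _ z≢x _ M → z≢x (one z x (MonoPair-cong (star-z {z} z≢x) (MonoPair-cong (swapped {z}) M)) Mx))
            where
            att : Q.Attached ξ ξ (not ξ) ξ ξ≡
            att = Q.attach ξ ξ (not ξ) ξ ξ≡ (≤1 ξ) y′≤1 (λ _ → f , const , fu , fy′) u-room x′-room

-- The smaller graph for the fork

degree₂ : {A : Rel n} → Simple A → ∀ {v a b} → Nbr₂ A v a b →
  ∀ w → degR A w ≡ degR (A ⊖ v) w + (ι v w + ι a w) + (ι v w + ι b w)
degree₂ {A = A} S {v} {a} {b} N@(a≢b , va , vb , _) w = trans (count-cong (rebuild₂ S N w))
  (trans (deg-⊕ (⊕-sym (symm (⊖-simple S v)) {v} {a}) (adj⇒≢ S vb) (⊖-fresh A (adj⇒≢ S va) (a≢b ∘ sym)) w)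
    (cong (_+ (ι v w + ι b w)) (deg-⊕ (symm (⊖-simple S v)) (adj⇒≢ S va) (⊖-isolates A v a) w)))

module Rewire {A : Rel n} {W : Fin n → Bool} (G : GraphOn A W) {u x y x′ y′ : Fin n}
    (x≢y : x ≢ y) (x′≢y : x′ ≢ y) (y′≢x : y′ ≢ x) (x′≢y′ : x′ ≢ y′)
    (Nx : Nbr₂ A x u x′) (Ny : Nbr₂ A y u y′) where

  private
    S    = simple G
    xu   = proj₁ (proj₂ Nx)
    xx′  = proj₁ (proj₂ (proj₂ Nx))
    yu   = proj₁ (proj₂ Ny)
    yy′  = proj₁ (proj₂ (proj₂ Ny))
    x≢x′ = adj⇒≢ S xx′
    x≢y′ = y′≢x ∘ sym
    A₂   = A ⊖ y ⊖ x
    S₂   = ⊖-simple (⊖-simple S y) x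
    C    = A₂ ⊕ (x , x′)

  B : Rel n
  B = C ⊕ (x , y′)

  private
    B⇒ : ∀ {p q} → B p q ≡ true → A₂ p q ≡ true ⊎ SameEdge x x′ p q ⊎ SameEdge x y′ p q
    B⇒ {p} {q} h with ⊕⇒ C {x} {y′} {p} {q} h
    ... | inj₂ e  = inj₂ (inj₂ e)
    ... | inj₁ h′ with ⊕⇒ A₂ {x} {x′} {p} {q} h′
    ...   | inj₂ e  = inj₂ (inj₁ e)
    ...   | inj₁ h″ = inj₁ h″

    A₂⊆B : ∀ {p q} → A₂ p q ≡ true → B p q ≡ true
    A₂⊆B {p} {q} h = ⊕-⊇ C x y′ {p} {q} (⊕-⊇ A₂ x x′ {p} {q} h)

    A₂⇒ : ∀ {p q} → A₂ p q ≡ true → A p q ≡ true × (p ≢ x × q ≢ x) × (p ≢ y × q ≢ y)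
    A₂⇒ {p} {q} h with ⊖⇒ (A ⊖ y) x {p} {q} h
    ... | h′ , p≢x , q≢x with ⊖⇒ A y {p} {q} h′
    ...   | Apq , p≢y , q≢y = Apq , (p≢x , q≢x) , (p≢y , q≢y)

    x∉ : ∀ {w} → A₂ x w ≡ true → ⊥
    x∉ {w} h = proj₁ (proj₁ (proj₂ (A₂⇒ {x} {w} h))) refl

  B-simple : Simple B
  B-simple = record
    { symm = ⊕-sym (⊕-sym (symm S₂) {x} {x′}) {x} {y′}
    ; irr  = λ v → ¬-not λ h → loop v (B⇒ {v} {v} h) }
    where
    loop : ∀ v → A₂ v v ≡ true ⊎ SameEdge x x′ v v ⊎ SameEdge x y′ v v → ⊥
    loop v (inj₁ h)                           = adj⇒≢ S₂ {v} {v} h refl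
    loop v (inj₂ (inj₁ (inj₁ (e , e′))))      = x≢x′ (trans (sym e) e′)
    loop v (inj₂ (inj₁ (inj₂ (e , e′))))      = x≢x′ (trans (sym e′) e)
    loop v (inj₂ (inj₂ (inj₁ (e , e′))))      = x≢y′ (trans (sym e) e′)
    loop v (inj₂ (inj₂ (inj₂ (e , e′))))      = x≢y′ (trans (sym e′) e)

  B-nbrs : Nbr₂ B x x′ y′
  B-nbrs = x′≢y′ , ⊕-⊇ C x y′ {x} {x′} (⊕-∋ A₂ {x} {x′} {x} {x′} (inj₁ (refl , refl))) ,
    ⊕-∋ C {x} {y′} {x} {y′} (inj₁ (refl , refl)) , λ w h → only w (B⇒ {x} {w} h)
    where
    only : ∀ w → A₂ x w ≡ true ⊎ SameEdge x x′ x w ⊎ SameEdge x y′ x w → w ≡ x′ ⊎ w ≡ y′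
    only w (inj₁ h)                      = ⊥-elim (x∉ {w} h)
    only w (inj₂ (inj₁ (inj₁ (_ , e))))  = inj₁ e
    only w (inj₂ (inj₁ (inj₂ (e , _))))  = ⊥-elim (x≢x′ e)
    only w (inj₂ (inj₂ (inj₁ (_ , e))))  = inj₂ e
    only w (inj₂ (inj₂ (inj₂ (e , _))))  = ⊥-elim (x≢y′ e)

  A₂≗ : A₂ ≗ᴿ B ⊖ x
  A₂≗ p q = Bool-ext
    (λ h → let _ , (p≢x , q≢x) , _ = A₂⇒ {p} {q} h in ⇒⊖ B x {p} {q} (A₂⊆B {p} {q} h) p≢x q≢x)
    (λ h → let Bpq , p≢x , q≢x = ⊖⇒ B x {p} {q} h in back p≢x q≢x (B⇒ {p} {q} Bpq))
    where
    back : p ≢ x → q ≢ x → A₂ p q ≡ true ⊎ SameEdge x x′ p q ⊎ SameEdge x y′ p q → A₂ p q ≡ true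
    back _   _   (inj₁ h)                     = h
    back p≢x _   (inj₂ (inj₁ (inj₁ (e , _)))) = ⊥-elim (p≢x e)
    back _   q≢x (inj₂ (inj₁ (inj₂ (_ , e)))) = ⊥-elim (q≢x e)
    back p≢x _   (inj₂ (inj₂ (inj₁ (e , _)))) = ⊥-elim (p≢x e)
    back _   q≢x (inj₂ (inj₂ (inj₂ (_ , e)))) = ⊥-elim (q≢x e)

  -- Both graphs are compared with `A₂`, which arises from A by deleting two vertices of degree 2
  -- and from B by deleting one.
  ‖B‖ : ‖ A ‖ ≡ 4 + ‖ B ‖
  ‖B‖ = trans (‖⊖‖₂ S Ny) (cong (4 +_) (trans (‖⊖‖₂ (⊖-simple S y) N₁) (sym (trans (‖⊖‖₂ B-simple B-nbrs)
    (cong (4 +_) (sym (‖‖-cong A₂≗)))))))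
    where
    N₁ = Nbr₂-⊖ {A = A} x≢y (adj⇒≢ S yu ∘ sym) x′≢y Nx

  B-graph : GraphOn B (W ∖ y)
  B-graph = record
    { simple     = B-simple
    ; inside     = λ p q h → inside-B p q (B⇒ {p} {q} h)
    ; maxDegree  = λ z → bound z (z ≟ x)
    ; degenerate = dgn }
    where
    Wx  = ⇒∖ W (inside G x u xu) x≢y
    Wx′ = ⇒∖ W (inside₂ G x x′ xx′) x′≢y
    Wy′ = ⇒∖ W (inside₂ G y y′ yy′) (adj⇒≢ S yy′ ∘ sym)
    inside-B : ∀ p q → A₂ p q ≡ true ⊎ SameEdge x x′ p q ⊎ SameEdge x y′ p q → (W ∖ y) p ≡ true
    inside-B p q (inj₁ h) = let Apq , _ , p≢y , _ = A₂⇒ {p} {q} h in ⇒∖ W (inside G p q Apq) p≢y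
    inside-B p q (inj₂ (inj₁ (inj₁ (refl , _)))) = Wx
    inside-B p q (inj₂ (inj₁ (inj₂ (refl , _)))) = Wx′
    inside-B p q (inj₂ (inj₂ (inj₁ (refl , _)))) = Wx
    inside-B p q (inj₂ (inj₂ (inj₂ (refl , _)))) = Wy′
    degB : ∀ z → degR B z ≡ degR A₂ z + (ι x z + ι x′ z) + (ι x z + ι y′ z)
    degB z = trans (degree₂ B-simple B-nbrs z) (cong (λ t → t + (ι x z + ι x′ z) + (ι x z + ι y′ z))
      (sym (count-cong (A₂≗ z))))
    degBx : degR B x ≡ 2
    degBx rewrite degB x | count-none (A₂ x) (λ w → ⊖-isolates (A ⊖ y) x w)
      | ι-same x | ι-diff x≢x′ | ι-diff x≢y′ = refl
    bound : ∀ z → Dec (z ≡ x) → degR B z ≤ 4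
    bound z (yes refl) = ≤-trans (≤-reflexive degBx) (m≤m+n 2 2)
    bound z (no z≢x)  = ≤-trans (≤-trans (≤-reflexive (degB z)) less) (maxDegree G z)
      where
      -- In B the vertex x′ keeps its edge to x, and y′ has an edge to x in place of the one to y; u
      -- only loses edges.
      less : degR A₂ z + (ι x z + ι x′ z) + (ι x z + ι y′ z) ≤ degR A z
      less = begin
        degR A₂ z + (ι x z + ι x′ z) + (ι x z + ι y′ z)
          ≡⟨ cong (λ t → degR A₂ z + (ι x z + ι x′ z) + (t + ι y′ z)) (ι-diff z≢x) ⟩
        degR A₂ z + (ι x z + ι x′ z) + ι y′ z
          ≤⟨ +-mono-≤ (+-monoˡ-≤ (ι x z + ι x′ z) (m≤m+n (degR A₂ z) (ι x z + ι u z))) (m≤n+m (ι y′ z) (ι y z)) ⟩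
        degR A₂ z + (ι x z + ι u z) + (ι x z + ι x′ z) + (ι y z + ι y′ z)
          ≡⟨ cong (_+ (ι y z + ι y′ z)) (sym (degree₂ (⊖-simple S y) (Nbr₂-⊖ {A = A} x≢y (adj⇒≢ S yu ∘ sym) x′≢y Nx) z)) ⟩
        degR (A ⊖ y) z + (ι y z + ι y′ z)
          ≤⟨ +-monoˡ-≤ (ι y z + ι y′ z) (m≤m+n (degR (A ⊖ y) z) (ι y z + ι u z)) ⟩
        degR (A ⊖ y) z + (ι y z + ι u z) + (ι y z + ι y′ z)
          ≡⟨ sym (degree₂ S Ny z) ⟩
        degR A z ∎
        where open ≤-Reasoning
    -- If P contains x, then x itself has degree 2 in B. Otherwise all edges of B inside P avoid x
    -- and are edges of A.
    dgn : Degenerate B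
    dgn P ne = go (P x) refl
      where
      go : ∀ b → P x ≡ b → ∃ λ v → P v ≡ true × countF (λ w → B v w ∧ P w) ≤ 2
      go true Px = x , Px , ≤-trans (count-mono {p = λ w → B x w ∧ P w} {q = B x} (λ w → proj₁ ∘ ∧-split (B x w))) (≤-reflexive degBx)
      go false Px with degenerate G P ne
      ... | v , Pv , le = v , Pv , ≤-trans (count-mono {p = λ w → B v w ∧ P w} {q = λ w → A v w ∧ P w} sub) le
        where
        old : ∀ w → P w ≡ true → A₂ v w ≡ true ⊎ SameEdge x x′ v w ⊎ SameEdge x y′ v w → A v w ≡ true
        old w Pw (inj₁ h) = proj₁ (A₂⇒ {v} {w} h)
        old w Pw (inj₂ (inj₁ (inj₁ (refl , _)))) = ⊥-elim (true≢false (trans (sym Pv) Px))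
        old w Pw (inj₂ (inj₁ (inj₂ (_ , refl)))) = ⊥-elim (true≢false (trans (sym Pw) Px))
        old w Pw (inj₂ (inj₂ (inj₁ (refl , _)))) = ⊥-elim (true≢false (trans (sym Pv) Px))
        old w Pw (inj₂ (inj₂ (inj₂ (_ , refl)))) = ⊥-elim (true≢false (trans (sym Pw) Px))
        sub : ∀ w → B v w ∧ P w ≡ true → A v w ∧ P w ≡ true
        sub w h with ∧-split (B v w) h
        ... | Bvw , Pw = cong₂ _∧_ (old w Pw (B⇒ {v} {w} Bvw)) Pw

none⇒AtMostOne : {A : Rel n} (χ : Colouring A) → NoMono χ → AtMostOne χ
none⇒AtMostOne χ none w w′ M _ = ⊥-elim (none w M)

empty-none : {A : Rel n} → (∀ u w → A u w ≡ false) → ∃ λ (χ : Colouring A) → NoMono χ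
empty-none none = χ , λ { w (k , two , _) → 1+n≢0 (trans (sym two) (isolated-δ χ (none w) k)) }
  where
  χ = emptyColouring none

module _ {A : Rel n} {W : Fin n → Bool} (G : GraphOn A W) {u x y z : Fin n} (x≢y : x ≢ y)
    (Nx : Nbr₂ A x u z) {y′ : Fin n} (Ny : Nbr₂ A y u y′) where

  size₁ : ∀ {m} → countF W ≡ suc m → countF (W ∖ y) ≡ m
  size₁ = countW W (inside G y u (proj₁ (proj₂ Ny)))

  ∈₁ : (W ∖ y) x ≡ true
  ∈₁ = ⇒∖ W (inside G x u (proj₁ (proj₂ Nx))) x≢y

  size₂ : ∀ {m} → countF W ≡ suc (suc m) → countF ((W ∖ y) ∖ x) ≡ m
  size₂ h = countW (W ∖ y) ∈₁ (size₁ h)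

  two-vertices : countF W ≢ 1
  two-vertices h = 1+n≢0 (trans (sym (count-∖ (W ∖ y) ∈₁)) (size₁ h))

  pivot∈ : ((W ∖ y) ∖ x) u ≡ true
  pivot∈ = ⇒∖ (W ∖ y) (⇒∖ W (inside₂ G x u (proj₁ (proj₂ Nx))) (adj⇒≢ (simple G) (proj₁ (proj₂ Ny)) ∘ sym))
    (adj⇒≢ (simple G) (proj₁ (proj₂ Nx)) ∘ sym)

pair-‖‖ : {A : Rel n} {W : Fin n → Bool} (G : GraphOn A W) → ∀ {u w x y} → x ≢ y → Nbr₂ A x u w → Nbr₂ A y u w →
  ‖ A ‖ ≡ 8 + ‖ A ⊖ y ⊖ x ‖
pair-‖‖ {A = A} G x≢y Nx Ny@(_ , yu , yw , _) = trans (‖⊖‖₂ S Ny) (cong (4 +_) (‖⊖‖₂ (⊖-simple S _)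
  (Nbr₂-⊖ {A = A} x≢y (adj⇒≢ S yu ∘ sym) (adj⇒≢ S yw ∘ sym) Nx)))
  where
  S = simple G

triangle-‖‖ : {A : Rel n} {W : Fin n → Bool} (G : GraphOn A W) → ∀ {u x y} → Nbr₂ A x u y → Nbr₂ A y u x →
  ‖ A ‖ ≡ 6 + ‖ A ⊖ y ⊖ x ‖
triangle-‖‖ {A = A} G Nx Ny = trans (‖⊖‖₂ S Ny) (cong (4 +_) (‖⊖‖₁ (⊖-simple S _) (triangle-nbr G Nx Ny)))
  where
  S = simple G

-- A monochromatic u misses the opposite colour, and at degree 1 the missing colour is the one not
-- on the single edge. Degree 3 is ruled out by the bound.
outcome⇒missing : {A : Rel n} {u : Fin n} (χ : Colouring A) → degR A u ≤ 2 →
  Mono χ u ⊎ degR A u ≡ 1 ⊎ degR A u ≡ 3 → ∃ λ k → δ χ k u ≡ 0 × 1 ≤ δ χ (not k) u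
outcome⇒missing {u = u} χ le (inj₁ (k , two , zer)) = not k , zer ,
  subst (λ k → 1 ≤ δ χ k u) (sym (not-involutive k)) (positive two)
outcome⇒missing {u = u} χ le (inj₂ (inj₁ one)) with δ χ true u in t | δ χ false u in f | trans (sym one) (δ-sum χ u)
... | zero | _ | e = true , t , ≤-reflexive (trans e (sym f))
... | suc a | zero | _ = false , f , ≤-trans (s≤s z≤n) (≤-reflexive (sym t))
... | suc zero | suc b | ()
... | suc (suc _) | suc b | ()
outcome⇒missing χ le (inj₂ (inj₂ three)) = ⊥-elim (<⇒≱ {2} ≤-refl (subst (_≤ 2) three le))

at-least-two : ∀ m {X} → 6 + X ≡ m * 4 → ∃ λ k → m ≡ suc (suc k)
at-least-two (suc (suc k)) _ = k , refl

-- Induction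

NoneFor OneFor : Rel n → Set
NoneFor A = ∃ λ (χ : Colouring A) → NoMono χ
OneFor A  = ∃ λ (χ : Colouring A) → AtMostOne χ

-- The bookkeeping of D: it is 4 + c before one vertex is deleted and c + k afterwards, if the
-- deletion takes k from twice the number of edges.
peel : ∀ c k m {X Y} → X ≡ k + Y → 4 + c + X ≡ 4 + m * 4 → c + k + Y ≡ m * 4
peel c k m {Y = Y} refl D = trans (+-assoc c k Y) (+-cancelˡ-≡ 4 _ _ D)

-- The rest would have D = 4, which `edge-bound` excludes for two or more vertices; so there are no
-- edges.
none-isolated : ∀ m {A : Rel n} {W : Fin n → Bool} (G : GraphOn A W) {v : Fin n} → (∀ w → A v w ≡ false) →
  countF (W ∖ v) ≡ m → 4 + ‖ A ⊖ v ‖ ≡ m * 4 → NoneFor A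
none-isolated (suc zero) G {v} none size D = empty-none λ u w →
  trans (⊖-vacuous (simple G) none u w) (singleton-empty (delete G v) size u w)
none-isolated (suc (suc k)) G {v} none size D = ⊥-elim (<⇒≱ (m<n+m _ {2} (s≤s z≤n))
  (≤-trans (edge-bound k (delete G v) size) (≤-reflexive (sym D))))
none-pendant : ∀ m {A : Rel n} {W : Fin n → Bool} (G : GraphOn A W) {v a : Fin n} → W v ≡ true → Nbr₁ A v a →
  countF (W ∖ v) ≡ m → 6 + ‖ A ⊖ v ‖ ≡ m * 4 → NoneFor A
none-pendant m G {v} {a} Wv N@(va , _) size D with at-least-two m D
... | k , refl with deficient-outcome k (delete G v) size D (∈W∖v G Wv va) (room G Wv va)
...   | χ , only , _ = extend-pendant G Wv N χ only

none-triangle : ∀ m {A : Rel n} {W : Fin n → Bool} (G : GraphOn A W) {u x y : Fin n} →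
  Nbr₂ A x u y → Nbr₂ A y u x → countF ((W ∖ y) ∖ x) ≡ m → 6 + ‖ A ⊖ y ⊖ x ‖ ≡ m * 4 → NoneFor A
none-triangle m {A} G {u} {x} {y} Nx@(_ , xu , xy , _) Ny@(_ , yu , _) size D with at-least-two m D
... | k , refl with deficient-outcome k (delete (delete G y) x) size D {u} (pivot∈ G (adj⇒≢ (simple G) xy) Nx Ny)
                      (m≤n⇒m≤1+n (pivot-low G (adj⇒≢ (simple G) xy) xu yu))
...   | χ , only , kind with outcome⇒missing χ (pivot-low G (adj⇒≢ (simple G) xy) xu yu) kind
...     | l , zer , pos = triangle-none G Nx Ny χ only l zer pos

pair-size : ∀ m {A : Rel n} {W : Fin n → Bool} (G : GraphOn A W) {u x y z y′ : Fin n} → x ≢ y →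
  Nbr₂ A x u z → Nbr₂ A y u y′ → countF W ≡ suc m → ∃ λ m′ → m ≡ suc m′ × countF ((W ∖ y) ∖ x) ≡ m′
pair-size zero    G x≢y Nx Ny size = ⊥-elim (two-vertices G x≢y Nx Ny size)
pair-size (suc m) G x≢y Nx Ny size = m , refl , size₂ G x≢y Nx Ny size

no-mono : ∀ m {A : Rel n} {W : Fin n → Bool} → GraphOn A W → countF W ≡ m → 8 + ‖ A ‖ ≡ m * 4 → NoneFor A
no-mono (suc m) {A} {W} G size D = solve (reduce G size)
  where
  S = simple G
  lifted : ∀ {A₀} → Lifts A₀ A → NoneFor A₀ → NoneFor A
  lifted lift (χ , none) = let χ′ , _ , keeps = lift χ (none⇒AtMostOne χ none) in χ′ , keeps none
  solve : Reducible A W → NoneFor A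
  solve (isolated {v} Wv none) = none-isolated m G none (countW W Wv size) (peel 4 0 m (‖‖-cong (⊖-vacuous S none)) D)
  solve (pendant {v} Wv N)     = none-pendant m G Wv N (countW W Wv size) (peel 4 2 m (‖⊖‖₁ S N) D)
  solve (lean {v} Wv N da)     = lifted (lift-lean G Wv N da)
    (no-mono m (delete G v) (countW W Wv size) (peel 4 4 m (‖⊖‖₂ S N) D))
  solve (triangle {u} {x} {y} Nx Ny) with pair-size m G (adj⇒≢ S (proj₁ (proj₂ (proj₂ Nx)))) Nx Ny size
  -- Two vertices are deleted: `peel` accounts for one and the cancellation of 4 for the other.
  ... | m′ , refl , size′ = none-triangle m′ G Nx Ny size′ (+-cancelˡ-≡ 4 _ _ (peel 4 6 (suc m′) (triangle-‖‖ G Nx Ny) D))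
  solve (diamond {x = x} {y} x≢y Nx Ny) with pair-size m G x≢y Nx Ny size
  ... | m′ , refl , size′ = lifted (lift-diamond G x≢y Nx Ny)
    (no-mono m′ (delete (delete G y) x) size′ (+-cancelˡ-≡ 4 _ _ (peel 4 8 (suc m′) (pair-‖‖ G x≢y Nx Ny) D)))
  solve (fork x≢y x′≢y y′≢x x′≢y′ Nx Ny) = lifted (lift-fork G x≢y x′≢y y′≢x x′≢y′ Nx Ny B-simple B-nbrs A₂≗)
    (no-mono m B-graph (size₁ G x≢y Nx Ny size) (peel 4 4 m ‖B‖ D))
    where open Rewire G x≢y x′≢y y′≢x x′≢y′ Nx Ny

-- Any vertex of degree at most 2 can be the prescribed place of the monochromatic vertex.
tight-one : ∀ m {A : Rel n} {W : Fin n → Bool} → GraphOn A W → countF W ≡ m → 6 + ‖ A ‖ ≡ m * 4 → OneFor A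
tight-one m {A} {W} G size D with at-least-two m D
... | k , refl with low G size
...   | v , Wv , le with deficient-outcome k G size D Wv (m≤n⇒m≤1+n le)
...     | χ , only , _ = χ , only⇒AtMostOne χ only

one-mono : ∀ m {A : Rel n} {W : Fin n → Bool} → GraphOn A W → countF W ≡ m → 10 + ‖ A ‖ ≡ m * 4 → OneFor A
one-mono (suc m) {A} {W} G size D = solve (reduce G size)
  where
  S = simple G
  lifted : ∀ {A₀} → Lifts A₀ A → OneFor A₀ → OneFor A
  lifted lift (χ , one) = let χ′ , one′ , _ = lift χ one in χ′ , one′
  solve : Reducible A W → OneFor A
  -- An isolated vertex takes D from 10 to 6, where one monochromatic vertex may be unavoidable, as
  -- in a triangle.
  solve (isolated {v} Wv none) = lifted (lift-isolated S none)
    (tight-one m (delete G v) (countW W Wv size) (peel 6 0 m (‖‖-cong (⊖-vacuous S none)) D))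
  solve (pendant {v} Wv N) =
    let χ , none = no-mono m (delete G v) (countW W Wv size) (peel 6 2 m (‖⊖‖₁ S N) D)
        χ′ , none′ = extend-pendant G Wv N χ (λ w M → ⊥-elim (none w M))
    in χ′ , none⇒AtMostOne χ′ none′
  solve (lean {v} Wv N da) = lifted (lift-lean G Wv N da)
    (one-mono m (delete G v) (countW W Wv size) (peel 6 4 m (‖⊖‖₂ S N) D))
  solve (triangle {u} {x} {y} Nx Ny) with pair-size m G (adj⇒≢ S (proj₁ (proj₂ (proj₂ Nx)))) Nx Ny size
  ... | m′ , refl , size′ =
    let χ , none = no-mono m′ (delete (delete G y) x) size′ (+-cancelˡ-≡ 4 _ _ (peel 6 6 (suc m′) (triangle-‖‖ G Nx Ny) D))
    in triangle-one G Nx Ny χ none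
  solve (diamond {x = x} {y} x≢y Nx Ny) with pair-size m G x≢y Nx Ny size
  ... | m′ , refl , size′ = lifted (lift-diamond G x≢y Nx Ny)
    (one-mono m′ (delete (delete G y) x) size′ (+-cancelˡ-≡ 4 _ _ (peel 6 8 (suc m′) (pair-‖‖ G x≢y Nx Ny) D)))
  solve (fork x≢y x′≢y y′≢x x′≢y′ Nx Ny) = lifted (lift-fork G x≢y x′≢y y′≢x x′≢y′ Nx Ny B-simple B-nbrs A₂≗)
    (one-mono m B-graph (size₁ G x≢y Nx Ny size) (peel 6 4 m ‖B‖ D))
    where open Rewire G x≢y x′≢y y′≢x x′≢y′ Nx Ny

-- The theorem for the given graph representation

∑-swap : (f : Fin n → Fin n → ℕ) → ∑ (λ u → ∑ (f u)) ≡ ∑ (λ v → ∑ (λ u → f u v))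
∑-swap {n} f = go (allFin n)
  where
  go : ∀ xs → sum (map (λ u → ∑ (f u)) xs) ≡ ∑ (λ v → sum (map (λ u → f u v) xs))
  go []       = sym (∑-zero n)
  go (x ∷ xs) = trans (cong (∑ (f x) +_) (go xs)) (sym (∑-+ (f x) (λ v → sum (map (λ u → f u v) xs))))

<⇒<ᵇ≡true : ∀ {a b} → a < b → (a <ᵇ b) ≡ true
<⇒<ᵇ≡true lt = T⇒≡true (<⇒<ᵇ lt)

≮⇒<ᵇ≡false : ∀ {a b} → ¬ a < b → (a <ᵇ b) ≡ false
≮⇒<ᵇ≡false {a} {b} a≮b = ¬-not λ h → a≮b (<ᵇ⇒< a b (Equivalence.from T-≡ h))

-- The function `up` keeps each edge at its smaller end only; adjacency is `up` plus its transpose,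
-- and both have the same double sum.
handshake : (G : Graph n) → ‖ adj G ‖ ≡ 2 * numEdges G
handshake {n} G = begin
  ‖ A ‖                                              ≡⟨ ∑-cong (λ u → trans (∑-cong (pointwise u)) (∑-+ (up u) (λ v → up v u))) ⟩
  ∑ (λ u → ∑ (up u) + ∑ (λ v → up v u))              ≡⟨ ∑-+ (λ u → ∑ (up u)) (λ u → ∑ (λ v → up v u)) ⟩
  numEdges G + ∑ (λ u → ∑ (λ v → up v u))            ≡⟨ cong (numEdges G +_) (sym (∑-swap up)) ⟩
  numEdges G + numEdges G                            ≡⟨ cong (numEdges G +_) (sym (+-identityʳ _)) ⟩
  2 * numEdges G                                     ∎
  where
  open ≡-Reasoning
  A = adj G
  up : Fin n → Fin n → ℕ
  up u v = bit (if toℕ u <ᵇ toℕ v then A u v else false)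
  pointwise : ∀ u v → bit (A u v) ≡ up u v + up v u
  pointwise u v with <-cmp (toℕ u) (toℕ v)
  ... | tri< lt _ gt rewrite <⇒<ᵇ≡true lt | ≮⇒<ᵇ≡false gt = sym (+-identityʳ _)
  ... | tri> lt _ gt rewrite <⇒<ᵇ≡true gt | ≮⇒<ᵇ≡false lt = cong bit (Graph.sym G u v)
  ... | tri≈ _ e _ with refl ← toℕ-injective e rewrite irrefl G u | ≮⇒<ᵇ≡false (n≮n (toℕ u)) = refl

count-all : ∀ n → countF {n} (λ _ → true) ≡ n
count-all zero    = refl
count-all (suc n) = trans (∑-suc {n} (λ _ → 1)) (cong suc (count-all n))

everything : (G : Graph n) → TwoDegenerate G → MaxDegLe G 4 → GraphOn (adj G) (λ _ → true)
everything {n} G degenerate-G maxDeg = record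
  { simple     = record { symm = Graph.sym G ; irr = irrefl G }
  ; inside     = λ _ _ _ → refl
  ; maxDegree  = maxDeg
  ; degenerate = dgn }
  where
  A = adj G
  induced : (Fin n → Bool) → Rel n
  induced P u v = A u v ∧ (P u ∧ P v)
  split : ∀ a b c → a ∧ (b ∧ c) ≡ true → a ≡ true × b ≡ true
  split true true _ _ = refl , refl
  dgn : Degenerate A
  dgn P ne with degenerate-G (record
    { inS     = P
    ; eH      = induced P
    ; eH-sym  = λ u v → cong₂ _∧_ (Graph.sym G u v) (∧-comm (P u) (P v))
    ; eH⊆G    = λ u v h → proj₁ (split (A u v) (P u) (P v) h)
    ; eH-ends = λ u v h → proj₂ (split (A u v) (P u) (P v) h) }) ne
  ... | v , Pv , le = v , Pv , subst (_≤ 2) (count-cong (λ w → cong (λ b → A v w ∧ (b ∧ P w)) Pv)) le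

-- From bridges and Boolean colours to cycles and edge colourings

lastOr-∈ : ∀ (x : Fin n) xs → lastOr x xs ∈ x ∷ xs
lastOr-∈ x []       = here refl
lastOr-∈ x (y ∷ ys) = there (lastOr-∈ y ys)

-- The bridge cut of the first edge xy is constant along the rest of the cycle, which avoids x until
-- the closing edge; that edge is not xy, as its other end is not y. So x and y would be on one
-- side.
Acyclic⇒¬Cycle : {R : Rel n} → Acyclic R → ¬ Cycle R
Acyclic⇒¬Cycle {R = R} ac C = impossible (Cycle.vs C) refl (Cycle.long C) (Cycle.distinct C) (Cycle.path C)
  where
  impossible : ∀ vs → Cycle.vs C ≡ vs → 3 ≤ length vs → Unique vs → PathIn R vs → ⊥
  impossible (x ∷ []) _ (s≤s ())
  impossible (x ∷ y ∷ []) _ (s≤s (s≤s ()))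
  impossible (x ∷ y ∷ z ∷ zs) e _ ((x≢y ∷ x∉) ∷ y∉ ∷ _) (xy , yz , path) with ac x y xy
  ... | f , const , fx≢fy = fx≢fy (trans (sym closing) (sym (along y (z ∷ zs) (yz , path) (x≢y ∷ x∉))))
    where
    level : ∀ {p q} → R p q ≡ true → x ≢ p → x ≢ q → f p ≡ f q
    level {p} {q} h x≢p x≢q with const p q h
    ... | inj₁ e              = e
    ... | inj₂ (inj₁ (e , _)) = ⊥-elim (x≢p (sym e))
    ... | inj₂ (inj₂ (_ , e)) = ⊥-elim (x≢q (sym e))
    along : ∀ p ps → PathIn R (p ∷ ps) → All (x ≢_) (p ∷ ps) → f p ≡ f (lastOr p ps)
    along p []       _        _                 = refl
    along p (q ∷ qs) (h , hs) (x≢p ∷ x≢q ∷ x≢) = trans (level h x≢p x≢q) (along q qs hs (x≢q ∷ x≢))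
    closing : f (lastOr z zs) ≡ f x
    closing with const (lastOr z zs) x (Cycle.closes C x (y ∷ z ∷ zs) e)
    ... | inj₁ h              = h
    ... | inj₂ (inj₁ (_ , h)) = ⊥-elim (x≢y h)
    ... | inj₂ (inj₂ (h , _)) = ⊥-elim (All.lookup y∉ (lastOr-∈ z zs) (sym h))

module _ (G : Graph n) (χ : Colouring (adj G)) where

  private
    A = adj G

    name : Bool → Fin 2
    name true  = zero
    name false = suc zero

    number : Fin 2 → Bool
    number zero    = true
    number (suc _) = false

  edgeColouring : EdgeColouring G
  edgeColouring = record
    { col     = λ u v → name (colour χ u v)
    ; col-sym = λ u v _ → cong name (colour-sym χ u v) }

  class≗ : ∀ i → colourClass edgeColouring i ≗ᴿ class χ (number i)
  class≗ zero u v with colour χ u v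
  ... | true  = refl
  ... | false = refl
  class≗ (suc zero) u v with colour χ u v
  ... | true  = refl
  ... | false = refl

  linear : Is2Linear edgeColouring
  linear i = (λ v → subst (_≤ 2) (sym (count-cong (class≗ i v))) (δ≤2 χ (number i) v)) ,
    Acyclic⇒¬Cycle (Acyclic-⊆ (λ u v h → trans (sym (class≗ i u v)) h) (acyclic χ (number i)))

  Monochromatic⇒Mono : ∀ {v} → Monochromatic G edgeColouring v → Mono χ v
  Monochromatic⇒Mono {v} (d , equal) with extract₂ (A v) d
  ... | a , _ , _ , va , _ = k , trans (sym (+-identityʳ _)) (trans (cong (δ χ k v +_) (sym others)) (trans (sym (δ-sum′ χ k v)) d)) , others
    where
    k = colour χ v a
    name-injective : ∀ {b c} → name b ≡ name c → b ≡ c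
    name-injective {true}  {true}  _ = refl
    name-injective {false} {false} _ = refl
    others : δ χ (not k) v ≡ 0
    others = count-none (class χ (not k) v) none
      where
      none : ∀ w → class χ (not k) v w ≡ false
      none w with A v w in vw
      ... | false = refl
      ... | true rewrite name-injective {colour χ v w} {k} (equal w a vw va) = same-notˡ k

double : ∀ k e → 2 * (3 + e + k) ≡ (6 + 2 * k) + 2 * e
double = solve 2 (λ k e → con 2 :* (con 3 :+ e :+ k) := (con 6 :+ con 2 :* k) :+ con 2 :* e) refl
  where open +-*-Solver

-- With k = 2|V| - 3 - |E| one has D = 6 + 2k, and the hypothesis leaves k ≤ 2. The edge bound that
-- gives k ≥ 0 needs two vertices, so the orders 0 and 1 are separate.
one-for-all : ∀ n (G : Graph n) → TwoDegenerate G → MaxDegLe G 4 → 2 * n ∸ 5 ≤ numEdges G → OneFor (adj G)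
one-for-all zero G _ _ _ = let χ , none = empty-none {A = adj G} (λ ()) in χ , none⇒AtMostOne χ none
one-for-all (suc zero) G dgn maxDeg _ =
  let χ , none = empty-none (singleton-empty (everything G dgn maxDeg) (count-all 1)) in χ , none⇒AtMostOne χ none
one-for-all (suc (suc m)) G dgn maxDeg many = cases (m≤n⇒∃[o]m+o≡n upper)
  where
  order = suc (suc m)
  e = numEdges G
  H = everything G dgn maxDeg
  n*4 : order * 4 ≡ 2 * (2 * order)
  n*4 = trans (*-comm order 4) (*-assoc 2 2 order)
  upper : 3 + e ≤ 2 * order
  upper = *-cancelˡ-≤ 2 (begin
    2 * (3 + e)       ≡⟨ *-distribˡ-+ 2 3 e ⟩
    6 + 2 * e         ≡⟨ cong (6 +_) (sym (handshake G)) ⟩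
    6 + ‖ adj G ‖     ≤⟨ edge-bound m H (count-all order) ⟩
    order * 4             ≡⟨ n*4 ⟩
    2 * (2 * order)       ∎)
    where open ≤-Reasoning
  -- This inequality also holds where the subtraction in the hypothesis is truncated at 0.
  lower : 2 * order ≤ 5 + e
  lower = ≤-trans (m≤n+m∸n (2 * order) 5) (+-monoʳ-≤ 5 many)
  count-edges : ∀ k → 3 + e + k ≡ 2 * order → (6 + 2 * k) + ‖ adj G ‖ ≡ order * 4
  count-edges k h = trans (cong ((6 + 2 * k) +_) (handshake G)) (trans (sym (double k e)) (trans (cong (2 *_) h) (sym n*4)))
  cases : (∃ λ k → 3 + e + k ≡ 2 * order) → OneFor (adj G)
  cases (0 , h) = tight-one order H (count-all order) (count-edges 0 h)
  cases (1 , h) = let χ , none = no-mono order H (count-all order) (count-edges 1 h) in χ , none⇒AtMostOne χ none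
  cases (2 , h) = one-mono order H (count-all order) (count-edges 2 h)
  cases (suc (suc (suc k)) , h) = ⊥-elim (<⇒≱ (s≤s (s≤s (s≤s (s≤s (s≤s (s≤s (m≤m+n e k)))))))
    (≤-trans (≤-reflexive (trans (shift k) h)) lower))
    where
    shift : ∀ k → 6 + (e + k) ≡ 3 + e + (3 + k)
    shift k = solve 2 (λ e k → con 6 :+ (e :+ k) := con 3 :+ e :+ (con 3 :+ k)) refl e k
      where open +-*-Solver

theorem3 : (n : ℕ) (G : Graph n) → TwoDegenerate G → MaxDegLe G 4 →
    2 * n ∸ 5 ≤ numEdges G →
    Σ (EdgeColouring G) λ c → Is2Linear c ×
    (∀ u v → Monochromatic G c u → Monochromatic G c v → u ≡ v)
theorem3 n G dgn maxDeg many with one-for-all n G dgn maxDeg many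
... | χ , one = edgeColouring G χ , linear G χ ,
  λ u v Mu Mv → one u v (Monochromatic⇒Mono G χ Mu) (Monochromatic⇒Mono G χ Mv)
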